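{- Let $\mathbf{x}$ be a recurrent infinite binary word having property $\mathrm{TM}(k)$ for some $k\ge 1$. Then there exists an infinite binary word $\mathbf{y}$ such that $\mathbf{x}=u\varphi^k(\mathbf{y})$, where $u$ is a proper (possibly empty) suffix of $\varphi^k(0)$ or of $\varphi^k(1)$.
   Context: $\varphi$ is the Thue--Morse morphism $0\mapsto01$, $1\mapsto10$ and $\mathbf{t}$ its fixed point starting with $0$. For words $u,w$, $\binom{u}{w}$ is the number of occurrences of $w$ as a scattered subword of $u$; $u\sim_j v$ if $\binom{u}{x}=\binom{v}{x}$ for all words $x$ of length at most $j$. The $j$-binomial complexity $b^{(j)}_{\mathbf{x}}(n)$ of an infinite word $\mathbf{x}$ is the number of $\sim_j$-classes among its length-$n$ factors. A binary word $\mathbf{x}$ has property $\mathrm{TM}(k)$ if $b^{(j)}_{\mathbf{x}}=b^{(j)}_{\mathbf{t}}$ for all $1\le j\le k$. A word is recurrent if each of its factors occurs infinitely often in it. -}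

module Defs where

open import Data.Bool using (Bool; true; false; not; if_then_else_)
open import Data.Nat using (ℕ; zero; suc; _+_; _≤_; _<_)
open import Data.List using (List; []; _∷_; _++_; length; concatMap)
open import Data.Fin using (Fin)
open import Data.Product using (Σ; ∃; _×_; _,_)
open import Data.Sum using (_⊎_)
open import Relation.Binary.PropositionalEquality using (_≡_; _≢_)
open import Relation.Nullary using (¬_)

-- Binary letters: false = 0, true = 1.  Infinite binary words: ℕ → Bool.
Word : Set
Word = List Bool

InfWord : Set
InfWord = ℕ → Bool

φ₁ : Bool → Word
φ₁ a = a ∷ not a ∷ []

φ : Word → Word
φ = concatMap φ₁

φ^ : ℕ → Word → Word
φ^ zero w = w
φ^ (suc k) w = φ^ k (φ w)

φ∞ : InfWord → InfWord
φ∞ y zero = y zero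
φ∞ y (suc zero) = not (y zero)
φ∞ y (suc (suc n)) = φ∞ (λ m → y (suc m)) n

φ∞^ : ℕ → InfWord → InfWord
φ∞^ zero y = y
φ∞^ (suc k) y = φ∞^ k (φ∞ y)

at : Word → ℕ → Bool
at [] _ = false
at (a ∷ w) zero = a
at (a ∷ w) (suc n) = at w n

-- Thue–Morse word t: the limit of φ^n(0); its n-th letter is the n-th letter of φ^(n+1)(0)
-- (which has length 2^(n+1) > n).
𝐭 : InfWord
𝐭 n = at (φ^ (suc n) (false ∷ [])) n

_·_ : Word → InfWord → InfWord
([] · s) n = s n
((a ∷ u) · s) zero = a
((a ∷ u) · s) (suc n) = (u · s) n

-- binomial coefficient of words (number of occurrences of w as a scattered subword of u)
binom : Word → Word → ℕ
binom u [] = 1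
binom [] (b ∷ w) = 0
binom (a ∷ u) (b ∷ w) =
  binom u (b ∷ w) + (if eqB a b then binom u w else 0)
  where
  eqB : Bool → Bool → Bool
  eqB false false = true
  eqB true true = true
  eqB _ _ = false

_∼[_]_ : Word → ℕ → Word → Set
u ∼[ j ] v = ∀ (w : Word) → length w ≤ j → binom u w ≡ binom v w

fac : InfWord → ℕ → ℕ → Word
fac x i zero = []
fac x i (suc n) = x i ∷ fac x (suc i) n

IsFactor : InfWord → Word → Set
IsFactor x w = ∃ λ i → fac x i (length w) ≡ w

-- "b^(j)_x(n) = m": there are exactly m ∼_j-classes among the length-n factors of x,
-- i.e. there are m pairwise non-equivalent length-n factors such that every
-- length-n factor is equivalent to one of them.
BinomComplexity : InfWord → ℕ → ℕ → ℕ → Set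
BinomComplexity x j n m =
  Σ (Fin m → Word) λ r →
    (∀ i → IsFactor x (r i) × length (r i) ≡ n)
    × (∀ i i′ → i ≢ i′ → ¬ (r i ∼[ j ] r i′))
    × (∀ w → IsFactor x w → length w ≡ n → ∃ λ i → w ∼[ j ] r i)

SameBinomComplexity : ℕ → InfWord → InfWord → Set
SameBinomComplexity j x y =
  ∀ n → ∃ λ m → BinomComplexity x j n m × BinomComplexity y j n m

TM : ℕ → InfWord → Set
TM k x = ∀ j → 1 ≤ j → j ≤ k → SameBinomComplexity j x 𝐭

Recurrent : InfWord → Set
Recurrent x = ∀ i n N → ∃ λ i′ → N ≤ i′ × fac x i′ n ≡ fac x i n

ProperSuffix : Word → Word → Set
ProperSuffix u w = ∃ λ v → v ≢ [] × v ++ u ≡ w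

{-# OPTIONS --safe #-}
module Submission where

-- By induction on k, a tail of x is φ^k(y), and TM(k+1) has to force y itself to be φ(y′) or
-- a φ(y′).  This holds as soon as y contains a square and every window of odd length 2m + 1 in
-- y has m or m + 1 ones, because then all squares of y start at positions of the same parity.
--
-- The ∼_{k+1}-class of a window of φ^k(y) determines, and is determined by, its offset in
-- the first block, the letters of y whose blocks it meets only partially, and the number of
-- ones in y among the blocks it meets; the only exceptions come from 000 and 111 in y.  For
-- "determines", the sums of C(i, s) over the positions i of the ones are equal for s ≤ k;
-- the sums for s ≤ 1 detect the alignment with the blocks of φ, and those for s ≤ k of φ(w)
-- yield those for s < k of w.
--
-- Suppose the windows of length 2m + 1 in y are balanced.  Comparing the numbers of classes of
-- length (2m + 2)·2ᵏ in φ^k(y) and in t shows that y has windows of length 2m + 2 with m and with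
-- m + 2 ones.  If a window of length 2m + 3 were not balanced, then by recurrence φ^k(y) would
-- have more classes of length (2m + 2)·2ᵏ + 1 than t.

open import Defs
open import Data.Bool using (Bool; true; false; not)
open import Data.Bool.Properties using (not-involutive; not-¬; ¬-not) renaming (_≟_ to _≟ᵇ_)
open import Data.Nat using (ℕ; zero; suc; _+_; _*_; _∸_; _^_; _≤_; _<_; z≤n; s≤s; z<s; s<s; _<?_; _≤?_; NonZero; >-nonZero)
open import Data.Nat.Properties
open import Data.Nat.DivMod using (_/_; _%_; m%n<n; m≡m%n+[m/n]*n)
open import Data.Nat.Tactic.RingSolver using (solve-∀)
open import Data.Fin as Fin using (Fin; toℕ; fromℕ<; inject≤)
open import Data.Fin.Patterns using (0F; 1F; 2F; 3F; 4F; 5F)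
open import Data.Fin.Properties using (injective⇒≤; toℕ-injective; toℕ<n; fromℕ<-injective; inject≤-injective; any?; +↔⊎; *↔×; 1↔⊤; 2↔Bool)
  renaming (suc-injective to Fin-suc-injective)
open import Data.List using ([]; _∷_; _++_; length; replicate)
open import Data.List.Properties using (length-++; ++-assoc; ∷-injective; concatMap-++)
open import Data.List.Relation.Binary.Permutation.Propositional using (_↭_; ↭-sym; ↭-trans) renaming (refl to ↭-refl; prep to ↭-prep; swap to ↭-swap; trans to ↭-trans′)
open import Data.List.Relation.Binary.Permutation.Propositional.Properties using (shift)
open import Data.Product using (∃; _×_; _,_; proj₁; proj₂)
open import Data.Product.Function.NonDependent.Propositional using (_×-↔_)
open import Data.Sum using (_⊎_; inj₁; inj₂)
open import Data.Sum.Function.Propositional using (_⊎-↔_)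
open import Data.Sum.Properties using (inj₁-injective; inj₂-injective)
open import Data.Unit using (⊤; tt)
open import Data.Empty using (⊥; ⊥-elim)
open import Function using (_∘_)
open import Function.Bundles using (_↔_; Inverse)
open import Function.Construct.Composition using (_↔-∘_)
open import Function.Construct.Identity using (↔-id)
open import Function.Construct.Symmetry using (↔-sym)
open import Relation.Nullary using (¬_; Dec; yes; no; contradiction)
open import Relation.Nullary.Decidable using (_×-dec_; ¬?)
open import Relation.Binary.PropositionalEquality

-- Binomial coefficients of words

-- Recurrence of `x` does not pass to `y` for free, because a prefix of `x` might return at a place
-- that cuts the blocks. The induction therefore carries a range such that a prefix of that length
-- returns only at multiples of 2ᵏ. The square found in `y` improves this to 2ᵏ⁺¹: a return after an
-- odd number of blocks would copy the square to a position of the wrong parity. The exceptions come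
-- from φ(000) and φ(111) being the same alternating word up to a shift by one letter. They can
-- disturb the counts only for m = 0, since balanced windows of length 3 exclude cubes. For k = 0 a
-- block is a single letter and 0 is the only offset, so the counting arguments for offsets inside a
-- block say nothing; this case is treated separately throughout.

bit : Bool → ℕ
bit false = 0
bit true = 1

-- The Kronecker delta of two letters, a factor in place of the `if` in `binom`, so that the
-- recursion becomes linear.
δ : Bool → Bool → ℕ
δ true b = bit b
δ false b = bit (not b)

binom-∷ : ∀ a u b w → binom (a ∷ u) (b ∷ w) ≡ binom u (b ∷ w) + δ a b * binom u w
binom-∷ true u true w = cong (binom u (true ∷ w) +_) (sym (+-identityʳ _))
binom-∷ true u false w = refl
binom-∷ false u true w = refl
binom-∷ false u false w = cong (binom u (false ∷ w) +_) (sym (+-identityʳ _))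

-- conv f g w = Σ f(w₁) g(w₂) over the factorizations w = w₁ w₂; conv° omits w₂ = [].
conv conv° : (Word → ℕ) → (Word → ℕ) → Word → ℕ
conv f g [] = f [] * g []
conv f g (b ∷ w) = f [] * g (b ∷ w) + conv (λ u → f (b ∷ u)) g w
conv° f g [] = 0
conv° f g (b ∷ w) = f [] * g (b ∷ w) + conv° (λ u → f (b ∷ u)) g w

conv-last : ∀ f g w → conv f g w ≡ conv° f g w + f w * g []
conv-last f g [] = refl
conv-last f g (b ∷ w) =
  trans (cong (f [] * g (b ∷ w) +_) (conv-last (λ u → f (b ∷ u)) g w))
        (sym (+-assoc (f [] * g (b ∷ w)) _ _))

-- With the factorization w₂ = [] left out, the first factor only sees proper prefixes of w. This
-- strict bound makes the cancellation of suffixes possible and gains the one letter in `++-comm-∼`.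
conv°-cong : ∀ w {f f′ g g′ : Word → ℕ} →
  (∀ u → length u < length w → f u ≡ f′ u) →
  (∀ u → length u ≤ length w → g u ≡ g′ u) → conv° f g w ≡ conv° f′ g′ w
conv°-cong [] _ _ = refl
conv°-cong (b ∷ w) p q =
  cong₂ _+_ (cong₂ _*_ (p [] z<s) (q (b ∷ w) ≤-refl))
    (conv°-cong w (λ u l → p (b ∷ u) (s<s l)) (λ u l → q u (m≤n⇒m≤1+n l)))

conv-zero : ∀ g w → conv (λ _ → 0) g w ≡ 0
conv-zero g [] = refl
conv-zero g (b ∷ w) = conv-zero g w

conv-linear : ∀ d f f′ g w →
  conv (λ u → f u + d * f′ u) g w ≡ conv f g w + d * conv f′ g w
conv-linear d f f′ g [] = lemma d (f []) (f′ []) (g [])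
  where
  lemma : ∀ d x y z → (x + d * y) * z ≡ x * z + d * (y * z)
  lemma = solve-∀
conv-linear d f f′ g (b ∷ w) =
  trans (cong ((f [] + d * f′ []) * g (b ∷ w) +_)
              (conv-linear d (λ u → f (b ∷ u)) (λ u → f′ (b ∷ u)) g w))
        (lemma d (f []) (f′ []) (g (b ∷ w)) _ _)
  where
  lemma : ∀ d x y z s t → (x + d * y) * z + (s + d * t) ≡ x * z + s + d * (y * z + t)
  lemma = solve-∀

conv-congˡ : ∀ w {f f′ g : Word → ℕ} → (∀ u → f u ≡ f′ u) → conv f g w ≡ conv f′ g w
conv-congˡ w {f} {f′} {g} p =
  trans (conv-last f g w)
    (trans (cong₂ _+_ (conv°-cong w (λ u _ → p u) (λ _ _ → refl)) (cong (_* g []) (p w)))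
           (sym (conv-last f′ g w)))

binom-++ : ∀ u v w → binom (u ++ v) w ≡ conv (binom u) (binom v) w
binom-++ [] v [] = refl
binom-++ [] v (b ∷ w) =
  trans (sym (+-identityʳ _))
        (cong₂ _+_ (sym (*-identityˡ _)) (sym (conv-zero (binom v) w)))
binom-++ (a ∷ u) v [] = refl
binom-++ (a ∷ u) v (b ∷ w) = begin
  binom (a ∷ u ++ v) (b ∷ w)
    ≡⟨ binom-∷ a (u ++ v) b w ⟩
  binom (u ++ v) (b ∷ w) + δ a b * binom (u ++ v) w
    ≡⟨ cong₂ (λ s t → s + δ a b * t) (binom-++ u v (b ∷ w)) (binom-++ u v w) ⟩
  1 * binom v (b ∷ w) + conv (λ w′ → binom u (b ∷ w′)) (binom v) w
    + δ a b * conv (binom u) (binom v) w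
    ≡⟨ +-assoc (1 * binom v (b ∷ w)) _ _ ⟩
  1 * binom v (b ∷ w) + (conv (λ w′ → binom u (b ∷ w′)) (binom v) w
    + δ a b * conv (binom u) (binom v) w)
    ≡⟨ cong (1 * binom v (b ∷ w) +_)
         (sym (conv-linear (δ a b) (λ w′ → binom u (b ∷ w′)) (binom u) (binom v) w)) ⟩
  1 * binom v (b ∷ w) + conv (λ w′ → binom u (b ∷ w′) + δ a b * binom u w′) (binom v) w
    ≡⟨ cong (1 * binom v (b ∷ w) +_) (conv-congˡ w (λ w′ → sym (binom-∷ a u b w′))) ⟩
  conv (binom (a ∷ u)) (binom v) (b ∷ w) ∎
  where open ≡-Reasoning

∼-refl : ∀ {j u} → u ∼[ j ] u
∼-refl w _ = refl

∼-reflexive : ∀ {j u v} → u ≡ v → u ∼[ j ] v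
∼-reflexive refl w _ = refl

∼-sym : ∀ {j u v} → u ∼[ j ] v → v ∼[ j ] u
∼-sym p w l = sym (p w l)

∼-trans : ∀ {j u v w} → u ∼[ j ] v → v ∼[ j ] w → u ∼[ j ] w
∼-trans p q w l = trans (p w l) (q w l)

∼-∷ : ∀ {j} a {u v} → u ∼[ j ] v → (a ∷ u) ∼[ j ] (a ∷ v)
∼-∷ a p [] l = refl
∼-∷ a {u} {v} p (b ∷ w) l =
  trans (binom-∷ a u b w)
    (trans (cong₂ (λ s t → s + δ a b * t) (p (b ∷ w) l) (p w (≤-trans (n≤1+n _) l)))
           (sym (binom-∷ a v b w)))

-- Induction on the test word: once the counts of `w` agree, the terms that use the first letter
-- cancel and leave the counts of `b ∷ w`.
∼-∷⁻ : ∀ {j} a {u v} → (a ∷ u) ∼[ j ] (a ∷ v) → u ∼[ j ] v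
∼-∷⁻ a p [] l = refl
∼-∷⁻ a {u} {v} p (b ∷ w) l = +-cancelʳ-≡ (δ a b * binom u w) _ _
  (trans (sym (binom-∷ a u b w))
    (trans (p (b ∷ w) l)
      (trans (binom-∷ a v b w)
        (cong (λ t → binom v (b ∷ w) + δ a b * t)
          (sym (∼-∷⁻ a p w (≤-trans (n≤1+n _) l)))))))

∼-++ˡ : ∀ {j} p {u v} → u ∼[ j ] v → (p ++ u) ∼[ j ] (p ++ v)
∼-++ˡ [] q = q
∼-++ˡ (a ∷ p) q = ∼-∷ a (∼-++ˡ p q)

∼-++ˡ⁻ : ∀ {j} p {u v} → (p ++ u) ∼[ j ] (p ++ v) → u ∼[ j ] v
∼-++ˡ⁻ [] q = q
∼-++ˡ⁻ (a ∷ p) q = ∼-++ˡ⁻ p (∼-∷⁻ a q)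

∼-++ʳ : ∀ {j} s {u v} → u ∼[ j ] v → (u ++ s) ∼[ j ] (v ++ s)
∼-++ʳ s {u} {v} p w l = begin
  binom (u ++ s) w                                       ≡⟨ binom-++ u s w ⟩
  conv (binom u) (binom s) w                             ≡⟨ conv-last (binom u) (binom s) w ⟩
  conv° (binom u) (binom s) w + binom u w * 1
    ≡⟨ cong₂ (λ s t → s + t * 1)
         (conv°-cong w (λ w′ l′ → p w′ (≤-trans (<⇒≤ l′) l)) (λ _ _ → refl)) (p w l) ⟩
  conv° (binom v) (binom s) w + binom v w * 1            ≡⟨ sym (conv-last (binom v) (binom s) w) ⟩
  conv (binom v) (binom s) w                             ≡⟨ sym (binom-++ v s w) ⟩
  binom (v ++ s) w ∎
  where open ≡-Reasoning

-- In the convolution the count of w in u alone is the extreme term; every other term involves a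
-- shorter prefix of w, settled by strong induction on its length.
∼-++ʳ⁻ : ∀ {j} s {u v} → (u ++ s) ∼[ j ] (v ++ s) → u ∼[ j ] v
∼-++ʳ⁻ {j} s {u} {v} p w l = go (suc (length w)) w ≤-refl l
  where
  go : ∀ n w → length w < n → length w ≤ j → binom u w ≡ binom v w
  go (suc n) w (s≤s l<n) l = *-cancelʳ-≡ _ _ 1 (+-cancelˡ-≡ (conv° (binom u) (binom s) w) _ _ (begin
    conv° (binom u) (binom s) w + binom u w * 1          ≡⟨ sym (conv-last (binom u) (binom s) w) ⟩
    conv (binom u) (binom s) w                           ≡⟨ sym (binom-++ u s w) ⟩
    binom (u ++ s) w                                     ≡⟨ p w l ⟩
    binom (v ++ s) w                                     ≡⟨ binom-++ v s w ⟩
    conv (binom v) (binom s) w                           ≡⟨ conv-last (binom v) (binom s) w ⟩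
    conv° (binom v) (binom s) w + binom v w * 1
      ≡⟨ cong (_+ binom v w * 1)
           (conv°-cong w
             (λ w′ l′ → sym (go n w′ (<-≤-trans l′ l<n) (≤-trans (<⇒≤ l′) l)))
             (λ _ _ → refl)) ⟩
    conv° (binom u) (binom s) w + binom v w * 1 ∎))
    where open ≡-Reasoning

-- In Σ binom u w₁ · binom v w₂ every proper factorization of w only involves words of
-- length at most k, on which u and v agree; the two extreme terms are exchanged.
++-comm-∼ : ∀ {k} u v → u ∼[ k ] v → (u ++ v) ∼[ suc k ] (v ++ u)
++-comm-∼ u v p [] l = refl
++-comm-∼ u v p (b ∷ w) (s≤s l) = begin
  binom (u ++ v) (b ∷ w)                  ≡⟨ expand u v ⟩
  binom v (b ∷ w) + conv° (λ w′ → binom u (b ∷ w′)) (binom v) w + binom u (b ∷ w)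
    ≡⟨ cong (λ t → binom v (b ∷ w) + t + binom u (b ∷ w))
         (conv°-cong w (λ w′ l′ → p (b ∷ w′) (≤-trans l′ l))
                       (λ w′ l′ → sym (p w′ (≤-trans l′ l)))) ⟩
  binom v (b ∷ w) + conv° (λ w′ → binom v (b ∷ w′)) (binom u) w + binom u (b ∷ w)
    ≡⟨ lemma (binom v (b ∷ w)) _ (binom u (b ∷ w)) ⟩
  binom u (b ∷ w) + conv° (λ w′ → binom v (b ∷ w′)) (binom u) w + binom v (b ∷ w)
    ≡⟨ sym (expand v u) ⟩
  binom (v ++ u) (b ∷ w) ∎
  where
  open ≡-Reasoning
  lemma : ∀ x y z → x + y + z ≡ z + y + x
  lemma = solve-∀
  expand : ∀ u v → binom (u ++ v) (b ∷ w) ≡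
    binom v (b ∷ w) + conv° (λ w′ → binom u (b ∷ w′)) (binom v) w + binom u (b ∷ w)
  expand u v = trans (binom-++ u v (b ∷ w)) (trans (conv-last (binom u) (binom v) (b ∷ w))
    (cong₂ (λ s t → s + conv° (λ w′ → binom u (b ∷ w′)) (binom v) w + t)
      (*-identityˡ (binom v (b ∷ w))) (*-identityʳ (binom u (b ∷ w)))))

-- Numbers of ones and permutations of blocks

ones : Word → ℕ
ones [] = 0
ones (a ∷ w) = bit a + ones w

ones-++ : ∀ u v → ones (u ++ v) ≡ ones u + ones v
ones-++ [] v = refl
ones-++ (a ∷ u) v = trans (cong (bit a +_) (ones-++ u v)) (sym (+-assoc (bit a) _ _))

ones≤length : ∀ w → ones w ≤ length w
ones≤length [] = z≤n
ones≤length (true ∷ w) = s≤s (ones≤length w)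
ones≤length (false ∷ w) = m≤n⇒m≤1+n (ones≤length w)

φ^-++ : ∀ k u v → φ^ k (u ++ v) ≡ φ^ k u ++ φ^ k v
φ^-++ zero u v = refl
φ^-++ (suc k) u v = trans (cong (φ^ k) (concatMap-++ φ₁ u v)) (φ^-++ k (φ u) (φ v))

-- The images of 0 and 1 under φ^(k+1) are the two concatenations of their images under φ^k, so
-- `++-comm-∼` raises the level by one.
φ^-images-∼ : ∀ k → φ^ k (false ∷ []) ∼[ k ] φ^ k (true ∷ [])
φ^-images-∼ zero [] _ = refl
φ^-images-∼ (suc k) =
  ∼-trans (∼-reflexive (φ^-++ k (false ∷ []) (true ∷ [])))
    (∼-trans (++-comm-∼ (φ^ k (false ∷ [])) (φ^ k (true ∷ [])) (φ^-images-∼ k))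
             (∼-reflexive (sym (φ^-++ k (true ∷ []) (false ∷ [])))))

φ^-swap-∼ : ∀ k a b → φ^ k (a ∷ b ∷ []) ∼[ suc k ] φ^ k (b ∷ a ∷ [])
φ^-swap-∼ k true true = ∼-refl
φ^-swap-∼ k false false = ∼-refl
φ^-swap-∼ k false true = φ^-images-∼ (suc k)
φ^-swap-∼ k true false = ∼-sym (φ^-images-∼ (suc k))

-- A permutation is a chain of swaps of neighbours, and swapping two neighbouring blocks costs
-- nothing up to level k + 1. Hence among complete blocks only the number of ones in the preimage
-- matters.
φ^-cong-↭ : ∀ k {u v} → u ↭ v → φ^ k u ∼[ suc k ] φ^ k v
φ^-cong-↭ k ↭-refl = ∼-refl
φ^-cong-↭ k {_ ∷ u} {_ ∷ v} (↭-prep a p) =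
  ∼-trans (∼-reflexive (φ^-++ k (a ∷ []) u))
    (∼-trans (∼-++ˡ (φ^ k (a ∷ [])) (φ^-cong-↭ k p))
             (∼-reflexive (sym (φ^-++ k (a ∷ []) v))))
φ^-cong-↭ k {_ ∷ _ ∷ u} {_ ∷ _ ∷ v} (↭-swap a b p) =
  ∼-trans (∼-reflexive (φ^-++ k (a ∷ b ∷ []) u))
    (∼-trans (∼-++ˡ (φ^ k (a ∷ b ∷ [])) (φ^-cong-↭ k p))
      (∼-trans (∼-++ʳ (φ^ k v) (φ^-swap-∼ k a b))
        (∼-reflexive (sym (φ^-++ k (b ∷ a ∷ []) v)))))
φ^-cong-↭ k (↭-trans′ p q) = ∼-trans (φ^-cong-↭ k p) (φ^-cong-↭ k q)

ones-sort : ∀ w → ∃ λ m → w ↭ replicate (ones w) true ++ replicate m false × ones w + m ≡ length w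
ones-sort [] = 0 , ↭-refl , refl
ones-sort (true ∷ w) with ones-sort w
... | m , p , e = m , ↭-prep true p , cong suc e
ones-sort (false ∷ w) with ones-sort w
... | m , p , e = suc m
  , ↭-trans (↭-prep false p) (↭-sym (shift false (replicate (ones w) true) (replicate m false)))
  , trans (+-suc (ones w) m) (cong suc e)

ones-↭ : ∀ u v → length u ≡ length v → ones u ≡ ones v → u ↭ v
ones-↭ u v l e with ones u | ones-sort u | ones v | ones-sort v
ones-↭ u v l refl | c | m , p , f | .c | m′ , p′ , f′
  rewrite +-cancelˡ-≡ c m m′ (trans f (trans l (sym f′))) = ↭-trans p (↭-sym p′)

-- Moments of words

-- The binomial coefficient C(n, s), lower index first.
bin : ℕ → ℕ → ℕ
bin zero n = 1
bin (suc s) zero = 0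
bin (suc s) (suc n) = bin (suc s) n + bin s n

bin-1 : ∀ n → bin 1 n ≡ n
bin-1 zero = refl
bin-1 (suc n) = trans (cong (_+ 1) (bin-1 n)) (+-comm n 1)

-- Σ C(i, s) over the positions i of the letter 1, counted from the right end.
mom : ℕ → Word → ℕ
mom s [] = 0
mom s (a ∷ w) = bit a * bin s (length w) + mom s w

-- These consequences of ∼ suffice to separate classes, and unlike the full set of counts they
-- transform under φ by an explicit triangular system.
_≈[_]_ : Word → ℕ → Word → Set
u ≈[ j ] v = ∀ s → s < j → mom s u ≡ mom s v

sumW : ℕ → (Word → ℕ) → ℕ
sumW zero f = f []
sumW (suc s) f = sumW s (λ u → f (true ∷ u)) + sumW s (λ u → f (false ∷ u))

sumW-cong : ∀ s {f g} → (∀ u → length u ≡ s → f u ≡ g u) → sumW s f ≡ sumW s g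
sumW-cong zero p = p [] refl
sumW-cong (suc s) p = cong₂ _+_ (sumW-cong s (λ u e → p (true ∷ u) (cong suc e)))
                                (sumW-cong s (λ u e → p (false ∷ u) (cong suc e)))

sumW-linear : ∀ s d f g → sumW s (λ u → f u + d * g u) ≡ sumW s f + d * sumW s g
sumW-linear zero d f g = refl
sumW-linear (suc s) d f g =
  trans (cong₂ _+_ (sumW-linear s d _ _) (sumW-linear s d _ _))
    (lemma d (sumW s (f ∘ (true ∷_))) (sumW s (g ∘ (true ∷_)))
             (sumW s (f ∘ (false ∷_))) (sumW s (g ∘ (false ∷_))))
  where
  lemma : ∀ d x y z t → (x + d * y) + (z + d * t) ≡ (x + z) + d * (y + t)
  lemma = solve-∀

sumW-binom-[] : ∀ s → sumW (suc s) (binom []) ≡ 0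
sumW-binom-[] s = cong₂ _+_ (zeros s) (zeros s)
  where
  zeros : ∀ s → sumW s (λ _ → 0) ≡ 0
  zeros zero = refl
  zeros (suc s) = cong₂ _+_ (zeros s) (zeros s)

-- Each choice of s positions in w spells exactly one word of length s.
sumW-binom : ∀ s w → sumW s (binom w) ≡ bin s (length w)
sumW-binom zero w = refl
sumW-binom (suc s) [] = sumW-binom-[] s
sumW-binom (suc s) (a ∷ w) = begin
  sumW s (λ u → binom (a ∷ w) (true ∷ u)) + sumW s (λ u → binom (a ∷ w) (false ∷ u))
    ≡⟨ cong₂ _+_ (split true) (split false) ⟩
  (sumW s (λ u → binom w (true ∷ u)) + δ a true * B)
    + (sumW s (λ u → binom w (false ∷ u)) + δ a false * B)
    ≡⟨ lemma (sumW s (binom w ∘ (true ∷_))) (sumW s (binom w ∘ (false ∷_))) (δ a true) (δ a false) B ⟩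
  sumW (suc s) (binom w) + (δ a true + δ a false) * B
    ≡⟨ cong₂ _+_ (sumW-binom (suc s) w) (cong₂ _*_ (total a) (sumW-binom s w)) ⟩
  bin (suc s) (length w) + 1 * bin s (length w)
    ≡⟨ cong (bin (suc s) (length w) +_) (*-identityˡ _) ⟩
  bin (suc s) (suc (length w)) ∎
  where
  open ≡-Reasoning
  B = sumW s (binom w)
  split : ∀ b → sumW s (λ u → binom (a ∷ w) (b ∷ u)) ≡ sumW s (λ u → binom w (b ∷ u)) + δ a b * B
  split b = trans (sumW-cong s (λ u _ → binom-∷ a w b u)) (sumW-linear s (δ a b) _ _)
  total : ∀ a → δ a true + δ a false ≡ 1
  total true = refl
  total false = refl
  lemma : ∀ x y d e B → (x + d * B) + (y + e * B) ≡ (x + y) + (d + e) * B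
  lemma = solve-∀

-- A subword that starts with 1 is a choice of a one and of s positions to its right; counting
-- positions from the right end makes this C(i, s).
mom-binom : ∀ s w → mom s w ≡ sumW s (λ u → binom w (true ∷ u))
mom-binom s [] = sym (zeros s)
  where
  zeros : ∀ s → sumW s (λ _ → 0) ≡ 0
  zeros zero = refl
  zeros (suc s) = cong₂ _+_ (zeros s) (zeros s)
mom-binom s (a ∷ w) = begin
  bit a * bin s (length w) + mom s w
    ≡⟨ +-comm (bit a * bin s (length w)) _ ⟩
  mom s w + bit a * bin s (length w)
    ≡⟨ cong₂ (λ x y → x + y) (mom-binom s w) (cong₂ _*_ (δ-true a) (sym (sumW-binom s w))) ⟩
  sumW s (λ u → binom w (true ∷ u)) + δ a true * sumW s (binom w)
    ≡⟨ sym (sumW-linear s (δ a true) _ _) ⟩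
  sumW s (λ u → binom w (true ∷ u) + δ a true * binom w u)
    ≡⟨ sumW-cong s (λ u _ → sym (binom-∷ a w true u)) ⟩
  sumW s (λ u → binom (a ∷ w) (true ∷ u)) ∎
  where
  open ≡-Reasoning
  δ-true : ∀ a → bit a ≡ δ a true
  δ-true true = refl
  δ-true false = refl

∼⇒≈ : ∀ {j u v} → u ∼[ j ] v → u ≈[ j ] v
∼⇒≈ {u = u} {v} p s l = trans (mom-binom s u)
  (trans (sumW-cong s (λ w e → p (true ∷ w) (subst (_< _) (sym e) l))) (sym (mom-binom s v)))

mom-0 : ∀ w → mom 0 w ≡ ones w
mom-0 [] = refl
mom-0 (a ∷ w) = cong₂ _+_ (*-identityʳ (bit a)) (mom-0 w)

≈-∷ : ∀ {j} a {u v} → length u ≡ length v → u ≈[ j ] v → (a ∷ u) ≈[ j ] (a ∷ v)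
≈-∷ a l p s q = cong₂ (λ m n → bit a * bin s m + n) l (p s q)

-- An appended letter moves every position up by one, which is Pascal's rule. It sits at position 0
-- itself, where C(0, s + 1) vanishes, so its value is irrelevant.
mom-snoc : ∀ s u a → mom (suc s) (u ++ a ∷ []) ≡ mom (suc s) u + mom s u
mom-snoc s [] a = trans (+-identityʳ _) (*-zeroʳ (bit a))
mom-snoc s (b ∷ u) a = trans
  (cong₂ (λ l m → bit b * bin (suc s) l + m)
    (trans (length-++ u) (+-comm (length u) 1)) (mom-snoc s u a))
  (lemma (bit b) (bin (suc s) (length u)) (bin s (length u)) (mom (suc s) u) (mom s u))
  where
  lemma : ∀ b x y m n → b * (x + y) + (m + n) ≡ (b * x + m) + (b * y + n)
  lemma = solve-∀

≈-snoc : ∀ {j u v} a → u ≈[ j ] v → (u ++ a ∷ []) ≈[ j ] (v ++ a ∷ [])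
≈-snoc {u = u} {v} a p zero q = trans (mom-0 (u ++ _)) (trans (ones-++ u _)
  (trans (cong (_+ _) (trans (sym (mom-0 u)) (trans (p 0 q) (mom-0 v))))
    (sym (trans (mom-0 (v ++ _)) (ones-++ v _)))))
≈-snoc {u = u} {v} a p (suc s) q = trans (mom-snoc s u a)
  (trans (cong₂ _+_ (p (suc s) q) (p s (≤-trans (n≤1+n _) q))) (sym (mom-snoc s v a)))

sumTo : ℕ → (ℕ → ℕ) → ℕ
sumTo zero f = 0
sumTo (suc n) f = sumTo n f + f n

sumTo-cong : ∀ n {f g} → (∀ t → t < n → f t ≡ g t) → sumTo n f ≡ sumTo n g
sumTo-cong zero p = refl
sumTo-cong (suc n) p = cong₂ _+_ (sumTo-cong n (λ t l → p t (m≤n⇒m≤1+n l))) (p n ≤-refl)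

sumTo-zero : ∀ n {f} → (∀ t → f t ≡ 0) → sumTo n f ≡ 0
sumTo-zero zero p = refl
sumTo-zero (suc n) p = cong₂ _+_ (sumTo-zero n p) (p n)

sumTo-linear : ∀ n d f g → sumTo n (λ t → d * f t + g t) ≡ d * sumTo n f + sumTo n g
sumTo-linear zero d f g = sym (cong (_+ 0) (*-zeroʳ d))
sumTo-linear (suc n) d f g =
  trans (cong (_+ (d * f n + g n)) (sumTo-linear n d f g)) (lemma d (sumTo n f) (sumTo n g) (f n) (g n))
  where
  lemma : ∀ d x y z t → (d * x + y) + (d * z + t) ≡ d * (x + z) + (y + t)
  lemma = solve-∀

sumTo-head : ∀ n f → sumTo (suc n) f ≡ f 0 + sumTo n (λ t → f (suc t))
sumTo-head zero f = sym (+-identityʳ (f 0))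
sumTo-head (suc n) f = trans (cong (_+ f (suc n)) (sumTo-head n f)) (+-assoc (f 0) _ _)

-- The coefficients of C(2n, s) in the basis C(n, t).
κ : ℕ → ℕ → ℕ
κ zero zero = 1
κ zero (suc t) = 0
κ (suc s) zero = 0
κ (suc zero) (suc t) = 2 * κ zero t
κ (suc (suc s)) (suc t) = 2 * κ (suc s) t + κ s t

κ-above : ∀ s t → s < t → κ s t ≡ 0
κ-above zero (suc t) _ = refl
κ-above (suc zero) (suc (suc t)) _ = refl
κ-above (suc zero) (suc zero) (s≤s ())
κ-above (suc (suc s)) (suc t) (s≤s l)
  rewrite κ-above (suc s) t l | κ-above s t (≤-trans (n≤1+n _) l) = refl

κ-diagonal : ∀ s → κ s s ≡ 2 ^ s
κ-diagonal zero = refl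
κ-diagonal (suc zero) = refl
κ-diagonal (suc (suc s)) rewrite κ-diagonal (suc s) | κ-above s (suc s) ≤-refl = +-identityʳ _

bin-double : ∀ s n → bin s (n * 2) ≡ sumTo (suc s) (λ t → κ s t * bin t n)
bin-double zero zero = refl
bin-double (suc s) zero = sym (trans (sumTo-head (suc s) _)
  (sumTo-zero (suc s) (λ t → *-zeroʳ (κ (suc s) (suc t)))))
bin-double zero (suc n) = refl
bin-double (suc zero) (suc n) = trans (cong (λ z → z + 1 + 1) (bin-double 1 n)) (lemma (bin 1 n))
  where
  lemma : ∀ x → 2 * x + 1 + 1 ≡ 2 * (x + 1)
  lemma = solve-∀
bin-double (suc (suc s)) (suc n) = begin
  bin (2 + s) (n * 2) + bin (1 + s) (n * 2) + (bin (1 + s) (n * 2) + bin s (n * 2))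
    ≡⟨ lemma₁ (bin (2 + s) (n * 2)) (bin (1 + s) (n * 2)) (bin s (n * 2)) ⟩
  -- The summand 0 stands for the coefficient `κ s (suc s)`; it pads the third sum to the length of
  -- the other two.
  bin (2 + s) (n * 2) + (2 * bin (1 + s) (n * 2) + (bin s (n * 2) + 0 * bin (suc s) n))
    ≡⟨ cong₂ _+_ (trans (bin-double (2 + s) n) (sumTo-head (2 + s) _))
        (cong₂ _+_ (cong (2 *_) (bin-double (1 + s) n))
          (cong₂ _+_ (bin-double s n) (cong (_* bin (suc s) n) (sym (κ-above s (suc s) ≤-refl))))) ⟩
  sumTo (2 + s) (λ t → κ (2 + s) (suc t) * bin (suc t) n)
    + (2 * sumTo (2 + s) (λ t → κ (1 + s) t * bin t n) + sumTo (2 + s) (λ t → κ s t * bin t n))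
    ≡⟨ cong (sumTo (2 + s) (λ t → κ (2 + s) (suc t) * bin (suc t) n) +_)
         (sym (sumTo-linear (2 + s) 2 (λ t → κ (1 + s) t * bin t n) (λ t → κ s t * bin t n))) ⟩
  A + sumTo (2 + s) (λ t → 2 * (κ (1 + s) t * bin t n) + κ s t * bin t n)
    ≡⟨ cong (_+ sumTo (2 + s) (λ t → 2 * (κ (1 + s) t * bin t n) + κ s t * bin t n)) (sym (*-identityˡ A)) ⟩
  1 * A + sumTo (2 + s) (λ t → 2 * (κ (1 + s) t * bin t n) + κ s t * bin t n)
    ≡⟨ sym (sumTo-linear (2 + s) 1 (λ t → κ (2 + s) (suc t) * bin (suc t) n)
         (λ t → 2 * (κ (1 + s) t * bin t n) + κ s t * bin t n)) ⟩
  sumTo (2 + s) (λ t → 1 * (κ (2 + s) (suc t) * bin (suc t) n)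
    + (2 * (κ (1 + s) t * bin t n) + κ s t * bin t n))
    ≡⟨ sumTo-cong (2 + s) (λ t _ → lemma₂ (κ (1 + s) t) (κ s t) (bin (suc t) n) (bin t n)) ⟩
  sumTo (2 + s) (λ t → κ (2 + s) (suc t) * bin (suc t) (suc n))
    ≡⟨ sym (sumTo-head (2 + s) (λ t → κ (2 + s) t * bin t (suc n))) ⟩
  sumTo (3 + s) (λ t → κ (2 + s) t * bin t (suc n)) ∎
  where
  open ≡-Reasoning
  A = sumTo (2 + s) (λ t → κ (2 + s) (suc t) * bin (suc t) n)
  lemma₁ : ∀ x y z → x + y + (y + z) ≡ x + (2 * y + (z + 0))
  lemma₁ = solve-∀
  lemma₂ : ∀ k l x y → 1 * ((2 * k + l) * x) + (2 * (k * y) + l * y) ≡ (2 * k + l) * (x + y)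
  lemma₂ = solve-∀

mom₂ : ℕ → Word → ℕ
mom₂ s [] = 0
mom₂ s (a ∷ w) = bit a * bin s (length w * 2) + mom₂ s w

mom₂-mom : ∀ s w → mom₂ s w ≡ sumTo (suc s) (λ t → κ s t * mom t w)
mom₂-mom s [] = sym (sumTo-zero (suc s) (λ t → *-zeroʳ (κ s t)))
mom₂-mom s (a ∷ w) = trans
  (cong₂ (λ x y → bit a * x + y) (bin-double s (length w)) (mom₂-mom s w))
  (trans (sym (sumTo-linear (suc s) (bit a) (λ t → κ s t * bin t (length w)) (λ t → κ s t * mom t w)))
         (sumTo-cong (suc s) (λ t _ → lemma (bit a) (κ s t) (bin t (length w)) (mom t w))))
  where
  lemma : ∀ a k x y → a * (k * x) + k * y ≡ k * (a * x + y)
  lemma = solve-∀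

length-φ : ∀ w → length (φ w) ≡ length w * 2
length-φ [] = refl
length-φ (a ∷ w) = cong (suc ∘ suc) (length-φ w)

base : ℕ → ℕ → ℕ
base s zero = 0
base s (suc n) = bin (suc s) (n * 2) + base s n

-- The block of a letter occupies positions 2i + 1 and 2i. Its one contributes C(2i, s + 1) for the
-- letter 0 and C(2i, s) more for the letter 1; `base` collects the part common to both letters and
-- `mom₂` the excess.
mom-φ : ∀ s w → mom (suc s) (φ w) ≡ base s (length w) + mom₂ s w
mom-φ s [] = refl
mom-φ s (a ∷ w) = trans
  (cong₂ (λ x y → bit a * (bin (suc s) x + bin s x) + (bit (not a) * bin (suc s) x + y))
    (length-φ w) (mom-φ s w))
  (lemma a (bin (suc s) (length w * 2)) (bin s (length w * 2)) (base s (length w)) (mom₂ s w))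
  where
  lemma₁ : ∀ x y z t → 1 * (x + y) + (0 * x + (z + t)) ≡ (x + z) + (1 * y + t)
  lemma₁ = solve-∀
  lemma₀ : ∀ x y z t → 0 * (x + y) + (1 * x + (z + t)) ≡ (x + z) + (0 * y + t)
  lemma₀ = solve-∀
  lemma : ∀ a x y z t → bit a * (x + y) + (bit (not a) * x + (z + t)) ≡ (x + z) + (bit a * y + t)
  lemma true = lemma₁
  lemma false = lemma₀

-- After `base` cancels, the moments of u and v satisfy the same triangular system with diagonal
-- entries 2ˢ, which is solved by strong induction on s.
≈-φ⁻ : ∀ {j u v} → length u ≡ length v → φ u ≈[ suc j ] φ v → u ≈[ j ] v
≈-φ⁻ {j} {u} {v} l p s s<j = go (suc s) s ≤-refl s<j
  where
  go : ∀ n s → s < n → s < j → mom s u ≡ mom s v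
  go (suc n) s (s≤s s≤n) s<j =
    *-cancelˡ-≡ _ _ (κ s s) {{subst NonZero (sym (κ-diagonal s)) (m^n≢0 2 s)}}
    (+-cancelˡ-≡ (sumTo s (λ t → κ s t * mom t u)) _ _ (begin
      sumTo (suc s) (λ t → κ s t * mom t u)   ≡⟨ sym (mom₂-mom s u) ⟩
      mom₂ s u                                ≡⟨ +-cancelˡ-≡ (base s (length u)) _ _
        (trans (sym (mom-φ s u)) (trans (p (suc s) (s≤s s<j))
          (trans (mom-φ s v) (cong (λ m → base s m + mom₂ s v) (sym l))))) ⟩
      mom₂ s v                                ≡⟨ mom₂-mom s v ⟩
      sumTo (suc s) (λ t → κ s t * mom t v)
        ≡⟨ cong (_+ κ s s * mom s v) (sumTo-cong s
             (λ t t<s → cong (κ s t *_) (sym (go n t (<-≤-trans t<s s≤n) (<-trans t<s s<j))))) ⟩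
      sumTo s (λ t → κ s t * mom t u) + κ s s * mom s v ∎))
    where open ≡-Reasoning

ones-φ : ∀ w → ones (φ w) ≡ length w
ones-φ [] = refl
ones-φ (true ∷ w) = cong suc (ones-φ w)
ones-φ (false ∷ w) = cong suc (ones-φ w)

mom₂-0 : ∀ w → mom₂ 0 w ≡ ones w
mom₂-0 [] = refl
mom₂-0 (a ∷ w) = cong₂ _+_ (*-identityʳ (bit a)) (mom₂-0 w)

mom-1-φ : ∀ w → mom 1 (φ w) ≡ base 0 (length w) + ones w
mom-1-φ w = trans (mom-φ 0 w) (cong (base 0 (length w) +_) (mom₂-0 w))

-- Windows of infinite words and of their images

length-fac : ∀ x i n → length (fac x i n) ≡ n
length-fac x i zero = refl
length-fac x i (suc n) = cong suc (length-fac x (suc i) n)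

fac-++ : ∀ x i m n → fac x i (m + n) ≡ fac x i m ++ fac x (m + i) n
fac-++ x i zero n = refl
fac-++ x i (suc m) n = cong (x i ∷_)
  (trans (fac-++ x (suc i) m n) (cong (λ j → fac x (suc i) m ++ fac x j n) (+-suc m i)))

fac-snoc : ∀ x i n → fac x i (suc n) ≡ fac x i n ++ x (n + i) ∷ []
fac-snoc x i n = trans (cong (fac x i) (+-comm 1 n)) (fac-++ x i n 1)

fac-cong : ∀ {x x′} i i′ n → (∀ j → j < n → x (j + i) ≡ x′ (j + i′)) → fac x i n ≡ fac x′ i′ n
fac-cong i i′ zero p = refl
fac-cong {x} {x′} i i′ (suc n) p = cong₂ _∷_ (p 0 z<s) (fac-cong (suc i) (suc i′) n
  (λ j l → subst₂ (λ a b → x a ≡ x′ b) (sym (+-suc j i)) (sym (+-suc j i′)) (p (suc j) (s<s l))))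

fac-lookup : ∀ {x x′} i i′ n → fac x i n ≡ fac x′ i′ n → ∀ j → j < n → x (j + i) ≡ x′ (j + i′)
fac-lookup i i′ (suc n) e zero l = proj₁ (∷-injective e)
fac-lookup {x} {x′} i i′ (suc n) e (suc j) (s≤s l) =
  subst₂ (λ a b → x a ≡ x′ b) (+-suc j i) (+-suc j i′)
    (fac-lookup (suc i) (suc i′) n (proj₂ (∷-injective e)) j l)

φ∞-even : ∀ y q → φ∞ y (q * 2) ≡ y q
φ∞-even y zero = refl
φ∞-even y (suc q) = φ∞-even (y ∘ suc) q

φ∞-odd : ∀ y q → φ∞ y (suc (q * 2)) ≡ not (y q)
φ∞-odd y zero = refl
φ∞-odd y (suc q) = φ∞-odd (y ∘ suc) q

fac-φ : ∀ y q n → fac (φ∞ y) (q * 2) (n * 2) ≡ φ (fac y q n)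
fac-φ y q zero = refl
fac-φ y q (suc n) = cong₂ _∷_ (φ∞-even y q) (cong₂ _∷_ (φ∞-odd y q) (fac-φ y (suc q) n))

φ∞^-outer : ∀ k y n → φ∞^ (suc k) y n ≡ φ∞ (φ∞^ k y) n
φ∞^-outer zero y n = refl
φ∞^-outer (suc k) y n = φ∞^-outer k (φ∞ y) n

φ∞-cong : ∀ {y z} → (∀ n → y n ≡ z n) → ∀ n → φ∞ y n ≡ φ∞ z n
φ∞-cong p zero = p 0
φ∞-cong p (suc zero) = cong not (p 0)
φ∞-cong p (suc (suc n)) = φ∞-cong (λ m → p (suc m)) n

φ∞^-cong : ∀ k {y z} → (∀ n → y n ≡ z n) → ∀ n → φ∞^ k y n ≡ φ∞^ k z n
φ∞^-cong zero p = p
φ∞^-cong (suc k) p = φ∞^-cong k (φ∞-cong p)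

-- Windows of φ(v)

Const : Bool → InfWord → ℕ → ℕ → Set
Const c v i n = ∀ j → j < n → v (j + i) ≡ c

Cube : Bool → InfWord → ℕ → Set
Cube c v i = Const c v i 3

Const-∷ : ∀ {c v i n} → v i ≡ c → Const c v (suc i) n → Const c v i (suc n)
Const-∷ p q zero _ = p
Const-∷ {v = v} {i} p q (suc j) (s≤s l) = trans (cong v (sym (+-suc j i))) (q j l)

Const-snoc : ∀ {c v i} n → Const c v i n → v (n + i) ≡ c → Const c v i (suc n)
Const-snoc n p q j (s≤s l) with m≤n⇒m<n∨m≡n l
... | inj₁ j<n = p j j<n
... | inj₂ refl = q

Const-≤ : ∀ {c v i m n} → m ≤ n → Const c v i n → Const c v i m
Const-≤ l p j q = p j (≤-trans q l)

ones-full : ∀ {v i} n → n ≤ ones (fac v i n) → Const true v i n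
ones-full zero _ j ()
ones-full {v} {i} (suc n) l with v i in e
ones-full {v} {i} (suc n) (s≤s l) | true = Const-∷ {v = v} e (ones-full n l)
ones-full {v} {i} (suc n) l | false = ⊥-elim (<-irrefl refl
  (≤-trans l (≤-trans (ones≤length (fac v (suc i) n)) (≤-reflexive (length-fac v (suc i) n)))))

ones-empty : ∀ {v i} n → ones (fac v i n) ≡ 0 → Const false v i n
ones-empty zero _ j ()
ones-empty {v} {i} (suc n) p with v i in e
... | false = Const-∷ {v = v} e (ones-empty n p)

-- At length 4 only one cube is forced: 0101 is φ(00), and it also lies inside φ(111). From length 5
-- on both cubes are forced.
Exceptional : ℕ → InfWord → ℕ → InfWord → ℕ → Set
Exceptional n v i v′ i′ = ∃ λ c →
  (Cube c v i ⊎ Cube (not c) v′ i′) × (5 ≤ n → Cube c v i × Cube (not c) v′ i′)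

Exceptional-sym : ∀ {n v i v′ i′} → Exceptional n v i v′ i′ → Exceptional n v′ i′ v i
Exceptional-sym {v = v} {i} (c , p , q) = not c , swap⊎ p , λ l → proj₂ (q l) , back (proj₁ (q l))
  where
  back : Cube c v i → Cube (not (not c)) v i
  back = subst (λ d → Cube d v i) (sym (not-involutive c))
  swap⊎ : ∀ {A : Set} → Cube c v i ⊎ A → A ⊎ Cube (not (not c)) v i
  swap⊎ (inj₁ x) = inj₂ (back x)
  swap⊎ (inj₂ y) = inj₁ y

odd≢even : ∀ m n → suc (m * 2) ≢ n * 2
odd≢even zero (suc n) ()
odd≢even (suc m) (suc n) e = odd≢even m n (suc-injective (suc-injective e))

ones-fac≤ : ∀ v i n → ones (fac v i n) ≤ n
ones-fac≤ v i n = ≤-trans (ones≤length (fac v i n)) (≤-reflexive (length-fac v i n))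

-- The four shapes of a window of φ∞ v, according to whether it starts (ends) inside a block.
block : Bool → Bool → InfWord → ℕ → ℕ → Word
block false false v i m = φ (fac v i m)
block false true  v i m = φ (fac v i m) ++ v (m + i) ∷ []
block true  false v i m = not (v i) ∷ φ (fac v (suc i) m)
block true  true  v i m = not (v i) ∷ φ (fac v (suc i) m) ++ v (m + suc i) ∷ []

fac-block : ∀ ρ σ v i m →
  fac (φ∞ v) (bit ρ + i * 2) (bit ρ + bit σ + m * 2) ≡ block ρ σ v i m
fac-block false false v i m = fac-φ v i m
fac-block false true v i m = trans (fac-snoc (φ∞ v) (i * 2) (m * 2))
  (cong₂ (λ u a → u ++ a ∷ []) (fac-φ v i m)
    (trans (cong (φ∞ v) (sym (*-distribʳ-+ 2 m i))) (φ∞-even v (m + i))))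
fac-block true false v i m = cong₂ _∷_ (φ∞-odd v i) (fac-φ v (suc i) m)
fac-block true true v i m = cong₂ _∷_ (φ∞-odd v i) (fac-block false true v (suc i) m)

length-φ-fac : ∀ v i m → length (φ (fac v i m)) ≡ m * 2
length-φ-fac v i m = trans (length-φ (fac v i m)) (cong (_* 2) (length-fac v i m))

ones-φ-fac : ∀ v i m → ones (φ (fac v i m)) ≡ m
ones-φ-fac v i m = trans (ones-φ (fac v i m)) (length-fac v i m)

mom-1-φ-fac : ∀ v i m → mom 1 (φ (fac v i m)) ≡ base 0 m + ones (fac v i m)
mom-1-φ-fac v i m = trans (mom-1-φ (fac v i m)) (cong (λ n → base 0 n + ones (fac v i m)) (length-fac v i m))

ones-φ-snoc : ∀ v i m a → ones (φ (fac v i m) ++ a ∷ []) ≡ m + bit a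
ones-φ-snoc v i m a =
  trans (ones-++ (φ (fac v i m)) _) (cong₂ _+_ (ones-φ-fac v i m) (+-identityʳ (bit a)))

mom-1-φ-snoc : ∀ v i m a → mom 1 (φ (fac v i m) ++ a ∷ []) ≡ base 0 m + ones (fac v i m) + m
mom-1-φ-snoc v i m a = trans (mom-snoc 0 (φ (fac v i m)) a)
  (cong₂ _+_ (mom-1-φ-fac v i m) (trans (mom-0 (φ (fac v i m))) (ones-φ-fac v i m)))

length-φ-snoc : ∀ v i m a → length (φ (fac v i m) ++ a ∷ []) ≡ suc (m * 2)
length-φ-snoc v i m a = trans (length-++ (φ (fac v i m)))
  (trans (+-comm _ 1) (cong suc (length-φ-fac v i m)))

block-ones : Bool → Bool → InfWord → ℕ → ℕ → ℕ
block-ones false false v i m = m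
block-ones false true  v i m = m + bit (v (m + i))
block-ones true  false v i m = bit (not (v i)) + m
block-ones true  true  v i m = bit (not (v i)) + (m + bit (v (m + suc i)))

ones-block : ∀ ρ σ v i m → ones (block ρ σ v i m) ≡ block-ones ρ σ v i m
ones-block false false v i m = ones-φ-fac v i m
ones-block false true v i m = ones-φ-snoc v i m (v (m + i))
ones-block true false v i m = cong (bit (not (v i)) +_) (ones-φ-fac v (suc i) m)
ones-block true true v i m = cong (bit (not (v i)) +_) (ones-φ-snoc v (suc i) m _)

block-mom : Bool → Bool → InfWord → ℕ → ℕ → ℕ
block-mom false false v i m = base 0 m + ones (fac v i m)
block-mom false true  v i m = base 0 m + ones (fac v i m) + m
block-mom true  false v i m = bit (not (v i)) * (m * 2) + (base 0 m + ones (fac v (suc i) m))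
block-mom true  true  v i m = bit (not (v i)) * suc (m * 2) + (base 0 m + ones (fac v (suc i) m) + m)

mom-block : ∀ ρ σ v i m → mom 1 (block ρ σ v i m) ≡ block-mom ρ σ v i m
mom-block false false v i m = mom-1-φ-fac v i m
mom-block false true v i m = mom-1-φ-snoc v i m (v (m + i))
mom-block true false v i m = cong₂ (λ l n → bit (not (v i)) * l + n)
  (trans (bin-1 _) (length-φ-fac v (suc i) m)) (mom-1-φ-fac v (suc i) m)
mom-block true true v i m = cong₂ (λ l n → bit (not (v i)) * l + n)
  (trans (bin-1 _) (length-φ-snoc v (suc i) m _)) (mom-1-φ-snoc v (suc i) m _)

bit-injective : ∀ {a b} → bit a ≡ bit b → a ≡ b
bit-injective {false} {false} _ = refl
bit-injective {true} {true} _ = refl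

EndsAgree : Bool → Bool → InfWord → ℕ → InfWord → ℕ → ℕ → Set
EndsAgree ρ σ v i v′ i′ n =
  (ρ ≡ true → v i ≡ v′ i′) × (σ ≡ true → ∀ m → n ≡ suc m → v (m + i) ≡ v′ (m + i′))

φ-fac-snoc : ∀ v i m → φ (fac v i (suc m)) ≡ (φ (fac v i m) ++ v (m + i) ∷ []) ++ not (v (m + i)) ∷ []
φ-fac-snoc v i m = trans (cong φ (fac-snoc v i m))
  (trans (concatMap-++ φ₁ (fac v i m) _) (sym (++-assoc (φ (fac v i m)) _ _)))

-- When the partially met blocks agree, the same missing letters can be added on both sides, which
-- preserves equality of moments and leaves images of whole words, as `≈-φ⁻` requires.
complete : ∀ {j} ρ σ v v′ i i′ m → EndsAgree ρ σ v i v′ i′ (bit ρ + bit σ + m) →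
  block ρ σ v i m ≈[ j ] block ρ σ v′ i′ m →
  φ (fac v i (bit ρ + bit σ + m)) ≈[ j ] φ (fac v′ i′ (bit ρ + bit σ + m))
complete false false v v′ i i′ m _ p = p
complete {j} false true v v′ i i′ m (_ , e) p =
  subst₂ (_≈[ j ]_) (sym (φ-fac-snoc v i m)) (trans
    (cong (λ a → (φ (fac v′ i′ m) ++ v′ (m + i′) ∷ []) ++ not a ∷ []) (e refl m refl))
    (sym (φ-fac-snoc v′ i′ m)))
    (≈-snoc {u = φ (fac v i m) ++ v (m + i) ∷ []} {v = φ (fac v′ i′ m) ++ v′ (m + i′) ∷ []}
      (not (v (m + i))) p)
complete {j} true false v v′ i i′ m (e , _) p =
  subst (λ a → (v i ∷ not (v i) ∷ φ (fac v (suc i) m)) ≈[ j ] (a ∷ not (v′ i′) ∷ φ (fac v′ (suc i′) m)))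
    (e refl) (≈-∷ (v i) {not (v i) ∷ φ (fac v (suc i) m)} {not (v′ i′) ∷ φ (fac v′ (suc i′) m)} (cong suc (trans (length-φ-fac v (suc i) m) (sym (length-φ-fac v′ (suc i′) m)))) p)
complete {j} true true v v′ i i′ m (e , f) p =
  subst₂ (_≈[ j ]_) (cong (λ w → v i ∷ not (v i) ∷ w) (sym (φ-fac-snoc v (suc i) m)))
    (trans (cong₂ (λ a b → a ∷ not (v′ i′) ∷ (φ (fac v′ (suc i′) m) ++ v′ (m + suc i′) ∷ []) ++ not b ∷ [])
       (e refl)
       (subst₂ (λ a b → v a ≡ v′ b) (sym (+-suc m i)) (sym (+-suc m i′)) (f refl (suc m) refl)))
      (cong (λ w → v′ i′ ∷ not (v′ i′) ∷ w) (sym (φ-fac-snoc v′ (suc i′) m))))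
    (≈-∷ (v i) {not (v i) ∷ (φ (fac v (suc i) m) ++ v (m + suc i) ∷ []) ++ not (v (m + suc i)) ∷ []}
               {not (v′ i′) ∷ (φ (fac v′ (suc i′) m) ++ v′ (m + suc i′) ∷ []) ++ not (v (m + suc i)) ∷ []}
      (cong suc (trans (length-++ (φ (fac v (suc i) m) ++ v (m + suc i) ∷ []))
        (trans (cong (_+ 1) (trans (length-φ-snoc v (suc i) m _) (sym (length-φ-snoc v′ (suc i′) m _))))
               (sym (length-++ (φ (fac v′ (suc i′) m) ++ v′ (m + suc i′) ∷ []))))))
      (≈-snoc {u = not (v i) ∷ φ (fac v (suc i) m) ++ v (m + suc i) ∷ []}
              {v = not (v′ i′) ∷ φ (fac v′ (suc i′) m) ++ v′ (m + suc i′) ∷ []}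
        (not (v (m + suc i))) p))

-- Complete blocks hold one 1 each, so the number of ones reveals the end letters unless both ends
-- are partial. In that case the first moment has to decide as well.
same-ends : ∀ ρ σ v v′ i i′ m →
  block-ones ρ σ v i m ≡ block-ones ρ σ v′ i′ m → block-mom ρ σ v i m ≡ block-mom ρ σ v′ i′ m →
  EndsAgree ρ σ v i v′ i′ (bit ρ + bit σ + m)
same-ends false false v v′ i i′ m _ _ = (λ ()) , (λ ())
same-ends false true v v′ i i′ m o _ = (λ ()) , λ { _ _ refl → bit-injective (+-cancelˡ-≡ m _ _ o) }
same-ends true false v v′ i i′ m o _ =
  (λ _ → not-injective (bit-injective (+-cancelʳ-≡ m _ _ o))) , (λ ())
  where
  not-injective : ∀ {a b} → not a ≡ not b → a ≡ b
  not-injective {a} {b} e = trans (sym (not-involutive a)) (trans (cong not e) (not-involutive b))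
same-ends true true v v′ i i′ m o q = (λ _ → first) , λ { _ _ refl → last }
  where
  -- The first letter sits at position 2m + 1 and contributes 2m + 1 to the first moment, more than
  -- the at most m by which the inner blocks can compensate.
  clash : ∀ x y → 1 * suc (m * 2) + (base 0 m + x + m) ≡ 0 * suc (m * 2) + (base 0 m + y + m) → y ≤ m → ⊥
  clash x y e l = <-irrefl refl (≤-trans (s≤s (≤-trans (m≤m*n m 2) (m≤m+n (m * 2) x)))
    (≤-trans (≤-reflexive (+-cancelʳ-≡ (base 0 m + m) _ _ (trans (lemma (m * 2) (base 0 m) x m) (trans e (lemma′ (base 0 m) y m))))) l))
    where
    lemma : ∀ d b x m → (suc d + x) + (b + m) ≡ 1 * suc d + (b + x + m)
    lemma = solve-∀
    lemma′ : ∀ b y m → (b + y + m) ≡ y + (b + m)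
    lemma′ = solve-∀
  cases : ∀ a b x y → bit (not a) * suc (m * 2) + (base 0 m + x + m)
    ≡ bit (not b) * suc (m * 2) + (base 0 m + y + m) → x ≤ m → y ≤ m → a ≡ b
  cases false false _ _ _ _ _ = refl
  cases true true _ _ _ _ _ = refl
  cases false true x y e _ l = ⊥-elim (clash x y e l)
  cases true false x y e l _ = ⊥-elim (clash y x (sym e) l)
  first : v i ≡ v′ i′
  first = cases (v i) (v′ i′) _ _ q (ones-fac≤ v (suc i) m) (ones-fac≤ v′ (suc i′) m)
  last : v (suc m + i) ≡ v′ (suc m + i′)
  last = subst₂ (λ a b → v a ≡ v′ b) (+-suc m i) (+-suc m i′) (bit-injective (+-cancelˡ-≡ m _ _
    (+-cancelˡ-≡ (bit (not (v i))) _ _ (trans o (cong (λ a → bit (not a) + (m + bit (v′ (m + suc i′)))) (sym first))))))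

4≤suc[m*2] : ∀ m → 4 ≤ suc (m * 2) → 2 ≤ m
4≤suc[m*2] (suc (suc m)) _ = s≤s (s≤s z≤n)
4≤suc[m*2] (suc zero) (s≤s (s≤s (s≤s ())))
4≤suc[m*2] zero (s≤s ())

5≤2+m*2 : ∀ m → 5 ≤ 2 + m * 2 → 2 ≤ m
5≤2+m*2 (suc (suc m)) _ = s≤s (s≤s z≤n)
5≤2+m*2 (suc zero) (s≤s (s≤s (s≤s (s≤s ()))))
5≤2+m*2 zero (s≤s (s≤s ()))

4≤2+m*2 : ∀ m → 4 ≤ 2 + m * 2 → 1 ≤ m
4≤2+m*2 (suc m) _ = s≤s z≤n
4≤2+m*2 zero (s≤s (s≤s ()))

-- The two alignments are one letter apart, and their first moments can only agree if the inner
-- blocks compensate as much as possible. One inner window then consists of ones only and the other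
-- of zeros only, and the end letters continue these runs.
exceptional-odd : ∀ v v′ i i′ m → 4 ≤ suc (m * 2) →
  block-ones false true v i m ≡ block-ones true false v′ i′ m →
  block-mom false true v i m ≡ block-mom true false v′ i′ m →
  Exceptional (suc (m * 2)) v i v′ i′
exceptional-odd v v′ i i′ m l o q with v′ i′ in e | v (m + i) in f
exceptional-odd v v′ i i′ m l o q | false | true = true , inj₁ (proj₁ both) , λ _ → both
  where
  full : ones (fac v i m) ≡ m + ones (fac v′ (suc i′) m)
  full = +-cancelʳ-≡ (base 0 m + m) _ _ (trans (lemma₁ (base 0 m) (ones (fac v i m)) m)
    (trans q (lemma₂ (base 0 m) (ones (fac v′ (suc i′) m)) m)))
    where
    lemma₁ : ∀ b x m → x + (b + m) ≡ b + x + m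
    lemma₁ = solve-∀
    lemma₂ : ∀ b y m → 1 * (m * 2) + (b + y) ≡ m + y + (b + m)
    lemma₂ = solve-∀
  empty : ones (fac v′ (suc i′) m) ≡ 0
  empty = n≤0⇒n≡0 (+-cancelˡ-≤ m _ _
    (≤-trans (≤-reflexive (sym full)) (≤-trans (ones-fac≤ v i m) (≤-reflexive (sym (+-identityʳ m))))))
  both : Cube true v i × Cube false v′ i′
  both = Const-≤ {v = v} (s≤s (4≤suc[m*2] m l)) (Const-snoc {v = v} m
           (ones-full m (≤-trans (m≤m+n m _) (≤-reflexive (sym full)))) f)
       , Const-≤ {v = v′} (s≤s (4≤suc[m*2] m l)) (Const-∷ {v = v′} e (ones-empty m empty))
exceptional-odd v v′ i i′ m l o q | true | false = false , inj₁ (proj₁ both) , λ _ → both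
  where
  full : ones (fac v i m) + m ≡ ones (fac v′ (suc i′) m)
  full = +-cancelˡ-≡ (base 0 m) _ _ (trans (sym (+-assoc (base 0 m) _ _)) q)
  empty : ones (fac v i m) ≡ 0
  empty = n≤0⇒n≡0 (+-cancelʳ-≤ m _ _ (≤-trans (≤-reflexive full) (ones-fac≤ v′ (suc i′) m)))
  both : Cube false v i × Cube true v′ i′
  both = Const-≤ {v = v} (s≤s (4≤suc[m*2] m l)) (Const-snoc {v = v} m (ones-empty m empty) f)
       , Const-≤ {v = v′} (s≤s (4≤suc[m*2] m l)) (Const-∷ {v = v′} e
           (ones-full m (≤-trans (m≤n+m m _) (≤-reflexive full))))
exceptional-odd v v′ i i′ m l o q | false | false =
  ⊥-elim (<-irrefl (trans (sym (+-identityʳ m)) o) ≤-refl)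
exceptional-odd v v′ i i′ m l o q | true | true =
  ⊥-elim (<-irrefl (trans (sym o) (+-comm m 1)) ≤-refl)

-- Again the first moments force extreme windows. The shifted window meets m + 2 blocks and the
-- aligned one m + 1; at length 4, where m = 1, only the former is long enough for a cube.
exceptional-even : ∀ v v′ i i′ m → 4 ≤ 2 + m * 2 →
  block-ones false false v i (suc m) ≡ block-ones true true v′ i′ m →
  block-mom false false v i (suc m) ≡ block-mom true true v′ i′ m →
  Exceptional (2 + m * 2) v i v′ i′
exceptional-even v v′ i i′ m l o q with v′ i′ in e | v′ (m + suc i′) in f
exceptional-even v v′ i i′ m l o q | false | false = true , inj₂ small , λ l′ →
    Const-≤ {v = v} (s≤s (5≤2+m*2 m l′)) (ones-full (suc m) (≤-trans (m≤m+n (suc m) _) (≤-reflexive (sym full)))) , small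
  where
  full : ones (fac v i (suc m)) ≡ suc m + ones (fac v′ (suc i′) m)
  full = +-cancelʳ-≡ (base 0 m + m * 2) _ _
    (trans (lemma₁ (base 0 m) (ones (fac v i (suc m))) (m * 2))
      (trans (cong (λ z → z + base 0 m + ones (fac v i (suc m))) (sym (bin-1 (m * 2))))
      (trans q (lemma₂ (base 0 m) (ones (fac v′ (suc i′) m)) m))))
    where
    lemma₁ : ∀ b x d → x + (b + d) ≡ d + b + x
    lemma₁ = solve-∀
    lemma₂ : ∀ b y m → 1 * suc (m * 2) + (b + y + m) ≡ suc m + y + (b + m * 2)
    lemma₂ = solve-∀
  empty : ones (fac v′ (suc i′) m) ≡ 0
  empty = n≤0⇒n≡0 (+-cancelˡ-≤ (suc m) _ _
    (≤-trans (≤-reflexive (sym full)) (≤-trans (ones-fac≤ v i (suc m)) (≤-reflexive (sym (+-identityʳ (suc m)))))))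
  small : Cube false v′ i′
  small = Const-≤ {v = v′} (s≤s (s≤s (4≤2+m*2 m l)))
    (Const-∷ {v = v′} e (Const-snoc {v = v′} m (ones-empty m empty) f))
exceptional-even v v′ i i′ m l o q | true | true = false , inj₂ small , λ l′ →
    Const-≤ {v = v} (s≤s (5≤2+m*2 m l′)) (ones-empty (suc m) empty) , small
  where
  full : ones (fac v i (suc m)) + m ≡ ones (fac v′ (suc i′) m)
  full = +-cancelʳ-≡ (base 0 m + m) _ _
    (trans (lemma₁ (base 0 m) (ones (fac v i (suc m))) m)
      (trans (cong (λ z → z + base 0 m + ones (fac v i (suc m))) (sym (bin-1 (m * 2))))
      (trans q (lemma₂ (base 0 m) (ones (fac v′ (suc i′) m)) m))))
    where
    lemma₁ : ∀ b x m → x + m + (b + m) ≡ m * 2 + b + x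
    lemma₁ = solve-∀
    lemma₂ : ∀ b y m → 0 * suc (m * 2) + (b + y + m) ≡ y + (b + m)
    lemma₂ = solve-∀
  empty : ones (fac v i (suc m)) ≡ 0
  empty = n≤0⇒n≡0 (+-cancelʳ-≤ m _ _ (≤-trans (≤-reflexive full) (ones-fac≤ v′ (suc i′) m)))
  small : Cube true v′ i′
  small = Const-≤ {v = v′} (s≤s (s≤s (4≤2+m*2 m l)))
    (Const-∷ {v = v′} e (Const-snoc {v = v′} m (ones-full m
      (≤-trans (m≤n+m m _) (≤-reflexive full))) f))
exceptional-even v v′ i i′ m l o q | false | true =
  ⊥-elim (<-irrefl (trans (suc-injective o) (+-comm m 1)) ≤-refl)
exceptional-even v v′ i i′ m l o q | true | false =
  ⊥-elim (<-irrefl (sym (trans o (+-identityʳ m))) ≤-refl)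

shape : ∀ ρ σ n n₁ → 1 ≤ n → bit ρ + (n + bit σ) ≡ n₁ * 2 →
  ∃ λ m → n ≡ bit ρ + bit σ + m * 2 × n₁ ≡ bit ρ + bit σ + m
shape false false n n₁ _ e = n₁ , trans (sym (+-identityʳ n)) e , refl
shape false true n zero _ e = ⊥-elim (1+n≢0 (trans (+-comm 1 n) e))
shape false true n (suc m) _ e = m , suc-injective (trans (+-comm 1 n) e) , refl
shape true false n (suc m) _ e = m , trans (sym (+-identityʳ n)) (suc-injective e) , refl
shape true true n (suc zero) l e =
  ⊥-elim (<-irrefl (sym (+-cancelʳ-≡ 1 n 0 (suc-injective e))) l)
shape true true n (suc (suc m)) _ e = m , suc-injective (trans (+-comm 1 n) (suc-injective e)) , refl

BlockEq : ℕ → Bool → Bool → Bool → Bool → ℕ → ℕ → InfWord → ℕ → InfWord → ℕ → Set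
BlockEq j ρ σ ρ′ σ′ n₁ n₁′ v i v′ i′ = ρ ≡ ρ′ × σ ≡ σ′ × n₁ ≡ n₁′
  × EndsAgree ρ σ v i v′ i′ n₁ × fac v i n₁ ≈[ j ] fac v′ i′ n₁

bit-parity : ∀ {m n} a b → bit a + m * 2 ≡ bit b + n * 2 → a ≡ b × m ≡ n
bit-parity {m} {n} false false e = refl , *-cancelʳ-≡ m n 2 e
bit-parity {m} {n} true true e = refl , *-cancelʳ-≡ m n 2 (suc-injective e)
bit-parity {m} {n} true false e = ⊥-elim (odd≢even m n e)
bit-parity {m} {n} false true e = ⊥-elim (odd≢even n m (sym e))

-- Equal lengths make the parities of ρ + σ agree. Equal alignments then lead to the preimages, and
-- the remaining mixed pairs are the two exceptional lemmas and their mirror images.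
≈-block⁻ : ∀ {j} ρ σ ρ′ σ′ v v′ i i′ m m′ → bit ρ + bit σ + m * 2 ≡ bit ρ′ + bit σ′ + m′ * 2 →
  4 ≤ bit ρ + bit σ + m * 2 → block ρ σ v i m ≈[ 2 + j ] block ρ′ σ′ v′ i′ m′ →
  BlockEq (suc j) ρ σ ρ′ σ′ (bit ρ + bit σ + m) (bit ρ′ + bit σ′ + m′) v i v′ i′
    ⊎ Exceptional (bit ρ + bit σ + m * 2) v i v′ i′
≈-block⁻ {j} ρ σ ρ′ σ′ v v′ i i′ m m′ e l p = go ρ σ ρ′ σ′ e l p o q
  where
  o : block-ones ρ σ v i m ≡ block-ones ρ′ σ′ v′ i′ m′
  o = trans (sym (ones-block ρ σ v i m)) (trans (sym (mom-0 (block ρ σ v i m))) (trans (p 0 z<s)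
        (trans (mom-0 (block ρ′ σ′ v′ i′ m′)) (ones-block ρ′ σ′ v′ i′ m′))))
  q : block-mom ρ σ v i m ≡ block-mom ρ′ σ′ v′ i′ m′
  q = trans (sym (mom-block ρ σ v i m)) (trans (p 1 (s≤s z<s)) (mom-block ρ′ σ′ v′ i′ m′))
  same : ∀ ρ σ → m ≡ m′ → block ρ σ v i m ≈[ 2 + j ] block ρ σ v′ i′ m′ →
    block-ones ρ σ v i m ≡ block-ones ρ σ v′ i′ m′ → block-mom ρ σ v i m ≡ block-mom ρ σ v′ i′ m′ →
    BlockEq (suc j) ρ σ ρ σ (bit ρ + bit σ + m) (bit ρ + bit σ + m′) v i v′ i′
  same ρ σ refl p o q = refl , refl , refl , ends ,
    ≈-φ⁻ {u = fac v i (bit ρ + bit σ + m)} {v = fac v′ i′ (bit ρ + bit σ + m)}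
      (trans (length-fac v i (bit ρ + bit σ + m)) (sym (length-fac v′ i′ (bit ρ + bit σ + m)))) (complete ρ σ v v′ i i′ m ends p)
    where ends = same-ends ρ σ v v′ i i′ m o q
  go : ∀ ρ σ ρ′ σ′ → bit ρ + bit σ + m * 2 ≡ bit ρ′ + bit σ′ + m′ * 2 →
    4 ≤ bit ρ + bit σ + m * 2 → block ρ σ v i m ≈[ 2 + j ] block ρ′ σ′ v′ i′ m′ →
    block-ones ρ σ v i m ≡ block-ones ρ′ σ′ v′ i′ m′ →
    block-mom ρ σ v i m ≡ block-mom ρ′ σ′ v′ i′ m′ →
    BlockEq (suc j) ρ σ ρ′ σ′ (bit ρ + bit σ + m) (bit ρ′ + bit σ′ + m′) v i v′ i′
      ⊎ Exceptional (bit ρ + bit σ + m * 2) v i v′ i′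
  go false false false false e l p o q =
    inj₁ (same false false (proj₂ (bit-parity {m} {m′} false false e)) p o q)
  go false true false true e l p o q =
    inj₁ (same false true (proj₂ (bit-parity {m} {m′} true true e)) p o q)
  go true false true false e l p o q =
    inj₁ (same true false (proj₂ (bit-parity {m} {m′} true true e)) p o q)
  go true true true true e l p o q = inj₁ (same true true
    (suc-injective (proj₂ (bit-parity {suc m} {suc m′} false false e))) p o q)
  go false true true false e l p o q with proj₂ (bit-parity {m} {m′} true true e)
  ... | refl = inj₂ (exceptional-odd v v′ i i′ m l o q)
  go true false false true e l p o q with proj₂ (bit-parity {m} {m′} true true e)
  ... | refl = inj₂ (Exceptional-sym {suc (m * 2)} {v′} {i′} {v} {i} (exceptional-odd v′ v i′ i m l (sym o) (sym q)))
  go false false true true e l p o q with proj₂ (bit-parity {m} {suc m′} false false e)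
  ... | refl = inj₂ (exceptional-even v v′ i i′ m′ l o q)
  go true true false false e l p o q with proj₂ (bit-parity {suc m} {m′} false false e)
  ... | refl = inj₂ (Exceptional-sym {2 + m * 2} {v′} {i′} {v} {i} (exceptional-even v′ v i′ i m l (sym o) (sym q)))
  go false false false true e _ _ _ _ = ⊥-elim (odd≢even m′ m (sym e))
  go false false true false e _ _ _ _ = ⊥-elim (odd≢even m′ m (sym e))
  go false true false false e _ _ _ _ = ⊥-elim (odd≢even m m′ e)
  go false true true true e _ _ _ _ = ⊥-elim (odd≢even m (suc m′) e)
  go true false false false e _ _ _ _ = ⊥-elim (odd≢even m m′ e)
  go true false true true e _ _ _ _ = ⊥-elim (odd≢even m (suc m′) e)
  go true true false true e _ _ _ _ = ⊥-elim (odd≢even m′ (suc m) (sym e))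
  go true true true false e _ _ _ _ = ⊥-elim (odd≢even m′ (suc m) (sym e))

-- Windows of φ^k(y)

halve : ∀ n → ∃ λ ρ → ∃ λ m → n ≡ bit ρ + m * 2
halve zero = false , 0 , refl
halve (suc n) with halve n
... | false , m , e = true , m , cong suc e
... | true , m , e = false , suc m , cong suc e

*-2^suc : ∀ q k → q * 2 ^ suc k ≡ (q * 2 ^ k) * 2
*-2^suc q k = lemma q (2 ^ k)
  where
  lemma : ∀ q p → q * (2 * p) ≡ (q * p) * 2
  lemma = solve-∀

half< : ∀ ρ m k → bit ρ + m * 2 < 2 ^ suc k → m < 2 ^ k
half< ρ m k l = *-cancelʳ-< 2 m (2 ^ k) (≤-<-trans (m≤n+m (m * 2) (bit ρ))
  (<-≤-trans l (≤-reflexive (*-comm 2 (2 ^ k)))))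

position-half : ∀ ρ t q k → (bit ρ + t * 2) + q * 2 ^ suc k ≡ bit ρ + (t + q * 2 ^ k) * 2
position-half ρ t q k = lemma (bit ρ) t q (2 ^ k)
  where
  lemma : ∀ b t q p → (b + t * 2) + q * (2 * p) ≡ b + (t + q * p) * 2
  lemma = solve-∀

φ∞-letter : ∀ ρ v v′ i i′ → v i ≡ v′ i′ → φ∞ v (bit ρ + i * 2) ≡ φ∞ v′ (bit ρ + i′ * 2)
φ∞-letter false v v′ i i′ e = trans (φ∞-even v i) (trans e (sym (φ∞-even v′ i′)))
φ∞-letter true v v′ i i′ e = trans (φ∞-odd v i) (trans (cong not e) (sym (φ∞-odd v′ i′)))

φ∞-letter⁻ : ∀ ρ v v′ i i′ → φ∞ v (bit ρ + i * 2) ≡ φ∞ v′ (bit ρ + i′ * 2) → v i ≡ v′ i′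
φ∞-letter⁻ false v v′ i i′ e = trans (sym (φ∞-even v i)) (trans e (φ∞-even v′ i′))
φ∞-letter⁻ true v v′ i i′ e = trans (sym (not-involutive (v i)))
  (trans (cong not (trans (sym (φ∞-odd v i)) (trans e (φ∞-odd v′ i′)))) (not-involutive (v′ i′)))

φ∞^-half : ∀ k y ρ t q →
  φ∞^ (suc k) y ((bit ρ + t * 2) + q * 2 ^ suc k) ≡ φ∞ (φ∞^ k y) (bit ρ + (t + q * 2 ^ k) * 2)
φ∞^-half k y ρ t q =
  trans (φ∞^-outer k y _) (cong (φ∞ (φ∞^ k y)) (position-half ρ t q k))

letter : ∀ k y y′ q q′ t → t < 2 ^ k → y q ≡ y′ q′ →
  φ∞^ k y (t + q * 2 ^ k) ≡ φ∞^ k y′ (t + q′ * 2 ^ k)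
letter zero y y′ q q′ zero _ e =
  subst₂ (λ a b → y a ≡ y′ b) (sym (*-identityʳ q)) (sym (*-identityʳ q′)) e
letter zero y y′ q q′ (suc t) (s≤s ()) e
letter (suc k) y y′ q q′ t l e with halve t
... | ρ , t₁ , refl = trans (φ∞^-half k y ρ t₁ q)
  (trans (φ∞-letter ρ (φ∞^ k y) (φ∞^ k y′) _ _ (letter k y y′ q q′ t₁ (half< ρ t₁ k l) e))
         (sym (φ∞^-half k y′ ρ t₁ q′)))

-- The images of 0 and 1 under φ^k are complementary, so any single letter of a block identifies the
-- block.
letter⁻ : ∀ k y y′ q q′ t → t < 2 ^ k →
  φ∞^ k y (t + q * 2 ^ k) ≡ φ∞^ k y′ (t + q′ * 2 ^ k) → y q ≡ y′ q′
letter⁻ zero y y′ q q′ zero _ e =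
  subst₂ (λ a b → y a ≡ y′ b) (*-identityʳ q) (*-identityʳ q′) e
letter⁻ zero y y′ q q′ (suc t) (s≤s ()) e
letter⁻ (suc k) y y′ q q′ t l e with halve t
... | ρ , t₁ , refl = letter⁻ k y y′ q q′ t₁ (half< ρ t₁ k l)
  (φ∞-letter⁻ ρ (φ∞^ k y) (φ∞^ k y′) _ _
    (trans (sym (φ∞^-half k y ρ t₁ q)) (trans e (φ∞^-half k y′ ρ t₁ q′))))

fac-φ^ : ∀ k y q n → fac (φ∞^ k y) (q * 2 ^ k) (n * 2 ^ k) ≡ φ^ k (fac y q n)
fac-φ^ zero y q n = cong₂ (fac y) (*-identityʳ q) (*-identityʳ n)
fac-φ^ (suc k) y q n = trans
  (cong₂ (fac (φ∞^ k (φ∞ y))) (lemma q (2 ^ k)) (lemma n (2 ^ k)))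
  (trans (fac-φ^ k (φ∞ y) (q * 2) (n * 2)) (cong (φ^ k) (fac-φ y q n)))
  where
  lemma : ∀ q p → q * (2 * p) ≡ (q * 2) * p
  lemma = solve-∀

not≢ : ∀ b → not b ≢ b
not≢ false ()
not≢ true ()

-- Three consecutive letters contain a complete block, whose two letters differ.
cube-free-φ∞ : ∀ c v i → ¬ Cube c (φ∞ v) i
cube-free-φ∞ c v i p with halve i
... | false , m , refl = not≢ (v m) (trans (sym (φ∞-odd v m))
        (trans (trans (p 1 (s≤s z<s)) (sym (p 0 z<s))) (φ∞-even v m)))
... | true , m , refl = not≢ (v (suc m)) (trans (sym (φ∞-odd v (suc m)))
        (trans (trans (p 2 (s≤s (s≤s z<s))) (sym (p 1 (s≤s z<s)))) (φ∞-even v (suc m))))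

cube-free-φ∞^ : ∀ k c y i → ¬ Cube c (φ∞^ (suc k) y) i
cube-free-φ∞^ k c y i p =
  cube-free-φ∞ c (φ∞^ k y) i (λ j l → trans (sym (φ∞^-outer k y (j + i))) (p j l))

-- A window of length n starting at offset r in block q of φ^k(y), and ending s letters
-- before the end of block q + l ∸ 1.
SameType : InfWord → InfWord → (q q′ r r′ s s′ l l′ : ℕ) → Set
SameType y y′ q q′ r r′ s s′ l l′ =
  r ≡ r′ × s ≡ s′ × l ≡ l′ × (r ≢ 0 → y q ≡ y′ q′)
  × (s ≢ 0 → ∀ m → l ≡ suc m → y (m + q) ≡ y′ (m + q′))
  × ones (fac y q l) ≡ ones (fac y′ q′ l′)

-- Of the words from y up to φ^k(y) only y can contain cubes, so an exception always shows in y. The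
-- threshold is the length 4 of the case k = 1, doubled at each further level.
LevelExceptional : ℕ → ℕ → InfWord → ℕ → InfWord → ℕ → Set
LevelExceptional k n y q y′ q′ = ∃ λ c →
  (Cube c y q ⊎ Cube (not c) y′ q′) × (2 ^ suc k < n → Cube c y q × Cube (not c) y′ q′)

-- ρ and σ are the lowest binary digits of the two offsets, and n₁ is the number of blocks of the
-- outermost φ that the window meets.
cover-half : ∀ k r s n l ρ σ r₁ s₁ → r ≡ bit ρ + r₁ * 2 → s ≡ bit σ + s₁ * 2 →
  r + (n + s) ≡ l * 2 ^ suc k →
  ∃ λ n₁ → bit ρ + (n + bit σ) ≡ n₁ * 2 × r₁ + (n₁ + s₁) ≡ l * 2 ^ k
cover-half k r s n l ρ σ r₁ s₁ refl refl e = Y ∸ Z ,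
  trans (sym (m+n∸n≡m (bit ρ + (n + bit σ)) (Z * 2)))
    (trans (cong (_∸ Z * 2) e′) (sym (*-distribʳ-∸ 2 Y Z))) ,
  trans (lemma′ r₁ (Y ∸ Z) s₁) (m∸n+n≡m (*-cancelʳ-≤ Z Y 2 (≤-trans (m≤n+m (Z * 2) _) (≤-reflexive e′))))
  where
  Y = l * 2 ^ k
  Z = r₁ + s₁
  lemma : ∀ b n c r s → b + (n + c) + (r + s) * 2 ≡ b + r * 2 + (n + (c + s * 2))
  lemma = solve-∀
  lemma′ : ∀ r n s → r + (n + s) ≡ n + (r + s)
  lemma′ = solve-∀
  e′ : bit ρ + (n + bit σ) + Z * 2 ≡ Y * 2
  e′ = trans (lemma (bit ρ) n (bit σ) r₁ s₁) (trans e (*-2^suc l k))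

last-offset : ∀ k q r s m l → s < 2 ^ k → r + (suc m + s) ≡ suc l * 2 ^ k →
  m + (r + q * 2 ^ k) ≡ (2 ^ k ∸ suc s) + (l + q) * 2 ^ k
last-offset k q r s m l s< e = +-cancelʳ-≡ (suc s) _ _ (begin
  m + (r + q * P) + suc s            ≡⟨ lemma₁ m r (q * P) s ⟩
  r + (suc m + s) + q * P            ≡⟨ cong (_+ q * P) e ⟩
  P + l * P + q * P                  ≡⟨ cong (λ z → z + l * P + q * P) (sym (m∸n+n≡m s<)) ⟩
  (P ∸ suc s) + suc s + l * P + q * P ≡⟨ lemma₂ (P ∸ suc s) (suc s) l q P ⟩
  (P ∸ suc s) + (l + q) * P + suc s ∎)
  where
  open ≡-Reasoning
  P = 2 ^ k
  lemma₁ : ∀ m r q s → m + (r + q) + suc s ≡ r + (suc m + s) + q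
  lemma₁ = solve-∀
  lemma₂ : ∀ t s l q p → t + s + l * p + q * p ≡ t + (l + q) * p + s
  lemma₂ = solve-∀

∸suc< : ∀ k s → s < 2 ^ k → 2 ^ k ∸ suc s < 2 ^ k
∸suc< k s l = ∸-monoʳ-< {2 ^ k} {suc s} {0} z<s l

-- Induction on k removes the outermost φ, one binary digit of each offset and one moment at a time.
-- The bound on n is halved with it, so windows have length at least 4 at every positive level.
≈⇒type : ∀ k y y′ q q′ r r′ s s′ n l l′ → r < 2 ^ k → r′ < 2 ^ k → s < 2 ^ k → s′ < 2 ^ k →
  2 ^ suc k ≤ n → r + (n + s) ≡ l * 2 ^ k → r′ + (n + s′) ≡ l′ * 2 ^ k →
  fac (φ∞^ k y) (r + q * 2 ^ k) n ≈[ suc k ] fac (φ∞^ k y′) (r′ + q′ * 2 ^ k) n →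
  SameType y y′ q q′ r r′ s s′ l l′ ⊎ LevelExceptional k n y q y′ q′
≈⇒type zero y y′ q q′ zero zero zero zero n l l′ _ _ _ _ _ e e′ p =
  inj₁ (refl , refl , l≡l′ , contradiction refl , contradiction refl ,
    trans (sym (fac-1 y q l n e)) (trans (trans (sym (mom-0 (fac y (q * 1) n))) (trans (p 0 z<s) (mom-0 (fac y′ (q′ * 1) n)))) (fac-1 y′ q′ l′ n e′)))
  where
  l≡l′ = trans (sym (*-identityʳ l)) (trans (sym e) (trans e′ (*-identityʳ l′)))
  fac-1 : ∀ y q l n → n + 0 ≡ l * 1 → ones (fac y (q * 1) n) ≡ ones (fac y q l)
  fac-1 y q l n e = cong₂ (λ a b → ones (fac y a b)) (*-identityʳ q)
    (trans (sym (+-identityʳ n)) (trans e (*-identityʳ l)))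
≈⇒type zero y y′ q q′ (suc r) r′ s s′ n l l′ (s≤s ()) _ _ _ _ _ _ _
≈⇒type zero y y′ q q′ r (suc r′) s s′ n l l′ _ (s≤s ()) _ _ _ _ _ _
≈⇒type zero y y′ q q′ r r′ (suc s) s′ n l l′ _ _ (s≤s ()) _ _ _ _ _
≈⇒type zero y y′ q q′ r r′ s (suc s′) n l l′ _ _ _ (s≤s ()) _ _ _ _
≈⇒type (suc k) y y′ q q′ r r′ s s′ n l l′ r< r′< s< s′< n≥ e e′ p
  with halve r | halve r′ | halve s | halve s′
... | ρ , r₁ , refl | ρ′ , r₁′ , refl | σ , s₁ , refl | σ′ , s₁′ , refl
  with cover-half k r s n l ρ σ r₁ s₁ refl refl e | cover-half k r′ s′ n l′ ρ′ σ′ r₁′ s₁′ refl refl e′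
... | n₁ , f , g | n₁′ , f′ , g′ = result (≈-block⁻ ρ σ ρ′ σ′ v v′ i i′ m m′
        (trans (sym h) h′) (subst (4 ≤_) h 4≤n)
        (subst₂ (_≈[ 2 + k ]_) (as-block y ρ σ r₁ q m h) (as-block y′ ρ′ σ′ r₁′ q′ m′ h′) p))
  where
  v = φ∞^ k y
  v′ = φ∞^ k y′
  i = r₁ + q * 2 ^ k
  i′ = r₁′ + q′ * 2 ^ k
  4≤n : 4 ≤ n
  4≤n = ≤-trans (*-monoʳ-≤ 2 (*-monoʳ-≤ 2 (m^n>0 2 k))) n≥
  sh = shape ρ σ n n₁ (≤-trans (s≤s z≤n) 4≤n) f
  sh′ = shape ρ′ σ′ n n₁′ (≤-trans (s≤s z≤n) 4≤n) f′
  m = proj₁ sh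
  m′ = proj₁ sh′
  h = proj₁ (proj₂ sh)
  h′ = proj₁ (proj₂ sh′)
  as-block : ∀ y ρ σ r₁ q m → n ≡ bit ρ + bit σ + m * 2 →
    fac (φ∞^ (suc k) y) (bit ρ + r₁ * 2 + q * 2 ^ suc k) n ≡ block ρ σ (φ∞^ k y) (r₁ + q * 2 ^ k) m
  as-block y ρ σ r₁ q m h = trans (cong₂ (fac (φ∞^ (suc k) y)) (position-half ρ r₁ q k) h)
    (trans (fac-cong (bit ρ + (r₁ + q * 2 ^ k) * 2) _ (bit ρ + bit σ + m * 2) (λ j _ → φ∞^-outer k y _))
           (fac-block ρ σ (φ∞^ k y) (r₁ + q * 2 ^ k) m))
  n≤ : n ≤ n₁ * 2
  n≤ = ≤-trans (m≤m+n n (bit σ)) (≤-trans (m≤n+m (n + bit σ) (bit ρ)) (≤-reflexive f))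
  n₁≥ : 2 ^ suc k ≤ n₁
  n₁≥ = *-cancelʳ-≤ (2 ^ suc k) n₁ 2 (≤-trans (≤-reflexive (*-comm (2 ^ suc k) 2)) (≤-trans n≥ n≤))
  result : BlockEq (suc k) ρ σ ρ′ σ′ (bit ρ + bit σ + m) (bit ρ′ + bit σ′ + m′) v i v′ i′
             ⊎ Exceptional (bit ρ + bit σ + m * 2) v i v′ i′ →
           SameType y y′ q q′ r r′ s s′ l l′ ⊎ LevelExceptional (suc k) n y q y′ q′
  result (inj₁ (refl , refl , eq , (ends₁ , ends₂) , win))
    with ≈⇒type k y y′ q q′ r₁ r₁′ s₁ s₁′ n₁ l l′ (half< ρ r₁ k r<) (half< ρ r₁′ k r′<)
           (half< σ s₁ k s<) (half< σ s₁′ k s′<) n₁≥ g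
           (subst (λ z → r₁′ + (z + s₁′) ≡ l′ * 2 ^ k) (trans (proj₂ (proj₂ sh′)) (trans (sym eq) (sym (proj₂ (proj₂ sh))))) g′)
           (subst₂ (λ a b → fac v i a ≈[ suc k ] fac v′ i′ b) (sym (proj₂ (proj₂ sh)))
             (sym (proj₂ (proj₂ sh))) win)
  ... | inj₁ (refl , refl , refl , first , last , o) =
    inj₁ (refl , refl , refl , first′ ρ refl , last′ σ refl , o)
    where
    first′ : ∀ τ → τ ≡ ρ → bit τ + r₁ * 2 ≢ 0 → y q ≡ y′ q′
    first′ false _ nz = first (λ z → nz (cong (_* 2) z))
    first′ true τ≡ _ = letter⁻ k y y′ q q′ r₁ (half< ρ r₁ k r<) (ends₁ (sym τ≡))
    last′ : ∀ τ → τ ≡ σ → bit τ + s₁ * 2 ≢ 0 → ∀ m → l ≡ suc m → y (m + q) ≡ y′ (m + q′)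
    last′ false _ nz = last (λ z → nz (cong (_* 2) z))
    last′ true τ≡ _ l₁ refl = inner n₁ refl
      where
      s₁< = half< σ s₁ k s<
      inner : ∀ n₂ → n₁ ≡ n₂ → y (l₁ + q) ≡ y′ (l₁ + q′)
      inner zero z = ⊥-elim (<-irrefl (sym z) (<-≤-trans (m^n>0 2 (suc k)) n₁≥))
      -- The last letter of the window of `v` has offset 2ᵏ - 1 - s₁ in its block, so it identifies
      -- the last letter of y that is met.
      inner (suc n₂) z = letter⁻ k y y′ (l₁ + q) (l₁ + q′) (2 ^ k ∸ suc s₁) (∸suc< k s₁ s₁<)
          (subst₂ (λ a b → v a ≡ v′ b) (last-offset k q r₁ s₁ n₂ l₁ s₁< g″)
            (last-offset k q′ r₁ s₁ n₂ l₁ s₁< g″)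
            (ends₂ (sym τ≡) n₂ (trans (sym (proj₂ (proj₂ sh))) z)))
        where g″ = subst (λ z → r₁ + (z + s₁) ≡ suc l₁ * 2 ^ k) z g
  ... | inj₂ (c , cube , both) = inj₂ (c , cube , λ big → both
    (*-cancelʳ-< 2 (2 ^ suc k) n₁ (<-≤-trans (≤-<-trans (≤-reflexive (*-comm (2 ^ suc k) 2)) big) n≤)))
  result (inj₂ ex) = exceptional k refl ex
    where
    exceptional : ∀ k′ → k′ ≡ k → Exceptional (bit ρ + bit σ + m * 2) v i v′ i′ →
      SameType y y′ q q′ r r′ s s′ l l′ ⊎ LevelExceptional (suc k) n y q y′ q′
    exceptional (suc k′) refl (c , inj₁ cube , _) = ⊥-elim (cube-free-φ∞^ k′ c y i cube)
    exceptional (suc k′) refl (c , inj₂ cube , _) = ⊥-elim (cube-free-φ∞^ k′ (not c) y′ i′ cube)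
    exceptional zero refl (c , cube , both) = inj₂ (subst₂
        (λ a b → ∃ λ c → (Cube c y a ⊎ Cube (not c) y′ b) × (4 < n → Cube c y a × Cube (not c) y′ b))
        (start r₁ q (half< ρ r₁ 0 r<)) (start r₁′ q′ (half< ρ′ r₁′ 0 r′<))
        (c , cube , λ big → both (subst (5 ≤_) h big)))
      where
      start : ∀ r q → r < 1 → r + q * 1 ≡ q
      start zero q _ = *-identityʳ q
      start (suc r) q (s≤s ())

-- Completing the windows to whole blocks adds equal words on either side, since the partially met
-- blocks agree. The completed words are equivalent by permuting blocks, and the added parts cancel.
type⇒∼ : ∀ k y y′ q q′ r s n l → r < 2 ^ k → s < 2 ^ k → r + (n + s) ≡ l * 2 ^ k →
  SameType y y′ q q′ r r s s l l →
  fac (φ∞^ k y) (r + q * 2 ^ k) n ∼[ suc k ] fac (φ∞^ k y′) (r + q′ * 2 ^ k) n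
type⇒∼ k y y′ q q′ r s n l r< s< e (_ , _ , _ , first , last , o) =
  ∼-++ʳ⁻ (fac X (n + (r + q * P)) s) (∼-++ˡ⁻ (fac X (q * P) r)
    (subst₂ (_∼[ suc k ]_) (split y q) (trans (split y′ q′) (cong₂ (λ u w → u ++ fac X′ (r + q′ * P) n ++ w)
      (sym (fac-cong (q * P) (q′ * P) r (λ j l → letter k y y′ q q′ j (<-trans l r<) (first (λ z → n≮0 (subst (j <_) z l))))))
      (sym (fac-cong (n + (r + q * P)) (n + (r + q′ * P)) s (suffix l e last)))))
      (φ^-cong-↭ k (ones-↭ (fac y q l) (fac y′ q′ l) (trans (length-fac y q l) (sym (length-fac y′ q′ l))) o))))
  where
  P = 2 ^ k
  X = φ∞^ k y
  X′ = φ∞^ k y′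
  split : ∀ y q → φ^ k (fac y q l) ≡
    fac (φ∞^ k y) (q * P) r ++ fac (φ∞^ k y) (r + q * P) n ++ fac (φ∞^ k y) (n + (r + q * P)) s
  split y q = trans (sym (fac-φ^ k y q l)) (trans (cong (fac (φ∞^ k y) (q * P)) (sym e))
    (trans (fac-++ (φ∞^ k y) (q * P) r (n + s))
      (cong (fac (φ∞^ k y) (q * P) r ++_) (fac-++ (φ∞^ k y) (r + q * P) n s))))
  suffix : ∀ l → r + (n + s) ≡ l * P → (s ≢ 0 → ∀ m → l ≡ suc m → y (m + q) ≡ y′ (m + q′)) →
    ∀ j → j < s → X (j + (n + (r + q * P))) ≡ X′ (j + (n + (r + q′ * P)))
  suffix zero e _ j j<s = ⊥-elim (<-irrefl refl (≤-trans (s≤s z≤n) (≤-trans j<s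
    (≤-trans (m≤n+m s n) (≤-trans (m≤n+m (n + s) r) (≤-reflexive e))))))
  suffix (suc m) e last j j<s = subst₂ (λ a b → X a ≡ X′ b) (sym (at-end q)) (sym (at-end q′))
    (letter k y y′ (m + q) (m + q′) (j + (P ∸ s))
      (<-≤-trans (+-monoˡ-< (P ∸ s) j<s) (≤-reflexive (m+[n∸m]≡n (<⇒≤ s<))))
      (last (λ z → n≮0 (subst (j <_) z j<s)) m refl))
    where
    at-end : ∀ q → j + (n + (r + q * P)) ≡ j + (P ∸ s) + (m + q) * P
    at-end q = +-cancelʳ-≡ s _ _ (begin
      j + (n + (r + q * P)) + s              ≡⟨ lemma₁ j n r (q * P) s ⟩
      j + (r + (n + s)) + q * P              ≡⟨ cong (λ z → j + z + q * P) e ⟩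
      j + (P + m * P) + q * P                ≡⟨ cong (λ z → j + (z + m * P) + q * P) (sym (m∸n+n≡m (<⇒≤ s<))) ⟩
      j + ((P ∸ s) + s + m * P) + q * P      ≡⟨ lemma₂ j (P ∸ s) s m q P ⟩
      j + (P ∸ s) + (m + q) * P + s ∎)
      where
      open ≡-Reasoning
      lemma₁ : ∀ j n r q s → j + (n + (r + q)) + s ≡ j + (r + (n + s)) + q
      lemma₁ = solve-∀
      lemma₂ : ∀ j t s m q p → j + (t + s + m * p) + q * p ≡ j + t + (m + q) * p + s
      lemma₂ = solve-∀

-- Counting classes; types of windows

-- Representatives are given by positions, and separation is stated positively, as injectivity, so
-- that it feeds directly into the comparisons of finite sets.
Classes : InfWord → ℕ → ℕ → ℕ → Set
Classes x j n M = ∃ λ (pos : Fin M → ℕ) →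
  (∀ a b → fac x (pos a) n ∼[ j ] fac x (pos b) n → a ≡ b)
  × (∀ i → ∃ λ a → fac x i n ∼[ j ] fac x (pos a) n)

classes : ∀ {x j n M} → BinomComplexity x j n M → Classes x j n M
classes {x} {j} {n} (r , factor , distinct , cover) = pos , separated , covered
  where
  pos = λ a → proj₁ (proj₁ (factor a))
  pos-r : ∀ a → fac x (pos a) n ≡ r a
  pos-r a = trans (cong (fac x (pos a)) (sym (proj₂ (factor a)))) (proj₂ (proj₁ (factor a)))
  separated : ∀ a b → fac x (pos a) n ∼[ j ] fac x (pos b) n → a ≡ b
  separated a b p with a Fin.≟ b
  ... | yes e = e
  ... | no ne = ⊥-elim (distinct a b ne (subst₂ (_∼[ j ]_) (pos-r a) (pos-r b) p))
  covered : ∀ i → ∃ λ a → fac x i n ∼[ j ] fac x (pos a) n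
  covered i with cover (fac x i n) (i , cong (fac x i) (length-fac x i n)) (length-fac x i n)
  ... | a , p = a , subst (fac x i n ∼[ j ]_) (sym (pos-r a)) p

↔-injective : ∀ {A B : Set} (e : A ↔ B) {a a′} → Inverse.to e a ≡ Inverse.to e a′ → a ≡ a′
↔-injective e {a} {a′} p = trans (sym (Inverse.strictlyInverseʳ e a))
  (trans (cong (Inverse.from e) p) (Inverse.strictlyInverseʳ e a′))

↔-injective⁻ : ∀ {A B : Set} (e : A ↔ B) {b b′} → Inverse.from e b ≡ Inverse.from e b′ → b ≡ b′
↔-injective⁻ e {b} {b′} p = trans (sym (Inverse.strictlyInverseˡ e b))
  (trans (cong (Inverse.to e) p) (Inverse.strictlyInverseˡ e b′))

card-≤ : ∀ {I J : Set} {a b} → I ↔ Fin a → J ↔ Fin b → (f : I → J) →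
  (∀ i i′ → f i ≡ f i′ → i ≡ i′) → a ≤ b
card-≤ eI eJ f inj = injective⇒≤ {f = Inverse.to eJ ∘ f ∘ Inverse.from eI}
  (λ p → ↔-injective⁻ eI (inj _ _ (↔-injective eJ p)))

classes-≥ : ∀ {x j n M N} {I : Set} → Classes x j n M → I ↔ Fin N → (pos : I → ℕ) →
  (∀ i i′ → fac x (pos i) n ∼[ j ] fac x (pos i′) n → i ≡ i′) → N ≤ M
classes-≥ {x} {j} {n} (pos₀ , _ , cover) e pos sep =
  card-≤ e (↔-id _) (λ i → proj₁ (cover (pos i)))
    (λ i i′ p → sep i i′ (∼-trans (proj₂ (cover (pos i)))
      (∼-sym (subst (λ a → fac x (pos i′) n ∼[ j ] fac x (pos₀ a) n) (sym p) (proj₂ (cover (pos i′)))))))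

classes-≤ : ∀ {x j n M N} {J : Set} (C : Classes x j n M) → J ↔ Fin N → (key : Fin M → J) →
  (∀ a b → key a ≡ key b → fac x (proj₁ C a) n ∼[ j ] fac x (proj₁ C b) n) → M ≤ N
classes-≤ (_ , sep , _) e key p = card-≤ (↔-id _) e key (λ a b q → sep a b (p a b q))

-- p is the size of the decidable subset D; the injections in both directions allow p to be bounded
-- from either side.
Enumeration : ∀ {n} → (Fin n → Set) → ℕ → Set
Enumeration {n} D p = ∃ λ (to : ∀ i → D i → Fin p) → ∃ λ (from : Fin p → Fin n) →
  (∀ i i′ d d′ → to i d ≡ to i′ d′ → i ≡ i′)
  × (∀ a → D (from a)) × (∀ a b → from a ≡ from b → a ≡ b)

enumerate : ∀ n (D : Fin n → Set) → (∀ i → Dec (D i)) → ∃ λ p → Enumeration D p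
enumerate zero D D? = 0 , (λ ()) , (λ ()) , (λ ()) , (λ ()) , (λ ())
enumerate (suc n) D D? with D? Fin.zero | enumerate n (D ∘ Fin.suc) (D? ∘ Fin.suc)
... | yes d₀ | p , to , from , to-inj , D-from , from-inj =
    suc p , to′ , from′ , to′-inj , D-from′ , from′-inj
  where
  to′ : ∀ i → D i → Fin (suc p)
  to′ Fin.zero _ = Fin.zero
  to′ (Fin.suc i) d = Fin.suc (to i d)
  from′ : Fin (suc p) → Fin (suc n)
  from′ Fin.zero = Fin.zero
  from′ (Fin.suc a) = Fin.suc (from a)
  to′-inj : ∀ i i′ d d′ → to′ i d ≡ to′ i′ d′ → i ≡ i′
  to′-inj Fin.zero Fin.zero _ _ _ = refl
  to′-inj (Fin.suc i) (Fin.suc i′) d d′ e =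
    cong Fin.suc (to-inj i i′ d d′ (Fin-suc-injective e))
  D-from′ : ∀ a → D (from′ a)
  D-from′ Fin.zero = d₀
  D-from′ (Fin.suc a) = D-from a
  from′-inj : ∀ a b → from′ a ≡ from′ b → a ≡ b
  from′-inj Fin.zero Fin.zero _ = refl
  from′-inj (Fin.suc a) (Fin.suc b) e =
    cong Fin.suc (from-inj a b (Fin-suc-injective e))
... | no ¬d₀ | p , to , from , to-inj , D-from , from-inj =
    p , to′ , Fin.suc ∘ from , to′-inj , D-from , λ a b e → from-inj a b (Fin-suc-injective e)
  where
  to′ : ∀ i → D i → Fin p
  to′ Fin.zero d = ⊥-elim (¬d₀ d)
  to′ (Fin.suc i) d = to i d
  to′-inj : ∀ i i′ d d′ → to′ i d ≡ to′ i′ d′ → i ≡ i′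
  to′-inj Fin.zero _ d _ _ = ⊥-elim (¬d₀ d)
  to′-inj (Fin.suc i) Fin.zero _ d _ = ⊥-elim (¬d₀ d)
  to′-inj (Fin.suc i) (Fin.suc i′) d d′ e = cong Fin.suc (to-inj i i′ d d′ e)

Triple : Set
Triple = Bool × Bool × Bool

Bool↔ : Bool ↔ Fin 2
Bool↔ = ↔-sym 2↔Bool

Pair↔ : (Bool × Bool) ↔ Fin 4
Pair↔ = ↔-sym *↔× ↔-∘ (Bool↔ ×-↔ Bool↔)

Triple↔ : Triple ↔ Fin 8
Triple↔ = ↔-sym *↔× ↔-∘ (Bool↔ ×-↔ Pair↔)

⊎↔ : ∀ {A B : Set} {a b} → A ↔ Fin a → B ↔ Fin b → (A ⊎ B) ↔ Fin (a + b)
⊎↔ e f = ↔-sym +↔⊎ ↔-∘ (e ⊎-↔ f)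

×↔ : ∀ {a b} → (Fin a × Fin b) ↔ Fin (a * b)
×↔ = ↔-sym *↔×

NotAllEqual : Triple → Set
NotAllEqual (a , g , b) = ¬ (a ≡ g × g ≡ b)

code₆ : Triple → Fin 6
code₆ (false , false , true) = 0F
code₆ (false , true , false) = 1F
code₆ (false , true , true) = 2F
code₆ (true , false , false) = 3F
code₆ (true , false , true) = 4F
code₆ (true , true , false) = 5F
-- A dummy value for the two constant triples, which `decode₆-code₆` excludes.
code₆ _ = 0F

decode₆ : Fin 6 → Triple
decode₆ 0F = false , false , true
decode₆ 1F = false , true , false
decode₆ 2F = false , true , true
decode₆ 3F = true , false , false
decode₆ 4F = true , false , true
decode₆ 5F = true , true , false

decode₆-code₆ : ∀ τ → NotAllEqual τ → decode₆ (code₆ τ) ≡ τ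
decode₆-code₆ (false , false , false) ne = ⊥-elim (ne (refl , refl))
decode₆-code₆ (true , true , true) ne = ⊥-elim (ne (refl , refl))
decode₆-code₆ (false , false , true) _ = refl
decode₆-code₆ (false , true , false) _ = refl
decode₆-code₆ (false , true , true) _ = refl
decode₆-code₆ (true , false , false) _ = refl
decode₆-code₆ (true , false , true) _ = refl
decode₆-code₆ (true , true , false) _ = refl

decode₆-notAllEqual : ∀ i → NotAllEqual (decode₆ i)
decode₆-notAllEqual 0F (_ , ())
decode₆-notAllEqual 1F (() , _)
decode₆-notAllEqual 2F (() , _)
decode₆-notAllEqual 3F (() , _)
decode₆-notAllEqual 4F (() , _)
decode₆-notAllEqual 5F (_ , ())

decode₆-injective : ∀ i j → decode₆ i ≡ decode₆ j → i ≡ j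
decode₆-injective i j e = trans (sym (code₆-decode₆ i)) (trans (cong code₆ e) (code₆-decode₆ j))
  where
  code₆-decode₆ : ∀ i → code₆ (decode₆ i) ≡ i
  code₆-decode₆ 0F = refl
  code₆-decode₆ 1F = refl
  code₆-decode₆ 2F = refl
  code₆-decode₆ 3F = refl
  code₆-decode₆ 4F = refl
  code₆-decode₆ 5F = refl

Balanced : InfWord → ℕ → Set
Balanced y m = ∀ q → ∃ λ g → ones (fac y q (suc (m * 2))) ≡ bit g + m

-- The first letter, the heavier letter of the inner window, and the last letter of y[q, q + 2m + 3).
type : ∀ y m → Balanced y m → ℕ → Triple
type y m h q = y q , proj₁ (h (suc q)) , y (2 + m * 2 + q)

weight : Triple → ℕ
weight (a , g , b) = bit a + bit g + bit b

ones-cover : ∀ y m h q → ones (fac y q (3 + m * 2)) ≡ weight (type y m h q) + m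
ones-cover y m h q = trans (cong (bit (y q) +_) (trans (cong ones (fac-snoc y (suc q) (suc (m * 2))))
    (trans (ones-++ (fac y (suc q) (suc (m * 2))) _)
      (cong₂ (λ u v → u + (bit (y v) + 0)) (proj₂ (h (suc q))) (+-suc (suc (m * 2)) q)))))
  (lemma (bit (y q)) (bit (proj₁ (h (suc q)))) (bit (y (2 + m * 2 + q))) m)
  where
  lemma : ∀ a g b m → a + (g + m + (b + 0)) ≡ a + g + b + m
  lemma = solve-∀

ones-even : ∀ y m (h : Balanced y m) q →
  ones (fac y q (2 + m * 2)) ≡ bit (y q) + bit (proj₁ (h (suc q))) + m
ones-even y m h q = trans (cong (bit (y q) +_) (proj₂ (h (suc q)))) (sym (+-assoc (bit (y q)) _ m))

ones-even-suc : ∀ y m (h : Balanced y m) q →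
  ones (fac y (suc q) (2 + m * 2)) ≡ bit (proj₁ (h (suc q))) + bit (y (2 + m * 2 + q)) + m
ones-even-suc y m h q = trans (cong ones (fac-snoc y (suc q) (suc (m * 2))))
  (trans (ones-++ (fac y (suc q) (suc (m * 2))) _)
    (trans (cong₂ (λ u v → u + (bit (y v) + 0)) (proj₂ (h (suc q))) (+-suc (suc (m * 2)) q))
      (lemma (bit (proj₁ (h (suc q)))) (bit (y (2 + m * 2 + q))) m)))
  where
  lemma : ∀ g b m → g + m + (b + 0) ≡ g + b + m
  lemma = solve-∀

type-≡ : ∀ y y′ m h h′ q q′ → y q ≡ y′ q′ → y (2 + m * 2 + q) ≡ y′ (2 + m * 2 + q′) →
  ones (fac y q (3 + m * 2)) ≡ ones (fac y′ q′ (3 + m * 2)) → type y m h q ≡ type y′ m h′ q′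
type-≡ y y′ m h h′ q q′ a b o = cong₂ _,_ a (cong₂ _,_
  (bit-injective (+-cancelˡ-≡ (bit (y q)) _ _ (+-cancelʳ-≡ (bit (y (2 + m * 2 + q))) _ _
    (trans (+-cancelʳ-≡ m _ _ (trans (sym (ones-cover y m h q)) (trans o (ones-cover y′ m h′ q′))))
      (cong₂ (λ c d → bit c + bit (proj₁ (h′ (suc q′))) + bit d) (sym a) (sym b)))))) b)

type-ones : ∀ y y′ m h h′ q q′ → type y m h q ≡ type y′ m h′ q′ →
  ones (fac y q (3 + m * 2)) ≡ ones (fac y′ q′ (3 + m * 2))
type-ones y y′ m h h′ q q′ e =
  trans (ones-cover y m h q) (trans (cong (λ τ → weight τ + m) e) (sym (ones-cover y′ m h′ q′)))

majority : ∀ τ → NotAllEqual τ → ∃ λ g → weight τ ≡ bit g + 1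
majority (false , false , false) ne = ⊥-elim (ne (refl , refl))
majority (true , true , true) ne = ⊥-elim (ne (refl , refl))
majority (false , false , true) _ = false , refl
majority (false , true , false) _ = false , refl
majority (false , true , true) _ = true , refl
majority (true , false , false) _ = false , refl
majority (true , false , true) _ = true , refl
majority (true , true , false) _ = true , refl

-- A window of length 2m + 3 has m ones plus the weight of its triple, and this weight is 1 or 2
-- unless the triple is constant. Unbalanced windows are thus those of type (s, s, s).
notAllEqual⇒balanced : ∀ y m h → (∀ q → NotAllEqual (type y m h q)) → Balanced y (suc m)
notAllEqual⇒balanced y m h ne q with majority (type y m h q) (ne q)
... | g , e = g , trans (ones-cover y m h q) (trans (cong (_+ m) e) (+-assoc (bit g) 1 m))

balanced⇒notAllEqual : ∀ y m h → Balanced y (suc m) → ∀ q → NotAllEqual (type y m h q)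
balanced⇒notAllEqual y m h h′ q (e , e′) = clash (y q) (proj₁ (h (suc q))) (y (2 + m * 2 + q)) (proj₁ (h′ q)) e e′
    (+-cancelʳ-≡ m _ _ (trans (sym (ones-cover y m h q)) (trans (proj₂ (h′ q)) (sym (+-assoc (bit (proj₁ (h′ q))) 1 m)))))
  where
  clash : ∀ a z b g → a ≡ z → z ≡ b → weight (a , z , b) ≡ bit g + 1 → ⊥
  clash false _ _ false refl refl ()
  clash false _ _ true refl refl ()
  clash true _ _ false refl refl ()
  clash true _ _ true refl refl ()

-- A window of odd length consists of m complete blocks with one 1 each and a single further letter
-- at one end.
balanced-φ∞ : ∀ v m → Balanced (φ∞ v) m
balanced-φ∞ v m q with halve q
... | false , i , refl = v (m + i) , trans (cong ones (fac-block false true v i m))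
        (trans (ones-block false true v i m) (+-comm m _))
... | true , i , refl = not (v i) , trans (cong ones (fac-block true false v i m)) (ones-block true false v i m)

balanced-cong : ∀ {v w} m → (∀ n → v n ≡ w n) → Balanced v m → Balanced w m
balanced-cong m e h q = proj₁ (h q) ,
  trans (cong ones (fac-cong q q (suc (m * 2)) (λ j _ → sym (e (j + q))))) (proj₂ (h q))

cube-free : ∀ y c q → Balanced y 1 → ¬ Cube c y q
cube-free y c q h p = clash c (proj₁ (h q)) (trans (sym (cong ones constant)) (proj₂ (h q)))
  where
  constant : fac y q 3 ≡ c ∷ c ∷ c ∷ []
  constant = cong₂ _∷_ (p 0 z<s) (cong₂ _∷_ (p 1 (s≤s z<s)) (cong (_∷ []) (p 2 (s≤s (s≤s z<s)))))
  clash : ∀ c g → ones (c ∷ c ∷ c ∷ []) ≡ bit g + 1 → ⊥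
  clash false false ()
  clash false true ()
  clash true false ()
  clash true true ()

-- The Thue–Morse word

φ^-φ : ∀ k w → φ^ k (φ w) ≡ φ (φ^ k w)
φ^-φ zero w = refl
φ^-φ (suc k) w = φ^-φ k (φ w)

at-φ-even : ∀ w n → at (φ w) (n * 2) ≡ at w n
at-φ-even [] n = refl
at-φ-even (a ∷ w) zero = refl
at-φ-even (a ∷ w) (suc n) = at-φ-even w n

at-φ-odd : ∀ w n → n < length w → at (φ w) (suc (n * 2)) ≡ not (at w n)
at-φ-odd (a ∷ w) zero _ = refl
at-φ-odd (a ∷ w) (suc n) (s≤s l) = at-φ-odd w n l

at-++ : ∀ u v n → n < length u → at (u ++ v) n ≡ at u n
at-++ (a ∷ u) v zero _ = refl
at-++ (a ∷ u) v (suc n) (s≤s l) = at-++ u v n l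

length-φ^ : ∀ k w → length (φ^ k w) ≡ length w * 2 ^ k
length-φ^ zero w = sym (*-identityʳ _)
length-φ^ (suc k) w = trans (length-φ^ k (φ w))
  (trans (cong (_* 2 ^ k) (length-φ w)) (*-assoc (length w) 2 (2 ^ k)))

τ : ℕ → Word
τ j = φ^ j (false ∷ [])

length-τ : ∀ j → length (τ j) ≡ 2 ^ j
length-τ j = trans (length-φ^ j _) (*-identityˡ _)

τ-stable : ∀ j d n → n < 2 ^ j → at (τ (d + j)) n ≡ at (τ j) n
τ-stable j zero n _ = refl
τ-stable j (suc d) n l = trans (cong (λ w → at w n) (φ^-++ (d + j) (false ∷ []) (true ∷ [])))
  (trans (at-++ (τ (d + j)) _ n (<-≤-trans l (≤-trans (^-monoʳ-≤ 2 (m≤n+m j d)) (≤-reflexive (sym (length-τ (d + j)))))))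
         (τ-stable j d n l))

-- Needed because `𝐭` reads each letter from a different iterate of φ.
τ-agree : ∀ j j′ n → n < 2 ^ j → n < 2 ^ j′ → at (τ j) n ≡ at (τ j′) n
τ-agree j j′ n l l′ = trans (sym (τ-stable j j′ n l))
  (trans (cong (λ i → at (τ i) n) (+-comm j′ j)) (τ-stable j′ j n l′))

n<2^n : ∀ n → n < 2 ^ n
n<2^n zero = z<s
n<2^n (suc n) = ≤-trans (≤-reflexive (cong suc (+-comm 1 n))) (≤-trans (+-mono-≤ (n<2^n n) (m^n>0 2 n))
  (≤-reflexive (cong (2 ^ n +_) (sym (+-identityʳ (2 ^ n))))))

𝐭-even : ∀ n → 𝐭 (n * 2) ≡ 𝐭 n
𝐭-even n = trans (cong (λ w → at w (n * 2)) (φ^-φ (n * 2) (false ∷ [])))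
  (trans (at-φ-even (τ (n * 2)) n) (τ-agree (n * 2) (suc n) n
    (<-≤-trans (n<2^n n) (^-monoʳ-≤ 2 (m≤m*n n 2))) (<-trans (n<2^n n) (^-monoʳ-< 2 (s≤s z<s) (n<1+n n)))))

𝐭-odd : ∀ n → 𝐭 (suc (n * 2)) ≡ not (𝐭 n)
𝐭-odd n = trans (cong (λ w → at w (suc (n * 2))) (φ^-φ (suc (n * 2)) (false ∷ [])))
  (trans (at-φ-odd (τ (suc (n * 2))) n (subst (n <_) (sym (length-τ (suc (n * 2)))) l))
    (cong not (τ-agree (suc (n * 2)) (suc n) n l (<-trans (n<2^n n) (^-monoʳ-< 2 (s≤s z<s) (n<1+n n))))))
  where
  l : n < 2 ^ suc (n * 2)
  l = <-≤-trans (n<2^n n) (^-monoʳ-≤ 2 (≤-trans (m≤m*n n 2) (n≤1+n _)))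

𝐭-fixed : ∀ n → 𝐭 n ≡ φ∞ 𝐭 n
𝐭-fixed n with halve n
... | false , m , refl = trans (𝐭-even m) (sym (φ∞-even 𝐭 m))
... | true , m , refl = trans (𝐭-odd m) (sym (φ∞-odd 𝐭 m))

𝐭-fixed^ : ∀ k n → 𝐭 n ≡ φ∞^ k 𝐭 n
𝐭-fixed^ zero n = refl
𝐭-fixed^ (suc k) n = trans (𝐭-fixed^ k n) (φ∞^-cong k 𝐭-fixed n)

𝐭-balanced : ∀ m → Balanced 𝐭 m
𝐭-balanced m = balanced-cong m (λ n → sym (𝐭-fixed n)) (balanced-φ∞ 𝐭 m)

𝐭-cube-free : ∀ c q → ¬ Cube c 𝐭 q
𝐭-cube-free c q = cube-free 𝐭 c q (𝐭-balanced 1)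

-- An occurrence at distance d is carried by φ to distances 2d and 2d + 1, the latter with the
-- second letter complemented; this reduces every distance to 1.
𝐭-pairs : ∀ d a b → 1 ≤ d → ∃ λ q → 𝐭 q ≡ a × 𝐭 (d + q) ≡ b
𝐭-pairs d = go d d ≤-refl
  where
  go : ∀ N d → d ≤ N → ∀ a b → 1 ≤ d → ∃ λ q → 𝐭 q ≡ a × 𝐭 (d + q) ≡ b
  go zero zero z≤n a b ()
  go (suc N) d l a b pos with halve d
  ... | false , zero , refl = ⊥-elim (n≮0 pos)
  go (suc N) _ l a b pos | false , suc e , refl
    with go N (suc e) (≤-trans (s≤s (m≤m*n e 2)) (≤-pred l)) a b (s≤s z≤n)
  ... | q , p , p′ = q * 2 , trans (𝐭-even q) p
    , trans (cong 𝐭 (sym (*-distribʳ-+ 2 (suc e) q))) (trans (𝐭-even (suc e + q)) p′)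
  go (suc N) _ l a b pos | true , suc e , refl
    with go N (suc e) (≤-trans (s≤s (≤-trans (m≤m*n e 2) (n≤1+n _))) (≤-pred l)) a (not b) (s≤s z≤n)
  ... | q , p , p′ = q * 2 , trans (𝐭-even q) p
    , trans (cong (𝐭 ∘ suc) (sym (*-distribʳ-+ 2 (suc e) q)))
        (trans (𝐭-odd (suc e + q)) (trans (cong not p′) (not-involutive b)))
  -- Occurrences of the four words of length 2 in the prefix 0110100.
  go (suc N) _ l false false pos | true , zero , refl = 5 , refl , refl
  go (suc N) _ l false true pos | true , zero , refl = 0 , refl , refl
  go (suc N) _ l true false pos | true , zero , refl = 2 , refl , refl
  go (suc N) _ l true true pos | true , zero , refl = 1 , refl , refl

bit-+-injective : ∀ {a b} m → bit a + m ≡ bit b + m → a ≡ b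
bit-+-injective m e = bit-injective (+-cancelʳ-≡ m _ _ e)

ones-𝐭 : ∀ ρ σ i m → ones (fac 𝐭 (bit ρ + i * 2) (bit ρ + bit σ + m * 2)) ≡ block-ones ρ σ 𝐭 i m
ones-𝐭 ρ σ i m = trans (cong ones (trans (fac-cong (bit ρ + i * 2) _ (bit ρ + bit σ + m * 2) (λ j _ → 𝐭-fixed (j + (bit ρ + i * 2))))
  (fac-block ρ σ 𝐭 i m))) (ones-block ρ σ 𝐭 i m)

-- An occurrence of (a, g, b) starts at an even position if g ≠ a, and at an odd one if g ≠ b.
𝐭-types : ∀ m τ → NotAllEqual τ → ∃ λ q → type 𝐭 m (𝐭-balanced m) q ≡ τ
𝐭-types m (a , g , b) ne with g ≟ᵇ a
... | no g≢a with 𝐭-pairs (suc m) a b (s≤s z≤n)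
...   | q , p , p′ = q * 2 , cong₂ _,_ (trans (𝐭-even q) p) (cong₂ _,_
    (bit-+-injective m (trans (sym (proj₂ (𝐭-balanced m (suc (q * 2)))))
      (trans (ones-𝐭 true false q m) (cong (λ c → bit c + m) (trans (cong not p) (sym (¬-not g≢a)))))))
    (trans (cong (𝐭 ∘ suc ∘ suc) (sym (*-distribʳ-+ 2 m q))) (trans (𝐭-even (suc m + q)) p′)))
𝐭-types m (a , g , b) ne | yes refl with 𝐭-pairs (suc m) (not g) (not b) (s≤s z≤n)
...   | q , p , p′ = suc (q * 2) , cong₂ _,_ (trans (𝐭-odd q) (trans (cong not p) (not-involutive g))) (cong₂ _,_
    (bit-+-injective m (trans (sym (proj₂ (𝐭-balanced m (suc q * 2))))
      (trans (ones-𝐭 false true (suc q) m) (trans (+-comm m _) (cong (λ c → bit c + m)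
        (trans (cong 𝐭 (+-suc m q)) (trans p′ (sym (¬-not (λ e → ne (refl , e)))))))))))
    (trans (cong 𝐭 (trans (cong (suc ∘ suc) (+-suc (m * 2) (q * 2))) (cong (suc ∘ suc ∘ suc) (sym (*-distribʳ-+ 2 m q)))))
      (trans (𝐭-odd (suc m + q)) (trans (cong not p′) (not-involutive b)))))

-- Windows of length (2m + 2)·2ᵏ

-- Windows of length l·2ᵏ: one starting at offset r of a block covers l or l + 1 blocks.
endOf : ℕ → ℕ → ℕ
endOf P zero = 0
endOf P (suc r) = P ∸ suc r

lenOf : ℕ → ℕ → ℕ
lenOf l zero = l
lenOf l (suc r) = suc l

endOf< : ∀ k r → r < 2 ^ k → endOf (2 ^ k) r < 2 ^ k
endOf< k zero l = l
endOf< k (suc r) l = ∸suc< k r (<-trans (n<1+n r) l)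

endOf-cover : ∀ P l r → r < P → r + (l * P + endOf P r) ≡ lenOf l r * P
endOf-cover P l zero _ = +-identityʳ _
endOf-cover P l (suc r) r< = trans (lemma (suc r) (l * P) (P ∸ suc r)) (cong (_+ l * P) (m∸n+n≡m (<⇒≤ r<)))
  where
  lemma : ∀ r x e → r + (x + e) ≡ e + r + x
  lemma = solve-∀

-- At offset 0 the window consists of 2m + 2 complete blocks and only the ones count. At any other
-- offset it meets 2m + 3 blocks, both outer ones partially, and the whole triple counts.
SameEven : ∀ y y′ m → Balanced y m → Balanced y′ m → (q q′ r : ℕ) → Set
SameEven y y′ m h h′ q q′ r =
  (r ≡ 0 → ones (fac y q (2 + m * 2)) ≡ ones (fac y′ q′ (2 + m * 2)))
  × (r ≢ 0 → type y m h q ≡ type y′ m h′ q′)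

2^suc≤even : ∀ k m → 2 ^ suc k ≤ (2 + m * 2) * 2 ^ k
2^suc≤even k m = *-monoˡ-≤ (2 ^ k) (s≤s (s≤s (z≤n {m * 2})))

∼⇒even : ∀ k y y′ m h h′ q q′ r r′ → r < 2 ^ k → r′ < 2 ^ k →
  fac (φ∞^ k y) (r + q * 2 ^ k) ((2 + m * 2) * 2 ^ k)
    ∼[ suc k ] fac (φ∞^ k y′) (r′ + q′ * 2 ^ k) ((2 + m * 2) * 2 ^ k) →
  (r ≡ r′ × SameEven y y′ m h h′ q q′ r) ⊎ LevelExceptional k ((2 + m * 2) * 2 ^ k) y q y′ q′
∼⇒even k y y′ m h h′ q q′ r r′ r< r′< p
  with ≈⇒type k y y′ q q′ r r′ (endOf (2 ^ k) r) (endOf (2 ^ k) r′) ((2 + m * 2) * 2 ^ k)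
    (lenOf (2 + m * 2) r) (lenOf (2 + m * 2) r′) r< r′< (endOf< k r r<) (endOf< k r′ r′<)
    (2^suc≤even k m) (endOf-cover (2 ^ k) (2 + m * 2) r r<) (endOf-cover (2 ^ k) (2 + m * 2) r′ r′<) (∼⇒≈ p)
... | inj₂ ex = inj₂ ex
∼⇒even k y y′ m h h′ q q′ zero _ r< r′< p | inj₁ (refl , _ , _ , _ , _ , o) =
  inj₁ (refl , (λ _ → o) , contradiction refl)
∼⇒even k y y′ m h h′ q q′ (suc r) _ r< r′< p | inj₁ (refl , _ , _ , first , last , o) =
  inj₁ (refl , (λ ()) , λ _ → type-≡ y y′ m h h′ q q′ (first 1+n≢0)
    (last (m<n⇒n∸m≢0 r<) (2 + m * 2) refl) o)
  where
  m<n⇒n∸m≢0 : suc r < 2 ^ k → 2 ^ k ∸ suc r ≢ 0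
  m<n⇒n∸m≢0 l e = <-irrefl (sym e) (m<n⇒0<n∸m l)

even⇒∼ : ∀ k y y′ m h h′ q q′ r → r < 2 ^ k → SameEven y y′ m h h′ q q′ r →
  fac (φ∞^ k y) (r + q * 2 ^ k) ((2 + m * 2) * 2 ^ k)
    ∼[ suc k ] fac (φ∞^ k y′) (r + q′ * 2 ^ k) ((2 + m * 2) * 2 ^ k)
even⇒∼ k y y′ m h h′ q q′ r r< same =
  type⇒∼ k y y′ q q′ r (endOf (2 ^ k) r) ((2 + m * 2) * 2 ^ k) (lenOf (2 + m * 2) r) r< (endOf< k r r<)
    (endOf-cover (2 ^ k) (2 + m * 2) r r<) (sameType r same)
  where
  sameType : ∀ r → SameEven y y′ m h h′ q q′ r →
    SameType y y′ q q′ r r (endOf (2 ^ k) r) (endOf (2 ^ k) r) (lenOf (2 + m * 2) r) (lenOf (2 + m * 2) r)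
  sameType zero (same , _) = refl , refl , refl , contradiction refl , contradiction refl , same refl
  sameType (suc r) (_ , same) = refl , refl , refl , (λ _ → cong proj₁ τ≡) ,
    (λ { _ _ refl → cong (proj₂ ∘ proj₂) τ≡ }) , type-ones y y′ m h h′ q q′ τ≡
    where τ≡ = same 1+n≢0

-- Chosen so that the first two entries have sum 0, 1 and 2: in `𝐭`, windows of length 2m + 2 reach
-- m, m + 1 and m + 2 ones.
triple₃ : Fin 3 → Triple
triple₃ 0F = false , false , true
triple₃ 1F = false , true , true
triple₃ 2F = true , true , false

triple₃-notAllEqual : ∀ e → NotAllEqual (triple₃ e)
triple₃-notAllEqual 0F (_ , ())
triple₃-notAllEqual 1F (() , _)
triple₃-notAllEqual 2F (_ , ())

triple₃-ones : ∀ m e → ones (fac 𝐭 (proj₁ (𝐭-types m (triple₃ e) (triple₃-notAllEqual e))) (2 + m * 2)) ≡ toℕ e + m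
triple₃-ones m e with 𝐭-types m (triple₃ e) (triple₃-notAllEqual e)
... | q , p = trans (ones-even 𝐭 m (𝐭-balanced m) q)
  (trans (cong (λ τ → bit (proj₁ τ) + bit (proj₁ (proj₂ τ)) + m) p) (cong (_+ m) (sum e)))
  where
  sum : ∀ e → bit (proj₁ (triple₃ e)) + bit (proj₁ (proj₂ (triple₃ e))) ≡ toℕ e
  sum 0F = refl
  sum 1F = refl
  sum 2F = refl

-- Three numbers of ones at offset 0, and all six nonconstant triples at each of the other R = 2ᵏ -
-- 1 offsets.
classes-even-𝐭 : ∀ k R m M → suc R ≡ 2 ^ k →
  Classes (φ∞^ k 𝐭) (suc k) ((2 + m * 2) * 2 ^ k) M → 3 + R * 6 ≤ M
classes-even-𝐭 k R m M P≡ C =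
  classes-≥ C (⊎↔ (↔-id (Fin 3)) ×↔) (λ i → off i + blk i * 2 ^ k) separated
  where
  h = 𝐭-balanced m
  Index = Fin 3 ⊎ (Fin R × Fin 6)
  off blk : Index → ℕ
  off (inj₁ _) = 0
  off (inj₂ (ρ , _)) = suc (toℕ ρ)
  blk (inj₁ e) = proj₁ (𝐭-types m (triple₃ e) (triple₃-notAllEqual e))
  blk (inj₂ (_ , j)) = proj₁ (𝐭-types m (decode₆ j) (decode₆-notAllEqual j))
  off< : ∀ i → off i < 2 ^ k
  off< (inj₁ _) = m^n>0 2 k
  off< (inj₂ (ρ , _)) = <-≤-trans (s<s (toℕ<n ρ)) (≤-reflexive P≡)
  same : ∀ i i′ → off i ≡ off i′ → SameEven 𝐭 𝐭 m h h (blk i) (blk i′) (off i) → i ≡ i′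
  same (inj₁ e) (inj₁ e′) _ (p , _) = cong inj₁ (toℕ-injective (+-cancelʳ-≡ m _ _
    (trans (sym (triple₃-ones m e)) (trans (p refl) (triple₃-ones m e′)))))
  same (inj₂ (ρ , j)) (inj₂ (ρ′ , j′)) o (_ , p) = cong inj₂ (cong₂ _,_ (toℕ-injective (suc-injective o))
    (decode₆-injective j j′ (trans (sym (proj₂ (𝐭-types m (decode₆ j) (decode₆-notAllEqual j))))
      (trans (p 1+n≢0) (proj₂ (𝐭-types m (decode₆ j′) (decode₆-notAllEqual j′)))))))
  same (inj₁ _) (inj₂ _) () _
  same (inj₂ _) (inj₁ _) () _
  separated : ∀ i i′ →
    fac (φ∞^ k 𝐭) (off i + blk i * 2 ^ k) ((2 + m * 2) * 2 ^ k)
      ∼[ suc k ] fac (φ∞^ k 𝐭) (off i′ + blk i′ * 2 ^ k) ((2 + m * 2) * 2 ^ k) → i ≡ i′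
  separated i i′ p with ∼⇒even k 𝐭 𝐭 m h h (blk i) (blk i′) (off i) (off i′) (off< i) (off< i′) p
  ... | inj₁ (o , s) = same i i′ o s
  ... | inj₂ (c , inj₁ cube , _) = ⊥-elim (𝐭-cube-free c (blk i) cube)
  ... | inj₂ (c , inj₂ cube , _) = ⊥-elim (𝐭-cube-free (not c) (blk i′) cube)

sum₃ : Bool → Bool → Fin 3
sum₃ false false = 0F
sum₃ false true = 1F
sum₃ true false = 1F
sum₃ true true = 2F

sum₃-bits : ∀ a g → toℕ (sum₃ a g) ≡ bit a + bit g
sum₃-bits false false = refl
sum₃-bits false true = refl
sum₃-bits true false = refl
sum₃-bits true true = refl

-- Positions are first brought to a normal form because, for m = 0, windows over 000 and over
-- 111 may be the same word, so that only one of these two types should be counted.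
six-types : ∀ k R m M y (h : Balanced y m) → suc R ≡ 2 ^ k → 1 ≤ R →
  Classes (φ∞^ k y) (suc k) ((2 + m * 2) * 2 ^ k) M → 3 + R * 6 ≤ M →
  (Good : ℕ → Set) →
  (∀ i → ∃ λ q → ∃ λ r → r < 2 ^ k ×
    fac (φ∞^ k y) i ((2 + m * 2) * 2 ^ k) ≡ fac (φ∞^ k y) (r + q * 2 ^ k) ((2 + m * 2) * 2 ^ k)
    × (r ≢ 0 → Good q)) →
  ∃ λ (qs : Fin 6 → ℕ) →
    (∀ i j → type y m h (qs i) ≡ type y m h (qs j) → i ≡ j) × (∀ i → Good (qs i))
six-types k R m M y h P≡ 1≤R C M≥ Good normal = result (enumerate 8 Occurs occurs?)
  where
  X = φ∞^ k y
  n = (2 + m * 2) * 2 ^ k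
  pos = proj₁ C
  blk off : Fin M → ℕ
  blk a = proj₁ (normal (pos a))
  off a = proj₁ (proj₂ (normal (pos a)))
  off< : ∀ a → off a < 2 ^ k
  off< a = proj₁ (proj₂ (proj₂ (normal (pos a))))
  fac≡ : ∀ a → fac X (pos a) n ≡ fac X (off a + blk a * 2 ^ k) n
  fac≡ a = proj₁ (proj₂ (proj₂ (proj₂ (normal (pos a)))))
  good : ∀ a → off a ≢ 0 → Good (blk a)
  good a = proj₂ (proj₂ (proj₂ (proj₂ (normal (pos a)))))
  code : Fin M → Fin 8
  code a = Inverse.to Triple↔ (type y m h (blk a))
  Occurs : Fin 8 → Set
  Occurs i = ∃ λ a → off a ≢ 0 × code a ≡ i
  occurs? : ∀ i → Dec (Occurs i)
  occurs? i = any? (λ a → ¬? (off a ≟ 0) ×-dec (code a Fin.≟ i))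
  result : ∃ (Enumeration Occurs) → ∃ λ (qs : Fin 6 → ℕ) →
    (∀ i j → type y m h (qs i) ≡ type y m h (qs j) → i ≡ j) × (∀ i → Good (qs i))
  result (p , to , from , to-inj , from-occurs , from-inj) with 6 ≤? p
  ... | yes 6≤p = (λ i → blk (witness i)) , injective
      , λ i → good (witness i) (proj₁ (proj₂ (from-occurs (inject≤ i 6≤p))))
    where
    witness : Fin 6 → Fin M
    witness i = proj₁ (from-occurs (inject≤ i 6≤p))
    injective : ∀ i j → type y m h (blk (witness i)) ≡ type y m h (blk (witness j)) → i ≡ j
    injective i j e = inject≤-injective 6≤p 6≤p i j (from-inj _ _
      (trans (sym (proj₂ (proj₂ (from-occurs (inject≤ i 6≤p)))))
        (trans (cong (Inverse.to Triple↔) e) (proj₂ (proj₂ (from-occurs (inject≤ j 6≤p)))))))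
  -- With at most five types at nonzero offsets there would be at most 3 + 5R classes.
  ... | no 6≰p = ⊥-elim (<-irrefl refl (*-cancelˡ-≤ R {{>-nonZero 1≤R}} (+-cancelˡ-≤ 3 _ _
      (≤-trans M≥ (≤-trans (classes-≤ C (⊎↔ (↔-id (Fin 3)) ×↔) (λ a → key a (off a) refl) same)
        (+-monoʳ-≤ 3 (*-monoʳ-≤ R (≤-pred (≰⇒> 6≰p)))))))))
    where
    key : ∀ a r → off a ≡ r → Fin 3 ⊎ (Fin R × Fin p)
    key a zero _ = inj₁ (sum₃ (y (blk a)) (proj₁ (h (suc (blk a)))))
    key a (suc r) e = inj₂ (fromℕ< (≤-pred (subst₂ _<_ e (sym P≡) (off< a)))
      , to (code a) (a , (λ z → 1+n≢0 (trans (sym e) z)) , refl))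
    separate : ∀ a b r r′ (e : off a ≡ r) (e′ : off b ≡ r′) → key a r e ≡ key b r′ e′ →
      r ≡ r′ × SameEven y y m h h (blk a) (blk b) r
    separate a b zero zero e e′ p = refl , (λ _ → trans (ones-even y m h (blk a))
      (trans (cong (_+ m) (trans (sym (sum₃-bits _ _)) (trans (cong toℕ (inj₁-injective p)) (sum₃-bits _ _))))
        (sym (ones-even y m h (blk b))))) , contradiction refl
    separate a b (suc r) (suc r′) e e′ p =
      cong suc (fromℕ<-injective _ _ _ _ (cong proj₁ (inj₂-injective p))) ,
      (λ ()) , λ _ → ↔-injective Triple↔ (to-inj _ _ _ _ (cong proj₂ (inj₂-injective p)))
    separate a b zero (suc r′) e e′ ()
    separate a b (suc r) zero e e′ ()
    same : ∀ a b → key a (off a) refl ≡ key b (off b) refl → fac X (pos a) n ∼[ suc k ] fac X (pos b) n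
    same a b p with separate a b (off a) (off b) refl refl p
    ... | o , s = subst₂ (_∼[ suc k ]_) (sym (fac≡ a))
      (trans (cong (λ r → fac X (r + blk b * 2 ^ k) n) o) (sym (fac≡ b)))
      (even⇒∼ k y y m h h (blk a) (blk b) (off a) (off< a) s)

-- Windows of length (2m + 2)·2ᵏ + 1

-- Recurrence in the letterwise form that can be pulled back from `x` to the preimage.
PrefixRecurrent : InfWord → Set
PrefixRecurrent y = ∀ N B → ∃ λ i → B ≤ i × (∀ j → j < N → y (j + i) ≡ y j)

-- The window y[q, q + 2m + 2) has as many letters g as balance allows.
Extreme : Bool → ∀ y m → Balanced y m → ℕ → Set
Extreme g y m h q = y q ≡ g × proj₁ (h (suc q)) ≡ g

extreme? : ∀ g y m h q → Dec (Extreme g y m h q)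
extreme? g y m h q = (y q ≟ᵇ g) ×-dec (proj₁ (h (suc q)) ≟ᵇ g)

extreme-exclusive : ∀ {g y m h q} → Extreme g y m h q → ¬ Extreme (not g) y m h q
extreme-exclusive (refl , _) (e , _) = not-¬ refl e

extreme-later : ∀ {g y m h q} → PrefixRecurrent y → Extreme g y m h q →
  ∀ B → ∃ λ q′ → B ≤ q′ × Extreme g y m h q′
extreme-later {g} {y} {m} {h} {q} rec (e , f) B with rec (q + (2 + m * 2)) B
... | i , B≤i , agree = q + i , ≤-trans B≤i (m≤n+m i q)
  , trans (agree q (m<m+n q z<s)) e
  , trans (bit-+-injective m (trans (sym (proj₂ (h (suc (q + i)))))
      (trans (cong ones (fac-cong (suc (q + i)) (suc q) (suc (m * 2)) shifted)) (proj₂ (h (suc q)))))) f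
  where
  lemma : ∀ j q i → j + suc (q + i) ≡ (j + suc q) + i
  lemma = solve-∀
  lemma′ : ∀ q j → suc q + suc j ≡ suc (suc (j + q))
  lemma′ = solve-∀
  shifted : ∀ j → j < suc (m * 2) → y (j + suc (q + i)) ≡ y (j + suc q)
  shifted j l = trans (cong y (lemma j q i)) (agree (j + suc q)
    (≤-trans (≤-reflexive (cong suc (+-comm j (suc q)))) (≤-trans (≤-reflexive (sym (+-suc (suc q) j)))
      (≤-trans (+-monoʳ-≤ (suc q) l) (≤-reflexive (sym (+-suc q (suc (m * 2)))))))))

last-before : ∀ {P : ℕ → Set} → (∀ q → Dec (P q)) → ∀ q d → P q → ¬ P (d + q) → ∃ λ p → P p × ¬ P (suc p)
last-before P? q zero p np = ⊥-elim (np p)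
last-before P? q (suc d) p np with P? (d + q)
... | yes p′ = d + q , p′ , np
... | no np′ = last-before P? q d p np′

bits-extreme : ∀ a c g → bit a + bit c ≡ bit g + bit g → a ≡ g × c ≡ g
bits-extreme false false false _ = refl , refl
bits-extreme true true true _ = refl , refl
bits-extreme false false true ()
bits-extreme false true false ()
bits-extreme true false false ()
bits-extreme false true true ()
bits-extreme true false true ()
bits-extreme true true false ()

-- Both sides plus m count the ones of y[q + 1, q + 2m + 3), split at its last or at its first
-- letter.
even-shift : ∀ y m (h : Balanced y m) q →
  bit (proj₁ (h (suc q))) + bit (y (2 + m * 2 + q)) ≡ bit (y (suc q)) + bit (proj₁ (h (suc (suc q))))
even-shift y m h q = +-cancelʳ-≡ m _ _ (trans (sym (ones-even-suc y m h q)) (ones-even y m h (suc q)))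

extreme-suc : ∀ {g} y m (h : Balanced y m) q →
  proj₁ (h (suc q)) ≡ g → y (2 + m * 2 + q) ≡ g → Extreme g y m h (suc q)
extreme-suc {g} y m h q e f = bits-extreme (y (suc q)) (proj₁ (h (suc (suc q)))) g
  (trans (sym (even-shift y m h q)) (cong₂ (λ a b → bit a + bit b) e f))

extreme-suc⁻ : ∀ {g} y m (h : Balanced y m) q → Extreme g y m h (suc q) →
  proj₁ (h (suc q)) ≡ g × y (2 + m * 2 + q) ≡ g
extreme-suc⁻ {g} y m h q (e , f) = bits-extreme (proj₁ (h (suc q))) (y (2 + m * 2 + q)) g
  (trans (even-shift y m h q) (cong₂ (λ a b → bit a + bit b) e f))

-- The sliding count of ones goes infinitely often from one extreme to the other; look at the
-- moments where it leaves the first extreme and where it reaches the second one.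
transitions : ∀ y m (h : Balanced y m) → PrefixRecurrent y → (∀ g → ∃ (Extreme g y m h)) →
  ∀ z b → ∃ λ q → type y m h q ≡ (not b , z , b)
transitions y m h rec extremes z b with z ≟ᵇ b
... | no z≢b = leaving
  where
  g = not b
  leaving : ∃ λ q → type y m h q ≡ (g , z , b)
  leaving with extremes g
  ... | q₁ , ex₁ with extreme-later {h = h} rec (proj₂ (extremes (not g))) q₁
  ... | q₂ , q₁≤q₂ , ex₂ with last-before (extreme? g y m h) q₁ (q₂ ∸ q₁) ex₁
        (λ ex → extreme-exclusive {h = h} (subst (Extreme g y m h) (m∸n+n≡m q₁≤q₂) ex) ex₂)
  ... | p , (e , f) , ¬ex = p , cong₂ _,_ e (cong₂ _,_ (trans f (sym (¬-not z≢b)))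
          (trans (¬-not (λ e′ → ¬ex (extreme-suc y m h p f e′))) (not-involutive b)))
... | yes refl = arriving
  where
  g = not z
  arriving : ∃ λ q → type y m h q ≡ (g , z , z)
  arriving with extremes g
  ... | q₁ , ex₁ with extreme-later {h = h} rec (proj₂ (extremes z)) q₁
  ... | q₂ , q₁≤q₂ , ex₂ with last-before (λ q → ¬? (extreme? z y m h q)) q₁ (q₂ ∸ q₁)
        (λ ex → extreme-exclusive {h = h} ex ex₁)
        (λ n → n (subst (Extreme z y m h) (sym (m∸n+n≡m q₁≤q₂)) ex₂))
  ... | p , ¬ex , ¬¬ex with extreme? z y m h (suc p)
  ... | no ¬ex′ = ⊥-elim (¬¬ex ¬ex′)
  ... | yes ex with extreme-suc⁻ y m h p ex
  ... | e , f = p , cong₂ _,_ (¬-not (λ a → ¬ex (a , e))) (cong₂ _,_ e f)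

-- Without an extreme window for g, no triple has g in the middle and at one end, because (·, g, g)
-- makes the window one step later extreme. This leaves one triple with middle g and four with the
-- other middle, only five in all.
six-types⇒extremes : ∀ y m (h : Balanced y m) (qs : Fin 6 → ℕ) →
  (∀ i j → type y m h (qs i) ≡ type y m h (qs j) → i ≡ j) → ∀ g → ∃ (Extreme g y m h)
six-types⇒extremes y m h qs inj g
  with any? (λ i → extreme? g y m h (qs i))
     | any? (λ i → (proj₁ (h (suc (qs i))) ≟ᵇ g) ×-dec (y (2 + m * 2 + qs i) ≟ᵇ g))
... | yes (i , ex) | _ = qs i , ex
... | no _ | yes (i , e , f) = suc (qs i) , extreme-suc y m h (qs i) e f
... | no none | no none′ = ⊥-elim (<-irrefl refl
    (card-≤ (↔-id (Fin 6)) (⊎↔ (↔-sym 1↔⊤) Pair↔) (λ i → key (type y m h (qs i))) separated))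
  where
  key : Triple → ⊤ ⊎ (Bool × Bool)
  key (a , z , b) with z ≟ᵇ g
  ... | yes _ = inj₁ tt
  ... | no _ = inj₂ (a , b)
  key-injective : ∀ a z b a′ z′ b′ → key (a , z , b) ≡ key (a′ , z′ , b′) →
    ¬ (a ≡ g × z ≡ g) → ¬ (z ≡ g × b ≡ g) → ¬ (a′ ≡ g × z′ ≡ g) → ¬ (z′ ≡ g × b′ ≡ g) →
    (a , z , b) ≡ (a′ , z′ , b′)
  key-injective a z b a′ z′ b′ e n₁ n₂ n₃ n₄ with z ≟ᵇ g | z′ ≟ᵇ g
  key-injective a z b a′ z′ b′ e n₁ n₂ n₃ n₄ | yes p | yes p′ =
    cong₂ _,_ (trans (¬-not (λ a≡ → n₁ (a≡ , p))) (sym (¬-not (λ a≡ → n₃ (a≡ , p′)))))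
      (cong₂ _,_ (trans p (sym p′)) (trans (¬-not (λ b≡ → n₂ (p , b≡))) (sym (¬-not (λ b≡ → n₄ (p′ , b≡))))))
  key-injective a z b a′ z′ b′ refl n₁ n₂ n₃ n₄ | no p | no p′ =
    cong (λ c → a , c , b) (trans (¬-not p) (sym (¬-not p′)))
  key-injective a z b a′ z′ b′ () n₁ n₂ n₃ n₄ | yes p | no p′
  key-injective a z b a′ z′ b′ () n₁ n₂ n₃ n₄ | no p | yes p′
  separated : ∀ i j → key (type y m h (qs i)) ≡ key (type y m h (qs j)) → i ≡ j
  separated i j e = inj i j (key-injective _ _ _ _ _ _ e (λ p → none (i , p)) (λ p → none′ (i , p))
    (λ p → none (j , p)) (λ p → none′ (j , p)))

odd-cover : ∀ P A l r → suc A ≡ P → r < P → r + ((l * P + 1) + (A ∸ r)) ≡ suc l * P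
odd-cover P A l r refl (s≤s r≤) = trans (lemma r (l * suc A) (A ∸ r)) (cong (λ z → suc z + l * suc A) (m∸n+n≡m r≤))
  where
  lemma : ∀ r x e → r + ((x + 1) + e) ≡ suc (e + r) + x
  lemma = solve-∀

-- A window of this length meets 2m + 3 blocks at every offset. Its first block is complete at
-- offset 0 and its last block at offset A = 2ᵏ - 1, so the corresponding letter is not visible
-- there.
SameOdd : ∀ (y y′ : InfWord) (m A q q′ r : ℕ) → Set
SameOdd y y′ m A q q′ r =
  (r ≢ 0 → y q ≡ y′ q′) × (r ≢ A → y (2 + m * 2 + q) ≡ y′ (2 + m * 2 + q′))
  × ones (fac y q (3 + m * 2)) ≡ ones (fac y′ q′ (3 + m * 2))

∸<P : ∀ A P r → suc A ≡ P → A ∸ r < P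
∸<P A P r refl = s≤s (m∸n≤m A r)

∼⇒odd : ∀ k A y y′ m q q′ r r′ → suc A ≡ 2 ^ k → r < 2 ^ k → r′ < 2 ^ k →
  fac (φ∞^ k y) (r + q * 2 ^ k) ((2 + m * 2) * 2 ^ k + 1)
    ∼[ suc k ] fac (φ∞^ k y′) (r′ + q′ * 2 ^ k) ((2 + m * 2) * 2 ^ k + 1) →
  (r ≡ r′ × SameOdd y y′ m A q q′ r) ⊎ (∃ λ c → Cube c y q × Cube (not c) y′ q′)
∼⇒odd k A y y′ m q q′ r r′ P≡ r< r′< p
  with ≈⇒type k y y′ q q′ r r′ (A ∸ r) (A ∸ r′) ((2 + m * 2) * 2 ^ k + 1)
    (3 + m * 2) (3 + m * 2) r< r′< (∸<P A (2 ^ k) r P≡) (∸<P A (2 ^ k) r′ P≡)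
    (≤-trans (2^suc≤even k m) (m≤m+n _ 1))
    (odd-cover (2 ^ k) A (2 + m * 2) r P≡ r<) (odd-cover (2 ^ k) A (2 + m * 2) r′ P≡ r′<) (∼⇒≈ p)
... | inj₂ (c , _ , both) = inj₂ (c , both (≤-<-trans (2^suc≤even k m) (m<m+n _ z<s)))
... | inj₁ (refl , _ , _ , first , last , o) = inj₁ (refl , first ,
    (λ r≢A → last (λ z → r≢A (≤-antisym (≤-pred (≤-trans r< (≤-reflexive (sym P≡)))) (m∸n≡0⇒m≤n z)))
      (2 + m * 2) refl) , o)

odd⇒∼ : ∀ k A y y′ m q q′ r → suc A ≡ 2 ^ k → r < 2 ^ k → SameOdd y y′ m A q q′ r →
  fac (φ∞^ k y) (r + q * 2 ^ k) ((2 + m * 2) * 2 ^ k + 1)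
    ∼[ suc k ] fac (φ∞^ k y′) (r + q′ * 2 ^ k) ((2 + m * 2) * 2 ^ k + 1)
odd⇒∼ k A y y′ m q q′ r P≡ r< (first , last , o) =
  type⇒∼ k y y′ q q′ r (A ∸ r) ((2 + m * 2) * 2 ^ k + 1) (3 + m * 2) r< (∸<P A (2 ^ k) r P≡)
    (odd-cover (2 ^ k) A (2 + m * 2) r P≡ r<)
    (refl , refl , refl , first , (λ { nz _ refl → last (λ { refl → nz (n∸n≡0 A) }) }) , o)

decompose : ∀ k i → ∃ λ q → ∃ λ r → r < 2 ^ k × i ≡ r + q * 2 ^ k
decompose k i = i / 2 ^ k , i % 2 ^ k , m%n<n i (2 ^ k) , m≡m%n+[m/n]*n i (2 ^ k)
  where
  instance
    2^k≢0 : NonZero (2 ^ k)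
    2^k≢0 = m^n≢0 2 k

-- At each of the two extreme offsets a class is fixed by one visible end letter and the balanced
-- number of ones, four possibilities; at each of the A = 2ᵏ - 2 offsets between by one of six
-- triples.
classes-odd-𝐭 : ∀ k A m M → suc (suc A) ≡ 2 ^ k →
  Classes (φ∞^ k 𝐭) (suc k) ((2 + m * 2) * 2 ^ k + 1) M → M ≤ 4 + (4 + A * 6)
classes-odd-𝐭 k A m M P≡ C =
  classes-≤ C (⊎↔ Pair↔ (⊎↔ Pair↔ ×↔)) (λ a → key (blk a) (off a)) same
  where
  h = 𝐭-balanced m
  pos = proj₁ C
  n = (2 + m * 2) * 2 ^ k + 1
  blk off : Fin M → ℕ
  blk a = proj₁ (decompose k (pos a))
  off a = proj₁ (proj₂ (decompose k (pos a)))
  off< : ∀ a → off a < 2 ^ k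
  off< a = proj₁ (proj₂ (proj₂ (decompose k (pos a))))
  pos≡ : ∀ a → pos a ≡ off a + blk a * 2 ^ k
  pos≡ a = proj₂ (proj₂ (proj₂ (decompose k (pos a))))
  heavy : ℕ → Bool
  heavy q = proj₁ (𝐭-balanced (suc m) q)
  heavy-ones : ∀ q q′ → heavy q ≡ heavy q′ → ones (fac 𝐭 q (3 + m * 2)) ≡ ones (fac 𝐭 q′ (3 + m * 2))
  heavy-ones q q′ e = trans (proj₂ (𝐭-balanced (suc m) q))
    (trans (cong (λ g → bit g + suc m) e) (sym (proj₂ (𝐭-balanced (suc m) q′))))
  Key = (Bool × Bool) ⊎ ((Bool × Bool) ⊎ (Fin A × Fin 6))
  inner : ∀ q ρ → Dec (ρ < A) → Key
  inner q ρ (yes l) = inj₂ (inj₂ (fromℕ< l , code₆ (type 𝐭 m h q)))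
  inner q ρ (no _) = inj₂ (inj₁ (𝐭 q , heavy q))
  key : ℕ → ℕ → Key
  key q zero = inj₁ (𝐭 (2 + m * 2 + q) , heavy q)
  key q (suc ρ) = inner q ρ (ρ <? A)
  NAE : ∀ q → NotAllEqual (type 𝐭 m h q)
  NAE = balanced⇒notAllEqual 𝐭 m h (𝐭-balanced (suc m))
  separate-inner : ∀ q q′ ρ ρ′ (d : Dec (ρ < A)) (d′ : Dec (ρ′ < A)) → suc ρ < 2 ^ k → suc ρ′ < 2 ^ k →
    inner q ρ d ≡ inner q′ ρ′ d′ → suc ρ ≡ suc ρ′ × SameOdd 𝐭 𝐭 m (suc A) q q′ (suc ρ)
  separate-inner q q′ ρ ρ′ (yes l) (yes l′) _ _ e =
    cong suc (fromℕ<-injective _ _ _ _ (cong proj₁ (inj₂-injective (inj₂-injective e)))) ,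
    (λ _ → cong proj₁ types) , (λ _ → cong (proj₂ ∘ proj₂) types) , type-ones 𝐭 𝐭 m h h q q′ types
    where
    types : type 𝐭 m h q ≡ type 𝐭 m h q′
    types = trans (sym (decode₆-code₆ _ (NAE q)))
      (trans (cong decode₆ (cong proj₂ (inj₂-injective (inj₂-injective e)))) (decode₆-code₆ _ (NAE q′)))
  separate-inner q q′ ρ ρ′ (no ¬l) (no ¬l′) r< r′< e =
    cong suc (trans (at-end ¬l r<) (sym (at-end ¬l′ r′<))) ,
    (λ _ → cong proj₁ ends) , (λ ne → ⊥-elim (ne (cong suc (at-end ¬l r<)))) ,
    heavy-ones q q′ (cong proj₂ ends)
    where
    ends = inj₁-injective (inj₂-injective e)
    at-end : ∀ {ρ} → ¬ (ρ < A) → suc ρ < 2 ^ k → ρ ≡ A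
    at-end ¬l r< = ≤-antisym (≤-pred (≤-pred (≤-trans r< (≤-reflexive (sym P≡))))) (≮⇒≥ ¬l)
  separate-inner q q′ ρ ρ′ (yes _) (no _) _ _ ()
  separate-inner q q′ ρ ρ′ (no _) (yes _) _ _ ()
  key-inner : ∀ q ρ (d : Dec (ρ < A)) {c} → inner q ρ d ≡ inj₁ c → ⊥
  key-inner q ρ (yes _) ()
  key-inner q ρ (no _) ()
  separate : ∀ q q′ r r′ → r < 2 ^ k → r′ < 2 ^ k → key q r ≡ key q′ r′ →
    r ≡ r′ × SameOdd 𝐭 𝐭 m (suc A) q q′ r
  separate q q′ zero zero _ _ e = refl , contradiction refl , (λ _ → cong proj₁ (inj₁-injective e)) ,
    heavy-ones q q′ (cong proj₂ (inj₁-injective e))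
  separate q q′ (suc ρ) (suc ρ′) r< r′< e = separate-inner q q′ ρ ρ′ (ρ <? A) (ρ′ <? A) r< r′< e
  separate q q′ zero (suc ρ′) _ _ e = ⊥-elim (key-inner q′ ρ′ (ρ′ <? A) (sym e))
  separate q q′ (suc ρ) zero _ _ e = ⊥-elim (key-inner q ρ (ρ <? A) e)
  same : ∀ a b → key (blk a) (off a) ≡ key (blk b) (off b) →
    fac (φ∞^ k 𝐭) (pos a) n ∼[ suc k ] fac (φ∞^ k 𝐭) (pos b) n
  same a b e with separate (blk a) (blk b) (off a) (off b) (off< a) (off< b) e
  ... | o , s = subst₂ (λ i i′ → fac (φ∞^ k 𝐭) i n ∼[ suc k ] fac (φ∞^ k 𝐭) i′ n) (sym (pos≡ a))
    (trans (cong (_+ blk b * 2 ^ k) o) (sym (pos≡ b)))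
    (odd⇒∼ k (suc A) 𝐭 𝐭 m (blk a) (blk b) (off a) P≡ (off< a) s)

-- The types (not b, z, b) realize all four pairs of weight and visible end letter at both extreme
-- offsets, and the six types serve the offsets between. The constant triple has weight 0 or 3 and
-- gives a fifth class at offset 0.
classes-odd-unbalanced : ∀ k A m M y (h : Balanced y m) → suc (suc A) ≡ 2 ^ k →
  Classes (φ∞^ k y) (suc k) ((2 + m * 2) * 2 ^ k + 1) M →
  ∀ s q₀ → type y m h q₀ ≡ (s , s , s) →
  (qt : ∀ z b → ∃ λ q → type y m h q ≡ (not b , z , b)) →
  (∀ z b → ¬ Cube (not s) y (proj₁ (qt z b))) →
  (qs : Fin 6 → ℕ) → (∀ i j → type y m h (qs i) ≡ type y m h (qs j) → i ≡ j) →
  (∀ i → ¬ Cube (not s) y (qs i)) → 5 + (4 + A * 6) ≤ M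
classes-odd-unbalanced k A m M y h P≡ C s q₀ bad qt qt-free qs qs-inj qs-free =
  classes-≥ C (⊎↔ (⊎↔ (↔-sym 1↔⊤) Pair↔) (⊎↔ Pair↔ ×↔)) (λ i → off i + blk i * 2 ^ k) separated
  where
  Index = (⊤ ⊎ (Bool × Bool)) ⊎ ((Bool × Bool) ⊎ (Fin A × Fin 6))
  off blk : Index → ℕ
  off (inj₁ _) = 0
  off (inj₂ (inj₁ _)) = suc A
  off (inj₂ (inj₂ (ρ , _))) = suc (toℕ ρ)
  blk (inj₁ (inj₁ _)) = q₀
  blk (inj₁ (inj₂ (z , b))) = proj₁ (qt z b)
  blk (inj₂ (inj₁ (z , b))) = proj₁ (qt z b)
  blk (inj₂ (inj₂ (_ , j))) = qs j
  off< : ∀ i → off i < 2 ^ k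
  off< (inj₁ _) = m^n>0 2 k
  off< (inj₂ (inj₁ _)) = ≤-reflexive P≡
  off< (inj₂ (inj₂ (ρ , _))) = ≤-trans (s<s (m<n⇒m<1+n (toℕ<n ρ))) (≤-reflexive P≡)
  free : ∀ i → ¬ Cube (not s) y (blk i)
  free (inj₁ (inj₁ _)) cube = not-¬ (cong proj₁ bad) (cube 0 z<s)
  free (inj₁ (inj₂ (z , b))) = qt-free z b
  free (inj₂ (inj₁ (z , b))) = qt-free z b
  free (inj₂ (inj₂ (_ , j))) = qs-free j
  weight-qt : ∀ z b → ones (fac y (proj₁ (qt z b)) (3 + m * 2)) ≡ suc (bit z) + m
  weight-qt z b = trans (ones-cover y m h _) (cong (_+ m) (trans (cong weight (proj₂ (qt z b))) (sum z b)))
    where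
    sum : ∀ z b → weight (not b , z , b) ≡ suc (bit z)
    sum false false = refl
    sum false true = refl
    sum true false = refl
    sum true true = refl
  weight-bad : ones (fac y q₀ (3 + m * 2)) ≡ weight (s , s , s) + m
  weight-bad = trans (ones-cover y m h q₀) (cong (λ t → weight t + m) bad)
  bad≢ : ∀ s z → weight (s , s , s) ≢ suc (bit z)
  bad≢ false false ()
  bad≢ false true ()
  bad≢ true false ()
  bad≢ true true ()
  qt-weights : ∀ z b z′ b′ → ones (fac y (proj₁ (qt z b)) (3 + m * 2)) ≡ ones (fac y (proj₁ (qt z′ b′)) (3 + m * 2)) → z ≡ z′
  qt-weights z b z′ b′ o = bit-injective (suc-injective (+-cancelʳ-≡ m _ _
    (trans (sym (weight-qt z b)) (trans o (weight-qt z′ b′)))))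
  same : ∀ i i′ → off i ≡ off i′ → SameOdd y y m (suc A) (blk i) (blk i′) (off i) → i ≡ i′
  same (inj₁ (inj₁ _)) (inj₁ (inj₁ _)) _ _ = refl
  same (inj₁ (inj₁ _)) (inj₁ (inj₂ (z , b))) _ (_ , _ , o) = ⊥-elim (bad≢ s z (+-cancelʳ-≡ m _ _
    (trans (sym weight-bad) (trans o (weight-qt z b)))))
  same (inj₁ (inj₂ (z , b))) (inj₁ (inj₁ _)) _ (_ , _ , o) = ⊥-elim (bad≢ s z (+-cancelʳ-≡ m _ _
    (trans (sym weight-bad) (trans (sym o) (weight-qt z b)))))
  same (inj₁ (inj₂ (z , b))) (inj₁ (inj₂ (z′ , b′))) _ (_ , last , o) = cong (inj₁ ∘ inj₂)
    (cong₂ _,_ (qt-weights z b z′ b′ o)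
      (trans (sym (cong (proj₂ ∘ proj₂) (proj₂ (qt z b)))) (trans (last (λ ())) (cong (proj₂ ∘ proj₂) (proj₂ (qt z′ b′))))))
  same (inj₂ (inj₁ (z , b))) (inj₂ (inj₁ (z′ , b′))) _ (first , _ , o) = cong (inj₂ ∘ inj₁)
    (cong₂ _,_ (qt-weights z b z′ b′ o) (trans (sym (not-involutive b)) (trans (cong not
      (trans (sym (cong proj₁ (proj₂ (qt z b)))) (trans (first (λ ())) (cong proj₁ (proj₂ (qt z′ b′))))))
        (not-involutive b′))))
  same (inj₂ (inj₂ (ρ , j))) (inj₂ (inj₂ (ρ′ , j′))) e (first , last , o) = cong (inj₂ ∘ inj₂)
    (cong₂ _,_ (toℕ-injective (suc-injective e)) (qs-inj j j′ (type-≡ y y m h h (qs j) (qs j′) (first (λ ()))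
      (last (λ z → <-irrefl (suc-injective z) (toℕ<n ρ))) o)))
  same (inj₂ (inj₁ _)) (inj₂ (inj₂ (ρ , _))) e _ = ⊥-elim (<-irrefl (suc-injective (sym e)) (toℕ<n ρ))
  same (inj₂ (inj₂ (ρ , _))) (inj₂ (inj₁ _)) e _ = ⊥-elim (<-irrefl (suc-injective e) (toℕ<n ρ))
  same (inj₁ _) (inj₂ (inj₁ _)) () _
  same (inj₁ _) (inj₂ (inj₂ _)) () _
  same (inj₂ (inj₁ _)) (inj₁ _) () _
  same (inj₂ (inj₂ _)) (inj₁ _) () _
  separated : ∀ i i′ →
    fac (φ∞^ k y) (off i + blk i * 2 ^ k) ((2 + m * 2) * 2 ^ k + 1)
      ∼[ suc k ] fac (φ∞^ k y) (off i′ + blk i′ * 2 ^ k) ((2 + m * 2) * 2 ^ k + 1) → i ≡ i′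
  separated i i′ p with ∼⇒odd k (suc A) y y m (blk i) (blk i′) (off i) (off i′) P≡ (off< i) (off< i′) p
  ... | inj₁ (o , t) = same i i′ o t
  -- The two cubes have opposite letters, so one of them is a cube of `not s`, which no chosen block
  -- starts.
  ... | inj₂ (c , cube , cube′) with c ≟ᵇ s
  ...   | yes refl = ⊥-elim (free i′ cube′)
  ...   | no c≢s = ⊥-elim (free i (subst (λ d → Cube d y (blk i)) (¬-not c≢s) cube))

-- Balance of the preimage

equal : Bool → Bool → Bool
equal false b = not b
equal true b = b

-- Once (g, g) is excluded, the sum of a pair is known from whether its two letters are equal. This
-- bounds the classes by 2 in `extremes-base`.
equal-sums : ∀ g a z a′ z′ → equal a z ≡ equal a′ z′ → ¬ (a ≡ g × z ≡ g) → ¬ (a′ ≡ g × z′ ≡ g) →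
  bit a + bit z ≡ bit a′ + bit z′
equal-sums g a z a′ z′ e n n′ = go (equal a z) (equal a′ z′) refl refl e
  where
  differ : ∀ a z → equal a z ≡ false → bit a + bit z ≡ 1
  differ false true _ = refl
  differ true false _ = refl
  agree : ∀ a z → equal a z ≡ true → ¬ (a ≡ g × z ≡ g) → bit a + bit z ≡ bit (not g) + bit (not g)
  agree false false _ n = cong (λ c → bit c + bit c) (¬-not (λ p → n (p , p)))
  agree true true _ n = cong (λ c → bit c + bit c) (¬-not (λ p → n (p , p)))
  go : ∀ c c′ → equal a z ≡ c → equal a′ z′ ≡ c′ → equal a z ≡ equal a′ z′ → bit a + bit z ≡ bit a′ + bit z′
  go false _ p q e = trans (differ a z p) (sym (differ a′ z′ (trans (sym e) p)))
  go true _ p q e = trans (agree a z p n) (sym (agree a′ z′ (trans (sym e) p) n′))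

extremes-base : ∀ m M y (h : Balanced y m) → Classes y 1 ((2 + m * 2) * 1) M → 3 ≤ M → ∀ g → ∃ (Extreme g y m h)
extremes-base m M y h C M≥ g with any? (λ a → extreme? g y m h (proj₁ C a))
... | yes (a , ex) = proj₁ C a , ex
... | no none = ⊥-elim (<-irrefl refl (≤-trans M≥ (classes-≤ C Bool↔
    (λ a → equal (y (proj₁ C a)) (proj₁ (h (suc (proj₁ C a))))) same)))
  where
  same : ∀ a b → equal (y (proj₁ C a)) (proj₁ (h (suc (proj₁ C a))))
    ≡ equal (y (proj₁ C b)) (proj₁ (h (suc (proj₁ C b)))) →
    fac y (proj₁ C a) ((2 + m * 2) * 1) ∼[ 1 ] fac y (proj₁ C b) ((2 + m * 2) * 1)
  same a b e = subst₂ (λ i i′ → fac y i ((2 + m * 2) * 1) ∼[ 1 ] fac y i′ ((2 + m * 2) * 1))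
    (*-identityʳ (proj₁ C a)) (*-identityʳ (proj₁ C b))
    (even⇒∼ 0 y y m h h (proj₁ C a) (proj₁ C b) 0 z<s ((λ _ → trans (ones-even y m h (proj₁ C a))
      (trans (cong (_+ m) (equal-sums g (y (proj₁ C a)) _ (y (proj₁ C b)) _ e (λ p → none (a , p)) (λ p → none (b , p))))
        (sym (ones-even y m h (proj₁ C b))))) , contradiction refl))

∼-ones : ∀ {j u v} → u ∼[ suc j ] v → ones u ≡ ones v
∼-ones {j} {u} {v} p = trans (sym (mom-0 u)) (trans (∼⇒≈ p 0 z<s) (mom-0 v))

classes-odd-base-𝐭 : ∀ m M → Classes 𝐭 1 (3 + m * 2) M → M ≤ 2
classes-odd-base-𝐭 m M C = classes-≤ C Bool↔ (λ a → proj₁ (𝐭-balanced (suc m) (proj₁ C a)))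
  (λ a b e → φ^-cong-↭ 0 (ones-↭ _ _ (trans (length-fac 𝐭 (proj₁ C a) (3 + m * 2)) (sym (length-fac 𝐭 (proj₁ C b) (3 + m * 2))))
    (trans (proj₂ (𝐭-balanced (suc m) (proj₁ C a)))
      (trans (cong (λ g → bit g + suc m) e) (sym (proj₂ (𝐭-balanced (suc m) (proj₁ C b))))))))

classes-odd-base-unbalanced : ∀ m M y (h : Balanced y m) → Classes y 1 (3 + m * 2) M →
  ∀ s q₀ → type y m h q₀ ≡ (s , s , s) →
  (∀ z b → ∃ λ q → type y m h q ≡ (not b , z , b)) → 3 ≤ M
classes-odd-base-unbalanced m M y h C s q₀ bad qt =
  classes-≥ C (⊎↔ (↔-sym 1↔⊤) Bool↔) pos (λ i i′ p → weights i i′ (+-cancelʳ-≡ m _ _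
    (trans (sym (weight-pos i)) (trans (∼-ones {u = fac y (pos i) (3 + m * 2)} {v = fac y (pos i′) (3 + m * 2)} p) (weight-pos i′)))))
  where
  pos : ⊤ ⊎ Bool → ℕ
  pos (inj₁ _) = q₀
  pos (inj₂ z) = proj₁ (qt z true)
  τ₀ : ⊤ ⊎ Bool → Triple
  τ₀ (inj₁ _) = s , s , s
  τ₀ (inj₂ z) = false , z , true
  weight-pos : ∀ i → ones (fac y (pos i) (3 + m * 2)) ≡ weight (τ₀ i) + m
  weight-pos (inj₁ _) = trans (ones-cover y m h q₀) (cong (λ t → weight t + m) bad)
  weight-pos (inj₂ z) = trans (ones-cover y m h _) (cong (λ t → weight t + m) (proj₂ (qt z true)))
  mixed : ∀ s z → weight (s , s , s) ≢ bit z + 1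
  mixed false false ()
  mixed false true ()
  mixed true false ()
  mixed true true ()
  weights : ∀ i i′ → weight (τ₀ i) ≡ weight (τ₀ i′) → i ≡ i′
  weights (inj₁ _) (inj₁ _) _ = refl
  weights (inj₁ _) (inj₂ z) e = ⊥-elim (mixed s z e)
  weights (inj₂ z) (inj₁ _) e = ⊥-elim (mixed s z (sym e))
  weights (inj₂ z) (inj₂ z′) e = cong inj₂ (bit-injective (+-cancelʳ-≡ 1 _ _ e))

alt : Bool → ℕ → Bool
alt c zero = c
alt c (suc e) = alt (not c) e

φ∞-cube : ∀ c y q → Cube c y q → ∀ e → e < 6 → φ∞ y (e + q * 2) ≡ alt c e
φ∞-cube c y q p 0 _ = trans (φ∞-even y q) (p 0 z<s)
φ∞-cube c y q p 1 _ = trans (φ∞-odd y q) (cong not (p 0 z<s))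
φ∞-cube c y q p 2 _ = trans (φ∞-even y (suc q)) (trans (p 1 (s≤s z<s)) (sym (not-involutive c)))
φ∞-cube c y q p 3 _ = trans (φ∞-odd y (suc q)) (cong not (trans (p 1 (s≤s z<s)) (sym (not-involutive c))))
φ∞-cube c y q p 4 _ = trans (φ∞-even y (2 + q)) (trans (p 2 (s≤s (s≤s z<s)))
  (trans (sym (not-involutive c)) (sym (not-involutive (not (not c))))))
φ∞-cube c y q p 5 _ = trans (φ∞-odd y (2 + q)) (cong not (trans (p 2 (s≤s (s≤s z<s)))
  (trans (sym (not-involutive c)) (sym (not-involutive (not (not c)))))))
φ∞-cube c y q p (suc (suc (suc (suc (suc (suc e)))))) (s≤s (s≤s (s≤s (s≤s (s≤s (s≤s ()))))))

φ∞-opposite-cubes : ∀ s y q q₀ → Cube (not s) y q → Cube s y q₀ → ∀ β e → e < 5 →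
  φ∞ y (e + (bit β + q * 2)) ≡ φ∞ y (e + (bit (not β) + q₀ * 2))
φ∞-opposite-cubes s y q q₀ p p₀ false e l = trans (φ∞-cube (not s) y q p e (m<n⇒m<1+n l))
  (trans (sym (φ∞-cube s y q₀ p₀ (suc e) (s≤s l))) (cong (φ∞ y) (sym (+-suc e (q₀ * 2)))))
φ∞-opposite-cubes s y q q₀ p p₀ true e l = trans (cong (φ∞ y) (+-suc e (q * 2)))
  (trans (φ∞-cube (not s) y q p (suc e) (s≤s l))
    (trans (cong (λ c → alt c e) (not-involutive s)) (sym (φ∞-cube s y q₀ p₀ e (m<n⇒m<1+n l)))))

-- φ(ccc) and φ(c̄c̄c̄) are the same alternating word up to a shift by one letter.
opposite-cubes : ∀ k y s q q₀ r → Cube (not s) y q → Cube s y q₀ → r < 2 ^ suc k →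
  ∃ λ r′ → r′ < 2 ^ suc k ×
    fac (φ∞^ (suc k) y) (r + q * 2 ^ suc k) (2 * 2 ^ suc k)
      ≡ fac (φ∞^ (suc k) y) (r′ + q₀ * 2 ^ suc k) (2 * 2 ^ suc k)
opposite-cubes k y s q q₀ r p p₀ r< with decompose k r
... | b , t , t< , r≡ = bool b refl
  where
  P = 2 ^ k
  lemma : ∀ t β q j P → j + (t + β * P + q * (2 * P)) ≡ (j + t) + (β + q * 2) * P
  lemma = solve-∀
  at-block : ∀ β q j e u → j + t ≡ u + e * P →
    j + (t + bit β * P + q * 2 ^ suc k) ≡ u + (e + (bit β + q * 2)) * P
  at-block β q j e u eq = trans (lemma t (bit β) q j P) (trans (cong (_+ (bit β + q * 2) * P) eq)
    (trans (+-assoc u _ _) (cong (u +_) (sym (*-distribʳ-+ P e _)))))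
  shifted : ∀ β → fac (φ∞^ (suc k) y) (t + bit β * P + q * 2 ^ suc k) (2 * 2 ^ suc k)
    ≡ fac (φ∞^ (suc k) y) (t + bit (not β) * P + q₀ * 2 ^ suc k) (2 * 2 ^ suc k)
  shifted β = fac-cong _ _ (2 * 2 ^ suc k) agree
    where
    agree : ∀ j → j < 2 * 2 ^ suc k → φ∞^ (suc k) y (j + (t + bit β * P + q * 2 ^ suc k))
      ≡ φ∞^ (suc k) y (j + (t + bit (not β) * P + q₀ * 2 ^ suc k))
    agree j j< with decompose k (j + t)
    ... | e , u , u< , eq = subst₂ (λ a b → φ∞^ (suc k) y a ≡ φ∞^ (suc k) y b)
        (sym (at-block β q j e u eq)) (sym (at-block (not β) q₀ j e u eq))
        (letter k (φ∞ y) (φ∞ y) (e + (bit β + q * 2)) (e + (bit (not β) + q₀ * 2)) u u< (φ∞-opposite-cubes s y q q₀ p p₀ β e e<5))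
      where
      five : ∀ P → 2 * (2 * P) + P ≡ 5 * P
      five = solve-∀
      -- The window has length 4P and starts less than P after the start of a half block, so it
      -- meets at most five half blocks. This is the overlap of two alternating words of length 6
      -- shifted by one.
      e<5 : e < 5
      e<5 = *-cancelʳ-< P e 5 (≤-<-trans (m≤n+m (e * P) u) (≤-<-trans (≤-reflexive (sym eq))
        (<-≤-trans (+-mono-< j< t<) (≤-reflexive (five P)))))
  t+P< : t + 1 * P < 2 ^ suc k
  t+P< = <-≤-trans (+-monoˡ-< (1 * P) t<) (≤-reflexive (cong (P +_) refl))
  t+0< : t + 0 * P < 2 ^ suc k
  t+0< = ≤-<-trans (≤-reflexive (+-identityʳ t)) (<-≤-trans t< (m≤m+n P _))
  b<2 : b < 2
  b<2 = *-cancelʳ-< P b 2 (≤-<-trans (m≤n+m (b * P) t) (≤-<-trans (≤-reflexive (sym r≡)) r<))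
  bool : ∀ b′ → b′ ≡ b → ∃ λ r′ → r′ < 2 ^ suc k ×
    fac (φ∞^ (suc k) y) (r + q * 2 ^ suc k) (2 * 2 ^ suc k)
      ≡ fac (φ∞^ (suc k) y) (r′ + q₀ * 2 ^ suc k) (2 * 2 ^ suc k)
  bool 0 refl = t + 1 * P , t+P< , trans (cong (λ i → fac (φ∞^ (suc k) y) (i + q * 2 ^ suc k) (2 * 2 ^ suc k)) r≡) (shifted false)
  bool 1 refl = t + 0 * P , t+0< , trans (cong (λ i → fac (φ∞^ (suc k) y) (i + q * 2 ^ suc k) (2 * 2 ^ suc k)) r≡) (shifted true)
  bool (suc (suc b′)) refl = ⊥-elim (n≮0 (≤-pred (≤-pred b<2)))

Normal : ∀ (k m : ℕ) (y : InfWord) (Good : ℕ → Set) → Set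
Normal k m y Good = ∀ i → ∃ λ q → ∃ λ r → r < 2 ^ k ×
  fac (φ∞^ k y) i ((2 + m * 2) * 2 ^ k) ≡ fac (φ∞^ k y) (r + q * 2 ^ k) ((2 + m * 2) * 2 ^ k)
  × (r ≢ 0 → Good q)

normal-free : ∀ k m y {Good : ℕ → Set} → (∀ q → Good q) → Normal k m y Good
normal-free k m y good i with decompose k i
... | q , r , r< , e = q , r , r< , cong (λ j → fac (φ∞^ k y) j ((2 + m * 2) * 2 ^ k)) e , λ _ → good q

cube? : ∀ c y q → Dec (Cube c y q)
cube? c y q with y q ≟ᵇ c | y (suc q) ≟ᵇ c | y (2 + q) ≟ᵇ c
... | no n | _ | _ = no (λ p → n (p 0 z<s))
... | yes _ | no n | _ = no (λ p → n (p 1 (s≤s z<s)))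
... | yes _ | yes _ | no n = no (λ p → n (p 2 (s≤s (s≤s z<s))))
... | yes a | yes b | yes d = yes λ { 0 _ → a ; 1 _ → b ; 2 _ → d ; (suc (suc (suc _))) (s≤s (s≤s (s≤s ()))) }

cube-opposite : ∀ {s y q} → Cube s y q → ¬ Cube (not s) y q
cube-opposite p p′ = not-¬ (p 0 z<s) (p′ 0 z<s)

-- A window over the cube opposite to the one at q₀ is literally a window over q₀ with another
-- offset, and q₀ itself is harmless.
normal-cube : ∀ k y s q₀ → Cube s y q₀ → Normal (suc k) 0 y (λ q → ¬ Cube (not s) y q)
normal-cube k y s q₀ p₀ i with decompose (suc k) i
... | q , r , r< , e with cube? (not s) y q
...   | no ¬cube = q , r , r< , cong (λ j → fac (φ∞^ (suc k) y) j (2 * 2 ^ suc k)) e , λ _ → ¬cube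
...   | yes cube with opposite-cubes k y s q q₀ r cube p₀ r<
...     | r′ , r′< , e′ = q₀ , r′ , r′< ,
  trans (cong (λ j → fac (φ∞^ (suc k) y) j (2 * 2 ^ suc k)) e) e′ , λ _ → cube-opposite {s} {y} {q₀} p₀

pred-2^ : ∀ k → ∃ λ A → suc (suc A) ≡ 2 ^ suc k
pred-2^ k with 2 ^ k | m^n>0 2 k
... | suc n | _ = n + n , cong suc (trans (sym (+-suc n n)) (cong (n +_) (cong suc (sym (+-identityʳ n)))))

extremes : ∀ k m y (h : Balanced y m) → SameBinomComplexity (suc k) (φ∞^ k y) (φ∞^ k 𝐭) → ∀ g → ∃ (Extreme g y m h)
extremes k m y h S = go k C C-𝐭
  where
  M = proj₁ (S ((2 + m * 2) * 2 ^ k))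
  C : Classes (φ∞^ k y) (suc k) ((2 + m * 2) * 2 ^ k) M
  C = classes (proj₁ (proj₂ (S ((2 + m * 2) * 2 ^ k))))
  C-𝐭 : Classes (φ∞^ k 𝐭) (suc k) ((2 + m * 2) * 2 ^ k) M
  C-𝐭 = classes (proj₂ (proj₂ (S ((2 + m * 2) * 2 ^ k))))
  go : ∀ {M} k → Classes (φ∞^ k y) (suc k) ((2 + m * 2) * 2 ^ k) M →
    Classes (φ∞^ k 𝐭) (suc k) ((2 + m * 2) * 2 ^ k) M → ∀ g → ∃ (Extreme g y m h)
  go {M} zero C C-𝐭 = extremes-base m M y h C (classes-even-𝐭 0 0 m M refl C-𝐭)
  go {M} (suc k) C C-𝐭 = six-types⇒extremes y m h (proj₁ six) (proj₁ (proj₂ six))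
    where
    A = proj₁ (pred-2^ k)
    P≡ = proj₂ (pred-2^ k)
    six = six-types (suc k) (suc A) m M y h P≡ (s≤s z≤n) C
      (classes-even-𝐭 (suc k) (suc A) m M P≡ C-𝐭) (λ _ → ⊤) (normal-free (suc k) m y (λ _ → tt))

balanced-0 : ∀ y → Balanced y 0
balanced-0 y q = y q , refl

-- For positive m, balanced windows of length 3 rule out cubes. For m = 0 the unbalanced window is
-- itself a cube of s, and windows over opposite cubes are rewritten as windows over it.
balanced-suc : ∀ k m y → PrefixRecurrent y → Balanced y m → m ≡ 0 ⊎ Balanced y 1 →
  SameBinomComplexity (suc k) (φ∞^ k y) (φ∞^ k 𝐭) → Balanced y (suc m)
balanced-suc k m y rec h cubes S = notAllEqual⇒balanced y m h
  (λ q (e , f) → absurd k S (y q) q (cong₂ _,_ refl (cong₂ _,_ (sym e) (sym (trans e f)))))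
  where
  qt : ∀ k → SameBinomComplexity (suc k) (φ∞^ k y) (φ∞^ k 𝐭) → ∀ z b → ∃ λ q → type y m h q ≡ (not b , z , b)
  qt k S = transitions y m h rec (extremes k m y h S)
  absurd : ∀ k → SameBinomComplexity (suc k) (φ∞^ k y) (φ∞^ k 𝐭) → ∀ s q₀ → type y m h q₀ ≡ (s , s , s) → ⊥
  absurd zero S s q₀ bad with S (3 + m * 2)
  ... | M , C , C-𝐭 = <-irrefl refl (≤-trans
      (classes-odd-base-unbalanced m M y h (classes C) s q₀ bad (qt 0 S)) (classes-odd-base-𝐭 m M (classes C-𝐭)))
  absurd (suc k) S s q₀ bad with pred-2^ k | S ((2 + m * 2) * 2 ^ suc k) | S ((2 + m * 2) * 2 ^ suc k + 1)
  ... | A , P≡ | M , C , C-𝐭 | M′ , C′ , C-𝐭′ = <-irrefl refl (≤-trans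
      (classes-odd-unbalanced (suc k) A m M′ y h P≡ (classes C′) s q₀ bad (qt (suc k) S) (qt-free cubes)
        (proj₁ six) (proj₁ (proj₂ six)) (proj₂ (proj₂ six)))
      (classes-odd-𝐭 (suc k) A m M′ P≡ (classes C-𝐭′)))
    where
    normal : m ≡ 0 ⊎ Balanced y 1 → Normal (suc k) m y (λ q → ¬ Cube (not s) y q)
    normal (inj₂ h₁) = normal-free (suc k) m y (λ q → cube-free y (not s) q h₁)
    normal (inj₁ refl) = normal-cube k y s q₀ λ
      { 0 _ → cong proj₁ bad
      ; 1 _ → bit-+-injective 0 (trans (proj₂ (h (suc q₀))) (cong (λ t → bit (proj₁ (proj₂ t)) + 0) bad))
      ; 2 _ → cong (proj₂ ∘ proj₂) bad
      ; (suc (suc (suc _))) (s≤s (s≤s (s≤s ()))) }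
    six = six-types (suc k) (suc A) m M y h P≡ (s≤s z≤n) (classes C)
      (classes-even-𝐭 (suc k) (suc A) m M P≡ (classes C-𝐭)) (λ q → ¬ Cube (not s) y q) (normal cubes)
    qt-free : m ≡ 0 ⊎ Balanced y 1 → ∀ z b → ¬ Cube (not s) y (proj₁ (qt (suc k) S z b))
    qt-free (inj₂ h₁) z b = cube-free y (not s) _ h₁
    -- For m = 0 the type lists three consecutive letters, and its outer ones differ.
    qt-free (inj₁ refl) z b p = not≢ b (trans (sym (cong proj₁ (proj₂ (qt (suc k) S z b))))
      (trans (trans (p 0 z<s) (sym (p 2 (s≤s (s≤s z<s))))) (cong (proj₂ ∘ proj₂) (proj₂ (qt (suc k) S z b)))))

all-balanced : ∀ k y → PrefixRecurrent y →
  SameBinomComplexity (suc k) (φ∞^ k y) (φ∞^ k 𝐭) → ∀ m → Balanced y m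
all-balanced k y rec S zero = balanced-0 y
all-balanced k y rec S (suc zero) = balanced-suc k 0 y rec (balanced-0 y) (inj₁ refl) S
all-balanced k y rec S (suc (suc m)) =
  balanced-suc k (suc m) y rec (all-balanced k y rec S (suc m)) (inj₂ (all-balanced k y rec S 1)) S

-- Squares and desubstitution

-- A square cc next to a window of odd length must be compensated there, so the heavier letter of
-- that window is the opposite of c.
square-side : ∀ c g g′ → bit c + bit c + bit g ≡ bit g′ + 1 → g ≡ not c
square-side false true false _ = refl
square-side true false true _ = refl
square-side false false false ()
square-side false false true ()
square-side false true true ()
square-side true false false ()
square-side true true false ()
square-side true true true ()

squares-clash : ∀ c d g g₁ g₂ g₃ → bit c + bit c + bit g ≡ bit g₁ + 1 → bit d + bit d + bit g ≡ bit g₂ + 1 →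
  bit c + bit c + bit g + (bit d + bit d) ≡ bit g₃ + 2 → ⊥
squares-clash c d g g₁ g₂ g₃ e₁ e₂ e₃ with square-side c g g₁ e₁ | square-side d g g₂ e₂
squares-clash false false _ g₁ g₂ false e₁ e₂ () | refl | refl
squares-clash false false _ g₁ g₂ true e₁ e₂ () | refl | refl
squares-clash true true _ g₁ g₂ false e₁ e₂ () | refl | refl
squares-clash true true _ g₁ g₂ true e₁ e₂ () | refl | refl
squares-clash false true _ g₁ g₂ g₃ e₁ e₂ e₃ | refl | ()
squares-clash true false _ g₁ g₂ g₃ e₁ e₂ e₃ | refl | ()

Square : InfWord → ℕ → Set
Square y p = y p ≡ y (suc p)

-- The odd window between the two squares compensates both, so they use the same letter; together
-- the two squares and this window are then unbalanced. At distance 1 the squares overlap in a cube.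
squares-distance : ∀ y → (∀ m → Balanced y m) → ∀ p m → Square y p → ¬ Square y (suc (m * 2) + p)
squares-distance y h p zero s s′ = cube-free y (y p) p (h 1) λ
  { 0 _ → refl ; 1 _ → sym s ; 2 _ → sym (trans s s′) ; (suc (suc (suc _))) (s≤s (s≤s (s≤s ()))) }
squares-distance y h p (suc m) s s′ = squares-clash c d g g₁ g₂ g₃
    (+-cancelʳ-≡ m _ _ (trans (lemma₁ (bit c) (bit g) m) (trans (sym ones-left) (trans (proj₂ (h (suc m) p)) (lemma₂ (bit g₁) m)))))
    (+-cancelʳ-≡ m _ _ (trans (lemma₃ (bit d) (bit g) m) (trans (sym ones-right) (trans (proj₂ (h (suc m) (2 + p))) (lemma₂ (bit g₂) m)))))
    (+-cancelʳ-≡ m _ _ (trans (lemma₄ (bit c) (bit d) (bit g) m) (trans (sym ones-both) (trans (proj₂ (h (2 + m) p)) (lemma₅ (bit g₃) m)))))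
  where
  n = suc (m * 2)
  c = y p
  d = y (suc (suc m * 2) + p)
  g = proj₁ (h m (2 + p))
  g₁ = proj₁ (h (suc m) p)
  g₂ = proj₁ (h (suc m) (2 + p))
  g₃ = proj₁ (h (2 + m) p)
  shift-index : ∀ m p → suc m + suc (suc p) ≡ suc (suc (suc m)) + p
  shift-index = solve-∀
  ones-left : ones (fac y p (2 + n)) ≡ bit c + (bit c + (bit g + m))
  ones-left = cong (bit c +_) (cong₂ (λ a b → bit a + b) (sym s) (proj₂ (h m (2 + p))))
  ones-right : ones (fac y (2 + p) (2 + n)) ≡ bit g + m + (bit d + (bit d + 0))
  ones-right = trans (cong (λ l → ones (fac y (2 + p) l)) (+-comm 2 n))
    (trans (cong ones (fac-++ y (2 + p) n 2)) (trans (ones-++ (fac y (2 + p) n) _)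
      (cong₂ _+_ (proj₂ (h m (2 + p))) (trans (cong (λ i → ones (fac y i 2)) (shift-index (m * 2) p))
        (cong (λ a → bit d + (bit a + 0)) (sym s′))))))
  ones-both : ones (fac y p (4 + n)) ≡ bit c + (bit c + (bit g + m + (bit d + (bit d + 0))))
  ones-both = cong (bit c +_) (cong₂ (λ a b → bit a + b) (sym s) ones-right)
  lemma₁ : ∀ c g m → c + c + g + m ≡ c + (c + (g + m))
  lemma₁ = solve-∀
  lemma₂ : ∀ g m → g + suc m ≡ g + 1 + m
  lemma₂ = solve-∀
  lemma₃ : ∀ d g m → d + d + g + m ≡ g + m + (d + (d + 0))
  lemma₃ = solve-∀
  lemma₄ : ∀ c d g m → c + c + g + (d + d) + m ≡ c + (c + (g + m + (d + (d + 0))))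
  lemma₄ = solve-∀
  lemma₅ : ∀ g m → g + suc (suc m) ≡ g + 2 + m
  lemma₅ = solve-∀

opposite-parity : ∀ ρ p j → (∃ λ m → bit (not ρ) + j * 2 ≡ suc (m * 2) + (bit ρ + p * 2))
  ⊎ (∃ λ m → bit ρ + p * 2 ≡ suc (m * 2) + (bit (not ρ) + j * 2))
opposite-parity false p j = even-odd p j
  where
  even-odd : ∀ p j → (∃ λ m → suc (j * 2) ≡ suc (m * 2) + p * 2) ⊎ (∃ λ m → p * 2 ≡ suc (m * 2) + suc (j * 2))
  even-odd zero j = inj₁ (j , cong suc (sym (+-identityʳ _)))
  even-odd (suc p) zero = inj₂ (p , sym (trans (+-suc (suc (p * 2)) 0) (cong (suc ∘ suc) (+-identityʳ _))))
  even-odd (suc p) (suc j) with even-odd p j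
  ... | inj₁ (m , e) = inj₁ (m , trans (cong (suc ∘ suc) e) (lemma (m * 2) (p * 2)))
    where
    lemma : ∀ m p → suc (suc (suc m + p)) ≡ suc m + suc (suc p)
    lemma = solve-∀
  ... | inj₂ (m , e) = inj₂ (m , trans (cong (suc ∘ suc) e) (lemma (m * 2) (j * 2)))
    where
    lemma : ∀ m j → suc (suc (suc m + suc j)) ≡ suc m + suc (suc (suc j))
    lemma = solve-∀
opposite-parity true p j with opposite-parity false j p
... | inj₁ x = inj₂ x
... | inj₂ x = inj₁ x

squares-parity : ∀ y → (∀ m → Balanced y m) → ∀ ρ p → Square y (bit ρ + p * 2) →
  ∀ j → y (suc (bit (not ρ) + j * 2)) ≡ not (y (bit (not ρ) + j * 2))
squares-parity y h ρ p s j = ¬-not (λ e → clash (sym e))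
  where
  clash : ¬ Square y (bit (not ρ) + j * 2)
  clash s′ with opposite-parity ρ p j
  ... | inj₁ (m , e) = squares-distance y h (bit ρ + p * 2) m s (subst (Square y) e s′)
  ... | inj₂ (m , e) = squares-distance y h (bit (not ρ) + j * 2) m s′ (subst (Square y) e s)

φ∞-pairs : ∀ (z : InfWord) → (∀ i → z (suc (i * 2)) ≡ not (z (i * 2))) → ∀ n → z n ≡ φ∞ (λ i → z (i * 2)) n
φ∞-pairs z p n with halve n
... | false , i , refl = sym (φ∞-even (λ i → z (i * 2)) i)
... | true , i , refl = trans (p i) (sym (φ∞-odd (λ i → z (i * 2)) i))

φ∞^-head : ∀ k y q → φ∞^ k y (q * 2 ^ k) ≡ y q
φ∞^-head zero y q = cong y (*-identityʳ q)
φ∞^-head (suc k) y q = trans (cong (φ∞^ k (φ∞ y)) (sym (*-assoc q 2 (2 ^ k))))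
  (trans (φ∞^-head k (φ∞ y) (q * 2)) (φ∞-even y q))

φ∞^-shift : ∀ k y n → φ∞^ k y (n + 2 ^ k) ≡ φ∞^ k (y ∘ suc) n
φ∞^-shift zero y n = cong y (+-comm n 1)
φ∞^-shift (suc k) y n = trans (cong (φ∞^ k (φ∞ y)) (lemma n (2 ^ k)))
  (trans (φ∞^-shift k (φ∞ y) (n + 2 ^ k)) (φ∞^-shift k (φ∞ y ∘ suc) n))
  where
  lemma : ∀ n P → n + 2 * P ≡ (n + P) + P
  lemma = solve-∀

binomComplexity-transfer : ∀ {x x′ j n M} →
  (∀ w → IsFactor x w → IsFactor x′ w) → (∀ w → IsFactor x′ w → IsFactor x w) →
  BinomComplexity x j n M → BinomComplexity x′ j n M
binomComplexity-transfer to from (r , factor , distinct , cover) =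
  r , (λ a → to (r a) (proj₁ (factor a)) , proj₂ (factor a)) , distinct , λ w f → cover w (from w f)

factor-cong : ∀ {x x′} → (∀ n → x n ≡ x′ n) → ∀ w → IsFactor x w → IsFactor x′ w
factor-cong e w (i , p) = i , trans (fac-cong i i (length w) (λ j _ → sym (e (j + i)))) p

-- x = u φ^k(y) with |u| = offset < 2^k, and long prefixes of x only recur at multiples of 2^k.
record Desubstituted (k : ℕ) (x : InfWord) : Set where
  field
    offset : ℕ
    offset< : offset < 2 ^ k
    preimage : InfWord
    tail : ∀ n → x (n + offset) ≡ φ∞^ k preimage n
    range : ℕ
    sync : ∀ i → (∀ j → j < range → x (j + i) ≡ x j) → ∃ λ i₁ → i ≡ i₁ * 2 ^ k

  preimage-agree : ∀ i M → (∀ j → j < M * 2 ^ k + offset → x (j + i * 2 ^ k) ≡ x j) →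
    ∀ j → j < M → preimage (j + i) ≡ preimage j
  preimage-agree i M agree j j<M = begin
    preimage (j + i)                      ≡⟨ sym (φ∞^-head k preimage (j + i)) ⟩
    φ∞^ k preimage ((j + i) * 2 ^ k)      ≡⟨ sym (tail _) ⟩
    x ((j + i) * 2 ^ k + offset)          ≡⟨ cong x (lemma j i (2 ^ k) offset) ⟩
    x (j * 2 ^ k + offset + i * 2 ^ k)    ≡⟨ agree _ (+-monoˡ-< offset (*-monoˡ-< (2 ^ k) {{m^n≢0 2 k}} j<M)) ⟩
    x (j * 2 ^ k + offset)                ≡⟨ tail _ ⟩
    φ∞^ k preimage (j * 2 ^ k)            ≡⟨ φ∞^-head k preimage j ⟩
    preimage j ∎
    where
    open ≡-Reasoning
    lemma : ∀ j i P r → (j + i) * P + r ≡ j * P + r + i * P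
    lemma = solve-∀

  preimage-recurrent : PrefixRecurrent x → PrefixRecurrent preimage
  preimage-recurrent rec M B with rec (range + (M * 2 ^ k + offset)) (B * 2 ^ k)
  ... | i , B≤i , agree with sync i (λ j l → agree j (<-≤-trans l (m≤m+n range _)))
  ... | i₁ , refl = i₁ , *-cancelʳ-≤ B i₁ (2 ^ k) {{m^n≢0 2 k}} B≤i ,
    preimage-agree i₁ M (λ j l → agree j (<-≤-trans l (m≤n+m _ range)))

  tail-factor : Recurrent x → ∀ w → IsFactor x w → IsFactor (φ∞^ k preimage) w
  tail-factor rec w (i , p) with rec i (length w) offset
  ... | i′ , r≤i′ , e = i′ ∸ offset , trans (fac-cong (i′ ∸ offset) i′ (length w) (λ j _ →
    trans (sym (tail _)) (cong x (trans (+-assoc j _ offset) (cong (j +_) (m∸n+n≡m r≤i′)))))) (trans e p)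

  factor-tail : ∀ w → IsFactor (φ∞^ k preimage) w → IsFactor x w
  factor-tail w (i , p) = i + offset , trans (fac-cong (i + offset) i (length w) (λ j _ →
    trans (cong x (sym (+-assoc j i offset))) (tail (j + i)))) p

  -- By recurrence, removing the prefix loses no factors, and `𝐭` is fixed by φ^k.
  tail-complexity : Recurrent x → ∀ {j} → SameBinomComplexity j x 𝐭 →
    SameBinomComplexity j (φ∞^ k preimage) (φ∞^ k 𝐭)
  tail-complexity rec S n with S n
  ... | M , C , C-𝐭 = M , binomComplexity-transfer (tail-factor rec) factor-tail C ,
    binomComplexity-transfer (factor-cong (𝐭-fixed^ k)) (factor-cong (λ n → sym (𝐭-fixed^ k n))) C-𝐭

prefixRecurrent : ∀ {x} → Recurrent x → PrefixRecurrent x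
prefixRecurrent {x} rec N B with rec 0 N B
... | i , B≤i , e = i , B≤i , λ j l → trans (fac-lookup i 0 N e j l) (cong x (+-identityʳ j))

desubstitute : ∀ k x → Recurrent x → SameBinomComplexity (suc k) x 𝐭 → Desubstituted k x → Desubstituted (suc k) x
desubstitute k x rec S D = result (halve p)
  where
  open Desubstituted D renaming (preimage to y)
  S′ = tail-complexity rec S
  balanced : ∀ m → Balanced y m
  balanced = all-balanced k y (preimage-recurrent (prefixRecurrent rec)) S′
  -- For m = 0 an extreme window has length 2, so this is an occurrence of 11, the required square.
  extreme = extremes k 0 y (balanced-0 y) S′ true
  p = proj₁ extreme
  square : Square y p
  square = trans (proj₁ (proj₂ extreme)) (sym (proj₂ (proj₂ extreme)))
  range′ = range + ((2 + p) * 2 ^ k + offset)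
  sync′ : ∀ i → (∀ j → j < range′ → x (j + i) ≡ x j) → ∃ λ i₁ → i ≡ i₁ * 2 ^ suc k
  sync′ i agree with sync i (λ j l → agree j (<-≤-trans l (m≤m+n range _)))
  ... | i₁ , refl with halve i₁
  ...   | false , i₂ , refl = i₂ , *-assoc i₂ 2 (2 ^ k)
  -- A return after an odd number of blocks copies the square at p to an odd distance.
  ...   | true , i₂ , refl = ⊥-elim (squares-distance y balanced p i₂ square
      (subst (Square y) (+-comm p _) (trans (same p (m<n⇒m<1+n (n<1+n p))) (trans square (sym (same (suc p) (n<1+n (suc p))))))))
    where
    same : ∀ j → j < 2 + p → y (j + suc (i₂ * 2)) ≡ y j
    same = preimage-agree (suc (i₂ * 2)) (2 + p) (λ j l → agree j (<-≤-trans l (m≤n+m _ range)))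
  result : (∃ λ ρ → ∃ λ p₀ → p ≡ bit ρ + p₀ * 2) → Desubstituted (suc k) x
  result (true , p₀ , e) = record
    { offset = offset
    ; offset< = <-≤-trans offset< (m≤m+n (2 ^ k) _)
    ; preimage = λ i → y (i * 2)
    ; tail = λ n → trans (tail n) (φ∞^-cong k (φ∞-pairs y (squares-parity y balanced true p₀ (subst (Square y) e square))) n)
    ; range = range′
    ; sync = sync′ }
  -- Squares at even positions mean that the pairs of y start at odd positions, so the first block
  -- of y joins the prefix.
  result (false , p₀ , e) = record
    { offset = 2 ^ k + offset
    ; offset< = <-≤-trans (+-monoʳ-< (2 ^ k) offset<) (≤-reflexive (cong (2 ^ k +_) (sym (+-identityʳ (2 ^ k)))))
    ; preimage = λ i → y (suc (i * 2))
    ; tail = λ n → trans (cong x (sym (+-assoc n (2 ^ k) offset))) (trans (tail (n + 2 ^ k))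
        (trans (φ∞^-shift k y n) (φ∞^-cong k (φ∞-pairs (y ∘ suc)
          (squares-parity y balanced false p₀ (subst (Square y) e square))) n)))
    ; range = range′
    ; sync = sync′ }

desubstituted : ∀ K x → Recurrent x → TM K x → ∀ k → k ≤ K → Desubstituted k x
desubstituted K x rec tm zero _ = record
  { offset = 0 ; offset< = z<s ; preimage = x ; tail = λ n → cong x (+-identityʳ n)
  ; range = 0 ; sync = λ i _ → i , sym (*-identityʳ i) }
desubstituted K x rec tm (suc k) l = desubstitute k x rec (tm (suc k) (s≤s z≤n) l)
  (desubstituted K x rec tm k (≤-trans (n≤1+n k) l))

-- The prefix as a suffix of a block

·-prefix : ∀ x s i r → (∀ n → x (n + (r + i)) ≡ s n) → ∀ n → x (n + i) ≡ (fac x i r · s) n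
·-prefix x s i zero p n = p n
·-prefix x s i (suc r) p zero = refl
·-prefix x s i (suc r) p (suc n) = trans (cong x (sym (+-suc n i)))
  (·-prefix x s (suc i) r (λ n → trans (cong (λ j → x (n + j)) (+-suc r i)) (p n)) n)

theorem5p2 : (x : InfWord) (k : ℕ) → 1 ≤ k → Recurrent x → TM k x →
    ∃ λ (y : InfWord) → ∃ λ u →
    (ProperSuffix u (φ^ k (false ∷ [])) ⊎ ProperSuffix u (φ^ k (true ∷ [])))
    × (∀ n → x n ≡ (u · φ∞^ k y) n)
theorem5p2 x k _ rec tm = y , fac x 0 offset , by-letter (y i₂) refl ,
    λ n → trans (cong x (sym (+-identityʳ n)))
      (·-prefix x (φ∞^ k y) 0 offset (λ n → trans (cong (λ j → x (n + j)) (+-identityʳ offset)) (tail n)) n)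
  where
  open Desubstituted (desubstituted k x rec tm k ≤-refl) renaming (preimage to y)
  P = 2 ^ k
  X = φ∞^ k y
  -- A later occurrence of a long prefix of x is preceded by a complete block.
  later : ∃ λ i → ∀ j → j < offset → x (j + suc i * P) ≡ x j
  later with prefixRecurrent rec (range + offset) P
  ... | i , P≤i , agree with sync i (λ j l → agree j (<-≤-trans l (m≤m+n range offset)))
  -- The return was requested at distance at least 2ᵏ precisely to exclude the prefix itself and
  -- leave room for a block before it.
  ...   | zero , refl = ⊥-elim (<-irrefl refl (<-≤-trans (m^n>0 2 k) P≤i))
  ...   | suc i₂ , refl = i₂ , λ j l → agree j (<-≤-trans l (m≤n+m offset range))
  i₂ = proj₁ later
  d = P ∸ offset
  v = fac X (i₂ * P) d
  d+offset : d + offset ≡ P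
  d+offset = m∸n+n≡m (<⇒≤ offset<)
  v≢[] : v ≢ []
  v≢[] e = <-irrefl (trans (sym (cong length e)) (length-fac X (i₂ * P) d)) (m<n⇒0<n∸m offset<)
  -- The tail begins `offset` letters into `x`, so a return at a multiple of 2ᵏ fills the last
  -- `offset` letters of block i₂ of the tail.
  suffix : v ++ fac x 0 offset ≡ φ^ k (y i₂ ∷ [])
  suffix = begin
    v ++ fac x 0 offset
      ≡⟨ cong (v ++_) (fac-cong 0 (d + i₂ * P) offset (λ j l → trans (cong x (+-identityʳ j))
           (trans (sym (proj₂ later j l)) (trans (cong x (index j)) (tail _))))) ⟩
    v ++ fac X (d + i₂ * P) offset        ≡⟨ sym (fac-++ X (i₂ * P) d offset) ⟩
    fac X (i₂ * P) (d + offset)           ≡⟨ cong (fac X (i₂ * P)) (trans d+offset (sym (*-identityˡ P))) ⟩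
    fac X (i₂ * P) (1 * P)                ≡⟨ fac-φ^ k y i₂ 1 ⟩
    φ^ k (y i₂ ∷ []) ∎
    where
    open ≡-Reasoning
    lemma : ∀ j d r t → j + (d + r + t) ≡ j + (d + t) + r
    lemma = solve-∀
    index : ∀ j → j + suc i₂ * P ≡ (j + (d + i₂ * P)) + offset
    index j = trans (cong (λ z → j + (z + i₂ * P)) (sym d+offset)) (lemma j d offset (i₂ * P))
  by-letter : ∀ a → y i₂ ≡ a →
    ProperSuffix (fac x 0 offset) (φ^ k (false ∷ [])) ⊎ ProperSuffix (fac x 0 offset) (φ^ k (true ∷ []))
  by-letter false e = inj₁ (v , v≢[] , trans suffix (cong (λ a → φ^ k (a ∷ [])) e))
  by-letter true e = inj₂ (v , v≢[] , trans suffix (cong (λ a → φ^ k (a ∷ [])) e))
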